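{- Let $q$ be a prime power and let $A=(a_{ij})\in\mathbb{F}_q^{m\times k}$ be the coefficient matrix of a linear system $(\star)$: $\sum_{j=1}^k a_{ij}x_j=0$ for $i\in[m]$, in unknowns $x_1,\dots,x_k\in\mathbb{F}_q^n$. Assume $(\star)$ is a type (RC) linear system that is non-degenerate and irreducible, with $\ell$ column equivalence classes. Then there exist constants $\beta,\gamma>0$ with $\gamma<q$ such that for every $n$, every subset $S\subseteq\mathbb{F}_q^n$ of size at least $\beta\gamma^n$ contains a solution $(x_1,\dots,x_k)\in S^k$ of $(\star)$ such that: (i) every balanced linear equation satisfied by $(x_1,\dots,x_k)$ preserves the column equivalence classes of $(\star)$; (ii) $\dim(\mathrm{aff}(x_1,\dots,x_k))\ge\min(k-\ell,\,k-2)$.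
   Context: $(\star)$ is balanced if every row of $A$ sums to zero. Indices $j,j'\in[k]$ are equivalent if the $j$-th and $j'$-th columns of $A$ are nonzero scalar multiples of one another; the classes are the column equivalence classes. $(\star)$ is of type (RC) if it is balanced and has at most one column equivalence class of size $1$. Non-degenerate: rows of $A$ linearly independent and every column nonzero. Two systems are equivalent if each equation of either is a linear combination of the equations of the other; $(\star)$ is reducible if it is equivalent to a system whose variables can be partitioned into two or more classes such that each equation only uses variables of one class, and irreducible otherwise. A balanced linear equation satisfied by $(x_1,\dots,x_k)$ is $b_1x_1+\dots+b_kx_k=0$ with $b\in\mathbb{F}_q^k$, $b_1+\dots+b_k=0$; it preserves the column equivalence classes of $(\star)$ if appending the row $b$ to $A$ yields a matrix with the same column equivalence classes as $A$. $\mathrm{aff}$ denotes affine hull and $\dim$ the dimension of an affine subspace. -}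

module Defs where

open import Level using (0ℓ)
open import Data.Nat using (ℕ; zero; suc; _≤_)
open import Data.Fin using (Fin; zero; suc)
open import Data.Product using (Σ; ∃; ∃-syntax; _×_; _,_)
open import Data.List using (List; length)
open import Data.List.Membership.Propositional using (_∈_)
open import Data.List.Relation.Unary.AllPairs using (AllPairs)
open import Data.Vec using (Vec; tabulate; lookup)
open import Data.Vec.Functional using (_∷_)
open import Function using (_↔_)
open import Relation.Nullary using (¬_; Dec)
open import Relation.Binary.PropositionalEquality using (_≡_; _≢_)
open import Algebra.Structures using (IsCommutativeRing)

-- A finite field with q elements (q is then automatically a prime power).

record FiniteField : Set₁ where
  field
    Carrier  : Set
    _+_ _*_  : Carrier → Carrier → Carrier
    -_       : Carrier → Carrier
    0# 1#    : Carrier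
    isCommutativeRing : IsCommutativeRing _≡_ _+_ _*_ -_ 0# 1#
    0≢1      : 0# ≢ 1#
    inverse  : ∀ x → x ≢ 0# → ∃[ y ] (x * y ≡ 1#)
    _≟_      : (x y : Carrier) → Dec (x ≡ y)
    size     : ℕ
    enum     : Fin size ↔ Carrier

module Lin (F : FiniteField) where
  open FiniteField F

  sumF : ∀ {k} → (Fin k → Carrier) → Carrier
  sumF {zero}  f = 0#
  sumF {suc k} f = f zero + sumF (λ j → f (suc j))

  Matrix : ℕ → ℕ → Set
  Matrix m k = Fin m → Fin k → Carrier

  Point : ℕ → Set
  Point n = Vec Carrier n

  IsSolution : ∀ {m k n} → Matrix m k → (Fin k → Point n) → Set
  IsSolution A x = ∀ i t → sumF (λ j → A i j * lookup (x j) t) ≡ 0#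

  Balanced : ∀ {m k} → Matrix m k → Set
  Balanced A = ∀ i → sumF (A i) ≡ 0#

  ColEquiv : ∀ {m k} → Matrix m k → Fin k → Fin k → Set
  ColEquiv A j j' = ∃[ c ] (c ≢ 0# × (∀ i → A i j ≡ c * A i j'))

  SingletonClass : ∀ {m k} → Matrix m k → Fin k → Set
  SingletonClass A j = ∀ j' → ColEquiv A j j' → j' ≡ j

  TypeRC : ∀ {m k} → Matrix m k → Set
  TypeRC A = Balanced A ×
    (∀ j j' → SingletonClass A j → SingletonClass A j' → j ≡ j')

  NonDegenerate : ∀ {m k} → Matrix m k → Set
  NonDegenerate {m} A =
    (∀ (c : Fin m → Carrier) →
       (∀ j → sumF (λ i → c i * A i j) ≡ 0#) → ∀ i → c i ≡ 0#)
    × (∀ j → ∃[ i ] (A i j ≢ 0#))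

  RowsCombinationOf : ∀ {m m' k} → Matrix m' k → Matrix m k → Set
  RowsCombinationOf {m} B A =
    ∀ r → Σ (Fin m → Carrier) λ c → (∀ j → B r j ≡ sumF (λ i → c i * A i j))

  EquivSystems : ∀ {m m' k} → Matrix m k → Matrix m' k → Set
  EquivSystems A B = RowsCombinationOf B A × RowsCombinationOf A B

  Reducible : ∀ {m k} → Matrix m k → Set
  Reducible {m} {k} A =
    Σ ℕ λ m' → Σ (Matrix m' k) λ B → EquivSystems A B ×
    Σ ℕ λ p → (2 ≤ p × Σ (Fin k → Fin p) λ cls →
      (∀ t → ∃[ j ] (cls j ≡ t)) ×
      (∀ r → ∃[ t ] (∀ j → B r j ≢ 0# → cls j ≡ t)))

  Irreducible : ∀ {m k} → Matrix m k → Set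
  Irreducible A = ¬ Reducible A

  NumColClasses : ∀ {m k} → Matrix m k → ℕ → Set
  NumColClasses {k = k} A ℓ =
    Σ (Fin k → Fin ℓ) λ cls → (∀ t → ∃[ j ] (cls j ≡ t)) ×
      (∀ j j' → (cls j ≡ cls j' → ColEquiv A j j') ×
                (ColEquiv A j j' → cls j ≡ cls j'))

  SatisfiesEq : ∀ {k n} → (Fin k → Carrier) → (Fin k → Point n) → Set
  SatisfiesEq b x = ∀ t → sumF (λ j → b j * lookup (x j) t) ≡ 0#

  PreservesClasses : ∀ {m k} → Matrix m k → (Fin k → Carrier) → Set
  PreservesClasses A b =
    ∀ j j' → (ColEquiv A j j' → ColEquiv (b ∷ A) j j') ×
             (ColEquiv (b ∷ A) j j' → ColEquiv A j j')

  BalancedEqsPreserve : ∀ {m k n} → Matrix m k → (Fin k → Point n) → Set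
  BalancedEqsPreserve {k = k} A x =
    ∀ (b : Fin k → Carrier) → sumF b ≡ 0# → SatisfiesEq b x →
      PreservesClasses A b

  LinIndep : ∀ {d n} → (Fin d → Point n) → Set
  LinIndep {d} {n} v =
    ∀ (c : Fin d → Carrier) →
      (∀ t → sumF (λ s → c s * lookup (v s) t) ≡ 0#) → ∀ s → c s ≡ 0#

  diff : ∀ {n} → Point n → Point n → Point n
  diff u w = tabulate (λ t → lookup u t + (- lookup w t))

  -- dim aff(x_1,…,x_k) ≥ d : the direction space of the affine hull,
  -- spanned by the differences x_j − x_j', contains d linearly
  -- independent vectors (chosen among these differences).
  AffDimAtLeast : ∀ {k n} → (Fin k → Point n) → ℕ → Set
  AffDimAtLeast {k} x d =
    Σ (Fin d → Fin k) λ j → Σ (Fin d → Fin k) λ j' →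
      LinIndep (λ s → diff (x (j s)) (x (j' s)))

  record FinSubset (n : ℕ) : Set where
    field
      elems    : List (Point n)
      distinct : AllPairs _≢_ elems

-- rational helpers (the constants β, γ are taken rational)

open import Data.Rational as ℚ using (ℚ; 1ℚ)
open import Data.Integer using (+_)

ℕtoℚ : ℕ → ℚ
ℕtoℚ n = (+ n) ℚ./ 1

powℚ : ℚ → ℕ → ℚ
powℚ γ zero    = 1ℚ
powℚ γ (suc n) = γ ℚ.* powℚ γ n

{-# OPTIONS --safe #-}
-- Points p are replaced by (1, p), so that balanced relations become linear ones, and "few" means at most
-- C γ^n with γ < q.
--
-- By slice rank, a set in which a x + b y = (a + b) u has only trivial solutions is small. Applied to a large
-- subset in which no point lies in the exceptional space of another, this yields, for all but few u in S, a solution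
-- with x outside any prescribed space of bounded dimension. Substituting such solutions for u in a shorter equation
-- (in characteristic 2 also x + y + z = u), an equation Σ λ_j x_j = (Σ λ_j) t with arbitrary nonzero
-- coefficients has, for all but few t, solutions in S that satisfy no other linear relation modulo a given space.
--
-- Let σ_c be the sum of the coefficients λ_j in the class c, and v_c the direction of its columns. If some σ_c is
-- nonzero, or if there is only one class, solve Σ_{j in c} λ_j x_j = σ_c t in all classes with the same t. Otherwise
-- irreducibility yields w ≠ 0 with Σ w_c v_c = 0, and averaging over translates yields d such that
-- Σ_{j in c} λ_j x_j = w_c d can be solved in every class. In both cases the relations between the x_j are exactly
-- b_j = μ_c λ_j with Σ μ_c w_c = 0 (where w = σ in the first case), which gives (i) and (ii).
module Submission where

open import Defs

-- The obstacle is that slice rank yields some nontrivial solution of one equation, while (i) and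
-- (ii) exclude all unwanted relations among k points at once. Every existence statement is
-- therefore made relative to a list `U` of bounded length whose span must be avoided. Points
-- already chosen are put into `U`, so that solutions for different coefficients and classes can be
-- glued without unforeseen relations. A space of dimension at most K has at most q^K points,
-- whatever n is, so avoiding it costs only constants.
--
-- The need for w ≠ 0 comes from (ii). If the balanced relations between k points have dimension r,
-- the points span an affine space of dimension k - 1 - r. The multipliers μ orthogonal to w have
-- dimension ℓ - 1 if w ≠ 0, which gives k - ℓ, but dimension ℓ if w = 0, which gives one less. So
-- vanishing class sums require a different construction, except for a single class, where k - 2 is
-- exactly the weaker value.
--
-- Exceptional spaces are chosen under double negation. This is harmless, since the conclusions
-- drawn are decidable inequalities between cardinalities.

module Proof (F : FiniteField) where

  open import Data.Nat
  open import Data.Nat.Properties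
  open import Data.Nat.ListAction using (sum)
  open import Data.Nat.Tactic.RingSolver using (solve-∀)
  open import Data.Empty using (⊥; ⊥-elim)
  open import Data.Unit using (⊤; tt)
  open import Data.Product using (Σ; ∃; ∃-syntax; _×_; _,_; proj₁; proj₂)
  open import Data.Sum as Sum using (_⊎_; inj₁; inj₂)
  open import Data.Fin as Fin using (Fin; zero; suc)
  import Data.Fin.Properties as Finₚ
  open import Data.List using (List; []; _∷_; _++_; map; length; filter; cartesianProductWith; allFin; upTo)
  open import Data.List.Properties
  open import Data.List.Membership.Propositional using (_∈_; _∉_; find; lose)
  open import Data.List.Membership.Propositional.Properties
  open import Data.List.Relation.Unary.Any as Any using (Any; here; there)
  open import Data.List.Relation.Unary.All as All using (All; []; _∷_)
  open import Data.List.Relation.Unary.All.Properties using (All¬⇒¬Any; ¬Any⇒All¬)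
  open import Data.List.Relation.Unary.AllPairs using ([]; _∷_)
  open import Data.List.Relation.Unary.Unique.Propositional using (Unique)
  import Data.List.Relation.Unary.Unique.Propositional.Properties as Uniq
  open import Data.Vec as Vec using (Vec; []; _∷_; lookup; tabulate)
  import Data.Vec.Properties as Vecₚ
  import Data.Vec.Membership.Propositional.Properties as Vec∈
  open import Function using (_∘_; id; case_of_)
  open import Relation.Nullary
  open import Relation.Nullary.Negation using (¬¬-map)
  open import Relation.Nullary.Decidable using (¬¬-excluded-middle; _×-dec_; _→-dec_; ¬?)
  open import Relation.Unary using (Decidable)
  open import Relation.Binary.Definitions using (DecidableEquality; tri<; tri≈; tri>)
  open import Relation.Binary.PropositionalEquality hiding (J)
  open import Algebra.Bundles using (CommutativeRing; CommutativeMonoid; Semiring)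
  import Algebra.Solver.Ring
  import Algebra.Solver.Ring.AlmostCommutativeRing as ACR
  import Algebra.Properties.Ring
  import Algebra.Properties.Semiring.Mult.TCOptimised
  import Data.Integer as ℤ
  import Data.Integer.Properties as ℤₚ
  open import Data.Maybe using (Maybe; just; nothing)
  open import Function.Bundles using (Inverse)
  open import Data.Bool using (T)
  import Data.Rational as ℚ
  import Data.Rational.Properties as ℚₚ
  import Data.Rational.Unnormalised as ℚᵘ
  import Data.Rational.Unnormalised.Properties as ℚᵘₚ
  import Data.Vec.Functional as Functional
  import Algebra.Properties.CommutativeSemigroup as CommutativeSemigroupₚ
  open CommutativeSemigroupₚ +-commutativeSemigroup using () renaming (interchange to +-interchange)

  private variable
    𝔸 𝔹 : Set

  -- Classical reasoning under double negation, and lists without repetition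

  infixl 1 _>>=_
  _>>=_ : {X Y : Set} → ¬ ¬ X → (X → ¬ ¬ Y) → ¬ ¬ Y
  (m >>= f) k = m (λ x → f x k)

  pure : {X : Set} → X → ¬ ¬ X
  pure x k = k x

  ¬¬-∀∈ : {P : 𝔸 → Set} (xs : List 𝔸) → (∀ x → x ∈ xs → ¬ ¬ P x) → ¬ ¬ (∀ x → x ∈ xs → P x)
  ¬¬-∀∈ []       h = pure (λ _ ())
  ¬¬-∀∈ {P = P} (x ∷ xs) h = h x (here refl) >>= λ p →
    ¬¬-∀∈ xs (λ y y∈ → h y (there y∈)) >>= λ f →
    pure λ { y (here e) → subst P (sym e) p ; y (there y∈) → f y y∈ }

  -- Finitely many instances of excluded middle cost only one double negation. This permits `filter`
  -- with properties such as `Good`, for which no decision procedure is at hand.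
  ¬¬-dec : (xs : List 𝔸) → (∀ x → x ∈ xs) → (P : 𝔸 → Set) → ¬ ¬ Decidable P
  ¬¬-dec xs all P = ¬¬-map (λ f x → f x (all x)) (¬¬-∀∈ xs (λ _ _ → ¬¬-excluded-middle))

  unique-⊆⇒length≤ : {xs ys : List 𝔸} → Unique xs → (∀ x → x ∈ xs → x ∈ ys) → length xs ≤ length ys
  unique-⊆⇒length≤ {xs = []} _ _ = z≤n
  unique-⊆⇒length≤ {xs = x ∷ xs} (x∉ ∷ u) sub with ∈-∃++ (sub x (here refl))
  ... | as , bs , refl = begin
    suc (length xs) ≤⟨ s≤s (unique-⊆⇒length≤ u sub′) ⟩
    suc (length (as ++ bs)) ≡⟨ cong suc (length-++ as) ⟩
    suc (length as + length bs) ≡⟨ +-suc _ _ ⟨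
    length as + suc (length bs) ≡⟨ length-++ as ⟨
    length (as ++ x ∷ bs) ∎
    where
    open ≤-Reasoning
    sub′ : ∀ y → y ∈ xs → y ∈ as ++ bs
    sub′ y y∈ with ∈-++⁻ as (sub y (there y∈))
    ... | inj₁ p           = ∈-++⁺ˡ p
    ... | inj₂ (there p)   = ∈-++⁺ʳ as p
    ... | inj₂ (here refl) = ⊥-elim (All¬⇒¬Any x∉ y∈)

  module _ (_≟_ : DecidableEquality 𝔸) where
    open import Data.List.Membership.DecPropositional _≟_ using (_∈?_)

    outside : {xs ys : List 𝔸} → Unique xs → length ys < length xs → ∃[ x ] (x ∈ xs × x ∉ ys)
    outside {xs} {ys} u lt with Any.any? (λ x → ¬? (x ∈? ys)) xs
    ... | yes p = find p
    ... | no ¬p = ⊥-elim (<⇒≱ lt (unique-⊆⇒length≤ u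
                    (λ x x∈ → decidable-stable (x ∈? ys) (λ x∉ → ¬p (Any.map (λ { refl → x∉ }) x∈)))))

  -- Finite sums and counting

  Σℕ : List 𝔸 → (𝔸 → ℕ) → ℕ
  Σℕ xs f = sum (map f xs)

  Σℕ-mono : (xs : List 𝔸) {f g : 𝔸 → ℕ} → (∀ x → x ∈ xs → f x ≤ g x) → Σℕ xs f ≤ Σℕ xs g
  Σℕ-mono []       h = z≤n
  Σℕ-mono (x ∷ xs) h = +-mono-≤ (h x (here refl)) (Σℕ-mono xs (λ y y∈ → h y (there y∈)))

  Σℕ-const : (xs : List 𝔸) (c : ℕ) → Σℕ xs (λ _ → c) ≡ length xs * c
  Σℕ-const []       c = refl
  Σℕ-const (x ∷ xs) c = cong (c +_) (Σℕ-const xs c)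

  Σℕ-≤ : (xs : List 𝔸) {f : 𝔸 → ℕ} {c : ℕ} → (∀ x → x ∈ xs → f x ≤ c) → Σℕ xs f ≤ length xs * c
  Σℕ-≤ xs {c = c} h = ≤-trans (Σℕ-mono xs h) (≤-reflexive (Σℕ-const xs c))

  Σℕ-≥ : (xs : List 𝔸) {f : 𝔸 → ℕ} {c : ℕ} → (∀ x → x ∈ xs → c ≤ f x) → length xs * c ≤ Σℕ xs f
  Σℕ-≥ xs {c = c} h = ≤-trans (≤-reflexive (sym (Σℕ-const xs c))) (Σℕ-mono xs h)

  Σℕ-+ : (xs : List 𝔸) (f g : 𝔸 → ℕ) → Σℕ xs (λ x → f x + g x) ≡ Σℕ xs f + Σℕ xs g
  Σℕ-+ []       f g = refl
  Σℕ-+ (x ∷ xs) f g = trans (cong (f x + g x +_) (Σℕ-+ xs f g)) (+-interchange (f x) (g x) _ _)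

  Σℕ-* : (xs : List 𝔸) (c : ℕ) (f : 𝔸 → ℕ) → Σℕ xs (λ x → c * f x) ≡ c * Σℕ xs f
  Σℕ-* []       c f = sym (*-zeroʳ c)
  Σℕ-* (x ∷ xs) c f = trans (cong (c * f x +_) (Σℕ-* xs c f)) (sym (*-distribˡ-+ c _ _))

  Σℕ-cong : (xs : List 𝔸) {f g : 𝔸 → ℕ} → (∀ x → f x ≡ g x) → Σℕ xs f ≡ Σℕ xs g
  Σℕ-cong xs h = cong sum (map-cong h xs)

  count : {P : 𝔸 → Set} → Decidable P → List 𝔸 → ℕ
  count P? xs = length (filter P? xs)

  indicator : {P : Set} → Dec P → ℕ
  indicator (yes _) = 1
  indicator (no _)  = 0

  count-∷ : {P : 𝔸 → Set} (P? : Decidable P) (x : 𝔸) (xs : List 𝔸) →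
    count P? (x ∷ xs) ≡ indicator (P? x) + count P? xs
  count-∷ P? x xs with P? x
  ... | yes _ = refl
  ... | no  _ = refl

  count-Σ : {P : 𝔸 → Set} (P? : Decidable P) (xs : List 𝔸) → count P? xs ≡ Σℕ xs (indicator ∘ P?)
  count-Σ P? []       = refl
  count-Σ P? (x ∷ xs) = trans (count-∷ P? x xs) (cong (indicator (P? x) +_) (count-Σ P? xs))

  count-+ : {P Q : 𝔸 → Set} (P? : Decidable P) (Q? : Decidable Q) (xs : List 𝔸) →
    (∀ x → x ∈ xs → P x ⊎ Q x) → length xs ≤ count P? xs + count Q? xs
  count-+ P? Q? []       h = z≤n
  count-+ P? Q? (x ∷ xs) h = begin
    suc (length xs) ≤⟨ s≤s (count-+ P? Q? xs (λ y y∈ → h y (there y∈))) ⟩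
    1 + (count P? xs + count Q? xs) ≤⟨ +-monoˡ-≤ _ ind ⟩
    (i + j) + (count P? xs + count Q? xs) ≡⟨ +-interchange i j _ _ ⟩
    (i + count P? xs) + (j + count Q? xs) ≡⟨ cong₂ _+_ (count-∷ P? x xs) (count-∷ Q? x xs) ⟨
    count P? (x ∷ xs) + count Q? (x ∷ xs) ∎
    where
    open ≤-Reasoning
    i = indicator (P? x)
    j = indicator (Q? x)
    ind : 1 ≤ i + j
    ind with P? x | Q? x | h x (here refl)
    ... | yes _ | _     | _      = s≤s z≤n
    ... | no _  | yes _ | _      = s≤s z≤n
    ... | no ¬p | no _  | inj₁ p = ⊥-elim (¬p p)
    ... | no _  | no ¬q | inj₂ q = ⊥-elim (¬q q)

  double-count : {R : 𝔸 → 𝔹 → Set} (R? : ∀ x y → Dec (R x y)) (xs : List 𝔸) (ys : List 𝔹) →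
    Σℕ xs (λ x → count (R? x) ys) ≡ Σℕ ys (λ y → count (λ x → R? x y) xs)
  double-count R? []       ys = sym (trans (Σℕ-const ys 0) (*-zeroʳ (length ys)))
  double-count R? (x ∷ xs) ys = begin
    count (R? x) ys + Σℕ xs (λ x → count (R? x) ys)
      ≡⟨ cong₂ _+_ (count-Σ (R? x) ys) (double-count R? xs ys) ⟩
    Σℕ ys (indicator ∘ R? x) + Σℕ ys (λ y → count (λ x → R? x y) xs)
      ≡⟨ Σℕ-+ ys _ _ ⟨
    Σℕ ys (λ y → indicator (R? x y) + count (λ x → R? x y) xs)
      ≡⟨ Σℕ-cong ys (λ y → count-∷ (λ x → R? x y) x xs) ⟨
    Σℕ ys (λ y → count (λ x → R? x y) (x ∷ xs)) ∎
    where open ≡-Reasoning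

  words : List 𝔸 → (n : ℕ) → List (Vec 𝔸 n)
  words as zero    = [] ∷ []
  words as (suc n) = cartesianProductWith _∷_ as (words as n)

  words-complete : {as : List 𝔸} {n : ℕ} (v : Vec 𝔸 n) → (∀ i → lookup v i ∈ as) → v ∈ words as n
  words-complete []      h = here refl
  words-complete (x ∷ v) h = ∈-cartesianProductWith⁺ _∷_ (h zero) (words-complete v (λ i → h (suc i)))

  words-sound : {as : List 𝔸} {n : ℕ} (v : Vec 𝔸 n) → v ∈ words as n → ∀ i → lookup v i ∈ as
  words-sound {as = as} {suc n} v v∈ i with ∈-cartesianProductWith⁻ _∷_ as (words as n) v∈
  words-sound v v∈ zero    | _ , _ , x∈ , _ , refl  = x∈
  words-sound v v∈ (suc i) | _ , w , _ , w∈ , refl = words-sound w w∈ i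

  words-unique : {as : List 𝔸} (n : ℕ) → Unique as → Unique (words as n)
  words-unique zero    u = [] ∷ []
  words-unique (suc n) u = Uniq.cartesianProductWith⁺ _∷_ (λ { refl → refl , refl }) u (words-unique n u)

  length-cartesianProductWith : {C : Set} (f : 𝔸 → 𝔹 → C) (xs : List 𝔸) (ys : List 𝔹) →
    length (cartesianProductWith f xs ys) ≡ length xs * length ys
  length-cartesianProductWith f []       ys = refl
  length-cartesianProductWith f (x ∷ xs) ys = trans (length-++ (map (f x) ys))
    (cong₂ _+_ (length-map (f x) ys) (length-cartesianProductWith f xs ys))

  words-length : (as : List 𝔸) (n : ℕ) → length (words as n) ≡ length as ^ n
  words-length as zero    = refl
  words-length as (suc n) = trans (length-cartesianProductWith _∷_ as (words as n)) (cong (length as *_) (words-length as n))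

  -- Every subgraph of a digraph with out-degrees at most D has a vertex of in-degree at most D,
  -- so a greedy choice of such vertices discards at most 2D others at each step.
  module _ {𝔸 : Set} (_≟_ : DecidableEquality 𝔸) (nb : 𝔸 → List 𝔸) (D : ℕ) (small : ∀ x → length (nb x) ≤ D) where
    open import Data.List.Membership.DecPropositional _≟_ using (_∈?_)

    private
      low-indegree : (xs : List 𝔸) → Unique xs → 0 < length xs →
        ∃[ v ] (v ∈ xs × count (λ u → v ∈? nb u) xs ≤ D)
      low-indegree xs u pos with Any.any? (λ v → count (λ u → v ∈? nb u) xs ≤? D) xs
      ... | yes p = find p
      -- If all in-degrees exceeded D, there would be more than D edges per vertex, but the
      -- out-degrees allow at most D.
      ... | no ¬p = ⊥-elim (<⇒≱ (*-monoʳ-< (length xs) {{>-nonZero pos}} (n<1+n D)) (begin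
        length xs * suc D ≤⟨ Σℕ-≥ xs (λ v v∈ → ≰⇒> (λ le → ¬p (Any.map (λ { refl → le }) v∈))) ⟩
        Σℕ xs (λ v → count (λ u → v ∈? nb u) xs) ≡⟨ double-count (λ v u → v ∈? nb u) xs xs ⟩
        Σℕ xs (λ u → count (λ v → v ∈? nb u) xs) ≤⟨ Σℕ-≤ xs (λ w _ → ≤-trans (unique-⊆⇒length≤ (Uniq.filter⁺ (_∈? nb w) u)
                                            (λ _ y∈ → proj₂ (∈-filter⁻ (_∈? nb w) {xs = xs} y∈))) (small w)) ⟩
        length xs * D ∎))
        where open ≤-Reasoning

      independent : (fuel : ℕ) (xs : List 𝔸) → length xs ≤ fuel → Unique xs →
        Σ (List 𝔸) λ ys → Unique ys × (∀ y → y ∈ ys → y ∈ xs) ×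
          (∀ x y → x ∈ ys → y ∈ ys → y ∈ nb x → y ≡ x) × length xs ≤ (2 * D + 1) * length ys
      independent _ [] _ _ = [] , [] , (λ _ ()) , (λ _ _ ()) , z≤n
      independent (suc fuel) xs@(_ ∷ _) (s≤s le) u with low-indegree xs u (s≤s z≤n)
      ... | v , v∈ , deg = step (independent fuel zs zs<xs (Uniq.filter⁺ P? u))
        where
        P : 𝔸 → Set
        P y = v ≢ y × (y ∉ nb v × v ∉ nb y)
        P? : Decidable P
        P? y = ¬? (v ≟ y) ×-dec (¬? (y ∈? nb v) ×-dec ¬? (v ∈? nb y))
        zs = filter P? xs
        zs<xs : length zs ≤ fuel
        zs<xs = ≤-pred (≤-trans (filter-notAll P? xs (Any.map (λ { refl (ne , _) → ne refl }) v∈)) (s≤s le))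
        Q? : Decidable (λ y → ¬ P y)
        Q? y = ¬? (P? y)
        covered : length xs ≤ 1 + D + D + length zs
        covered = begin
          length xs ≤⟨ count-+ Q? P? xs (λ x _ → case P? x of λ { (yes p) → inj₂ p ; (no p) → inj₁ p }) ⟩
          count Q? xs + length zs ≤⟨ +-monoˡ-≤ _ (unique-⊆⇒length≤ (Uniq.filter⁺ Q? u) cover) ⟩
          length (v ∷ nb v ++ ins) + length zs ≡⟨ cong (λ n → suc n + length zs) (length-++ (nb v)) ⟩
          1 + (length (nb v) + length ins) + length zs ≤⟨ +-monoˡ-≤ (length zs) (+-monoʳ-≤ 1 (+-mono-≤ (small v) deg)) ⟩
          1 + D + D + length zs ∎
          where
          open ≤-Reasoning
          ins = filter (λ y → v ∈? nb y) xs
          cover : ∀ y → y ∈ filter Q? xs → y ∈ v ∷ nb v ++ ins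
          cover y y∈ with ∈-filter⁻ Q? {xs = xs} y∈
          ... | y∈xs , ¬Py with v ≟ y | y ∈? nb v | v ∈? nb y
          ... | yes refl | _     | _     = here refl
          ... | no _     | yes p | _     = there (∈-++⁺ˡ p)
          ... | no _     | no _  | yes p = there (∈-++⁺ʳ (nb v) (∈-filter⁺ (λ y → v ∈? nb y) y∈xs p))
          ... | no a     | no b  | no c  = ⊥-elim (¬Py (a , b , c))
        step : (Σ (List 𝔸) λ ys → Unique ys × (∀ y → y ∈ ys → y ∈ zs) ×
                  (∀ x y → x ∈ ys → y ∈ ys → y ∈ nb x → y ≡ x) × length zs ≤ (2 * D + 1) * length ys) →
               Σ (List 𝔸) λ ys → Unique ys × (∀ y → y ∈ ys → y ∈ xs) ×
                  (∀ x y → x ∈ ys → y ∈ ys → y ∈ nb x → y ≡ x) × length xs ≤ (2 * D + 1) * length ys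
        step (ys , uys , sub , ind , bound) =
          v ∷ ys , ¬Any⇒All¬ ys (λ v∈ys → proj₁ (inP v v∈ys) refl) ∷ uys ,
          (λ { y (here refl) → v∈ ; y (there y∈) → proj₁ (∈-filter⁻ P? {xs = xs} (sub y y∈)) }) ,
          ind′ , bound′
          where
          inP : ∀ y → y ∈ ys → P y
          inP y y∈ = proj₂ (∈-filter⁻ P? {xs = xs} (sub y y∈))
          ind′ : ∀ x y → x ∈ v ∷ ys → y ∈ v ∷ ys → y ∈ nb x → y ≡ x
          ind′ x y (here refl) (here refl) _ = refl
          ind′ x y (here refl) (there y∈) e  = ⊥-elim (proj₁ (proj₂ (inP y y∈)) e)
          ind′ x y (there x∈) (here refl) e  = ⊥-elim (proj₂ (proj₂ (inP x x∈)) e)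
          ind′ x y (there x∈) (there y∈) e   = ind x y x∈ y∈ e
          bound′ : length xs ≤ (2 * D + 1) * suc (length ys)
          bound′ = begin
            length xs ≤⟨ covered ⟩
            1 + D + D + length zs ≤⟨ +-monoʳ-≤ (1 + D + D) bound ⟩
            1 + D + D + (2 * D + 1) * length ys ≡⟨ lem D (length ys) ⟩
            (2 * D + 1) * suc (length ys) ∎
            where
            open ≤-Reasoning
            lem : ∀ D n → 1 + D + D + (2 * D + 1) * n ≡ (2 * D + 1) * suc n
            lem = solve-∀

    independent-set : (xs : List 𝔸) → Unique xs →
      Σ (List 𝔸) λ ys → Unique ys × (∀ y → y ∈ ys → y ∈ xs) ×
        (∀ x y → x ∈ ys → y ∈ ys → y ∈ nb x → y ≡ x) × length xs ≤ (2 * D + 1) * length ys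
    independent-set xs = independent (length xs) xs ≤-refl

  ^-distribʳ-* : ∀ n a b → (a * b) ^ n ≡ a ^ n * b ^ n
  ^-distribʳ-* zero    a b = refl
  ^-distribʳ-* (suc n) a b = trans (cong (a * b *_) (^-distribʳ-* n a b)) (lem a b (a ^ n) (b ^ n))
    where
    lem : ∀ a b x y → a * b * (x * y) ≡ a * x * (b * y)
    lem = solve-∀

  -- Rational constants

  private
    ℕtoℚᵘ : ∀ a n → ℚ.toℚᵘ (ℤ.+ a ℚ./ suc n) ℚᵘ.≃ ℚᵘ.mkℚᵘ (ℤ.+ a) n
    ℕtoℚᵘ a n = ℚₚ.toℚᵘ-fromℚᵘ (ℚᵘ.mkℚᵘ (ℤ.+ a) n)

    /-< : ∀ a n b m → a * suc m < b * suc n → ℤ.+ a ℚ./ suc n ℚ.< ℤ.+ b ℚ./ suc m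
    /-< a n b m lt = ℚₚ.toℚᵘ-cancel-< (ℚᵘₚ.<-respˡ-≃ (ℚᵘₚ.≃-sym (ℕtoℚᵘ a n)) (ℚᵘₚ.<-respʳ-≃ (ℚᵘₚ.≃-sym (ℕtoℚᵘ b m))
      (ℚᵘ.*<* (subst₂ ℤ._<_ (ℤₚ.pos-* a (suc m)) (ℤₚ.pos-* b (suc n)) (ℤ.+<+ lt)))))

    ℕtoℚ-≤⁻ : ∀ {a b} → ℕtoℚ a ℚ.≤ ℕtoℚ b → a ≤ b
    ℕtoℚ-≤⁻ {a} {b} le with ℚᵘₚ.≤-respˡ-≃ (ℕtoℚᵘ a 0) (ℚᵘₚ.≤-respʳ-≃ (ℕtoℚᵘ b 0) (ℚₚ.toℚᵘ-mono-≤ le))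
    ... | ℚᵘ.*≤* h = ℤₚ.drop‿+≤+ (subst₂ ℤ._≤_ (ℤₚ.*-identityʳ (ℤ.+ a)) (ℤₚ.*-identityʳ (ℤ.+ b)) h)

    ℕtoℚ-nonNegative : ∀ a → ℚ.NonNegative (ℕtoℚ a)
    ℕtoℚ-nonNegative a = ℚₚ.normalize-nonNeg a 1

    ℕtoℚ-* : ∀ a b → ℕtoℚ a ℚ.* ℕtoℚ b ≡ ℕtoℚ (a * b)
    ℕtoℚ-* a b = ℚₚ.toℚᵘ-injective (ℚᵘₚ.≃-trans (ℚₚ.toℚᵘ-homo-* (ℕtoℚ a) (ℕtoℚ b)) (ℚᵘₚ.≃-trans (ℚᵘₚ.*-cong (ℕtoℚᵘ a 0) (ℕtoℚᵘ b 0))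
      (ℚᵘₚ.≃-trans (ℚᵘ.*≡* (cong (ℤ._* ℤ.+ 1) (sym (ℤₚ.pos-* a b)))) (ℚᵘₚ.≃-sym (ℕtoℚᵘ (a * b) 0)))))

    /-cancel : ∀ a n → ℤ.+ a ℚ./ suc n ℚ.* ℕtoℚ (suc n) ≡ ℕtoℚ a
    /-cancel a n = ℚₚ.toℚᵘ-injective (ℚᵘₚ.≃-trans (ℚₚ.toℚᵘ-homo-* (ℤ.+ a ℚ./ suc n) (ℕtoℚ (suc n))) (ℚᵘₚ.≃-trans (ℚᵘₚ.*-cong (ℕtoℚᵘ a n) (ℕtoℚᵘ (suc n) 0))
      (ℚᵘₚ.≃-trans (ℚᵘ.*≡* (trans (ℤₚ.*-identityʳ _) (cong (λ z → ℤ.+ a ℤ.* ℤ.+ z) (sym (*-identityʳ (suc n)))))) (ℚᵘₚ.≃-sym (ℕtoℚᵘ a 0)))))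

    powℚ-* : ∀ γ D P → γ ℚ.* ℕtoℚ D ≡ ℕtoℚ P → ∀ n → powℚ γ n ℚ.* ℕtoℚ (D ^ n) ≡ ℕtoℚ (P ^ n)
    powℚ-* γ D P e zero    = ℕtoℚ-* 1 1
    powℚ-* γ D P e (suc n) = begin
      γ ℚ.* powℚ γ n ℚ.* ℕtoℚ (D * D ^ n) ≡⟨ cong (γ ℚ.* powℚ γ n ℚ.*_) (ℕtoℚ-* D (D ^ n)) ⟨
      γ ℚ.* powℚ γ n ℚ.* (ℕtoℚ D ℚ.* ℕtoℚ (D ^ n)) ≡⟨ interchange γ (powℚ γ n) (ℕtoℚ D) (ℕtoℚ (D ^ n)) ⟩
      γ ℚ.* ℕtoℚ D ℚ.* (powℚ γ n ℚ.* ℕtoℚ (D ^ n)) ≡⟨ cong₂ ℚ._*_ e (powℚ-* γ D P e n) ⟩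
      ℕtoℚ P ℚ.* ℕtoℚ (P ^ n) ≡⟨ ℕtoℚ-* P (P ^ n) ⟩
      ℕtoℚ (P * P ^ n) ∎
      where
      open ≡-Reasoning
      open CommutativeSemigroupₚ (CommutativeMonoid.commutativeSemigroup ℚₚ.*-1-commutativeMonoid) using (interchange)

  -- The extra factor absorbed in β accounts for the coordinate that homogenises the points.
  threshold : ∀ q d c → 1 ≤ q → Σ ℚ.ℚ λ β → Σ ℚ.ℚ λ γ → (ℚ.0ℚ ℚ.< β) × (ℚ.0ℚ ℚ.< γ) × (γ ℚ.< ℕtoℚ q) ×
    (∀ n N → β ℚ.* powℚ γ n ℚ.≤ ℕtoℚ N → c * (q * (1 + d)) ^ suc n < N * (2 + d) ^ suc n)
  threshold q d c 1≤q = β , γ , /-< 0 0 (c * q + 1) 0 (≤-trans (m≤n+m 1 (c * q)) (≤-reflexive (sym (*-identityʳ _)))) ,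
    /-< 0 0 P (1 + d) (≤-trans (*-mono-≤ 1≤q (s≤s z≤n)) (≤-reflexive (sym (*-identityʳ P)))) ,
    /-< P (1 + d) q 0 (≤-trans (s≤s (≤-reflexive (*-identityʳ P))) (*-monoʳ-< q {{>-nonZero 1≤q}} (n<1+n (1 + d)))) , bound
    where
    P = q * (1 + d)
    β γ : ℚ.ℚ
    β = ℕtoℚ (c * q + 1)
    γ = ℤ.+ P ℚ./ suc (1 + d)
    bound : ∀ n N → β ℚ.* powℚ γ n ℚ.≤ ℕtoℚ N → c * P ^ suc n < N * (2 + d) ^ suc n
    bound n N h = begin-strict
      c * (P * P ^ n) ≡⟨ lem₁ c q d (P ^ n) ⟩
      c * q * P ^ n * (1 + d) <⟨ m<m+n _ (*-mono-≤ (m^n>0 P {{m*n≢0 q (1 + d) {{>-nonZero 1≤q}}}} n) (s≤s z≤n)) ⟩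
      c * q * P ^ n * (1 + d) + P ^ n * (1 + d) ≤⟨ m≤m+n _ ((c * q + 1) * P ^ n) ⟩
      c * q * P ^ n * (1 + d) + P ^ n * (1 + d) + (c * q + 1) * P ^ n ≡⟨ lem₂ (c * q) (P ^ n) d ⟩
      (c * q + 1) * P ^ n * (2 + d) ≤⟨ *-monoˡ-≤ (2 + d) (ℕtoℚ-≤⁻ {(c * q + 1) * P ^ n} {N * (2 + d) ^ n} cleared) ⟩
      N * (2 + d) ^ n * (2 + d) ≡⟨ lem₃ N ((2 + d) ^ n) (2 + d) ⟩
      N * ((2 + d) * (2 + d) ^ n) ∎
      where
      open ≤-Reasoning
      lem₁ : ∀ c q d x → c * (q * (1 + d) * x) ≡ c * q * x * (1 + d)
      lem₁ = solve-∀
      lem₂ : ∀ a x d → a * x * (1 + d) + x * (1 + d) + (a + 1) * x ≡ (a + 1) * x * (2 + d)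
      lem₂ = solve-∀
      lem₃ : ∀ a b c → a * b * c ≡ a * (c * b)
      lem₃ = solve-∀
      cleared : ℕtoℚ ((c * q + 1) * P ^ n) ℚ.≤ ℕtoℚ (N * (2 + d) ^ n)
      cleared = subst₂ ℚ._≤_
        (trans (ℚₚ.*-assoc β (powℚ γ n) _) (trans (cong (β ℚ.*_) (powℚ-* γ (2 + d) P (/-cancel P (1 + d)) n)) (ℕtoℚ-* (c * q + 1) (P ^ n))))
        (ℕtoℚ-* N ((2 + d) ^ n))
        (ℚₚ.*-monoʳ-≤-nonNeg (ℕtoℚ ((2 + d) ^ n)) {{ℕtoℚ-nonNegative ((2 + d) ^ n)}} h)

  -- The field: ring solver, inverses, enumeration

  open Lin F
  open FiniteField F using (0#; 1#; isCommutativeRing; 0≢1; inverse; enum)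
    renaming (Carrier to 𝔽; _+_ to infixl 6 _⊕_; _*_ to infixl 7 _⊗_; -_ to infix 8 ⊝_; _≟_ to infix 4 _≟ᶠ_; size to q)

  commutativeRing : CommutativeRing _ _
  commutativeRing = record { isCommutativeRing = isCommutativeRing }

  open CommutativeRing commutativeRing using () renaming (*-comm to ⊗-comm; +-comm to ⊕-comm; +-assoc to ⊕-assoc; *-assoc to ⊗-assoc; +-identityˡ to ⊕-identityˡ; +-identityʳ to ⊕-identityʳ; *-identityˡ to ⊗-identityˡ; *-identityʳ to ⊗-identityʳ; zeroˡ to ⊗-zeroˡ; zeroʳ to ⊗-zeroʳ; -‿inverseʳ to ⊝-inverseʳ)

  private
    module R = CommutativeRing commutativeRing
    module Rₚ = Algebra.Properties.Ring R.ring
    open Algebra.Properties.Semiring.Mult.TCOptimised R.semiring using (×-homo-+; ×1-homo-*; 1+×) renaming (_×_ to infixl 8 _·_)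

    -- The canonical ring map from the integers. In an abstract field an expression such as 1 - 1
    -- does not compute, so the ring solver takes its constants from the integers, where equality
    -- can be evaluated.
    ⟪_⟫ : ℤ.ℤ → 𝔽
    ⟪ ℤ.+ n ⟫      = n · 1#
    ⟪ ℤ.-[1+ n ] ⟫ = ⊝ (suc n · 1#)

    ⟪-⟫ : ∀ i → ⟪ ℤ.- i ⟫ ≡ ⊝ ⟪ i ⟫
    ⟪-⟫ (ℤ.+ zero)  = sym Rₚ.-0#≈0#
    ⟪-⟫ ℤ.+[1+ n ]  = refl
    ⟪-⟫ ℤ.-[1+ n ]  = sym (Rₚ.-‿involutive _)

    ⟪⊖⟫ : ∀ m n → ⟪ m ℤ.⊖ n ⟫ ≡ m · 1# ⊕ ⊝ (n · 1#)
    ⟪⊖⟫ zero    zero    = sym (⊝-inverseʳ 0#)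
    ⟪⊖⟫ zero    (suc n) = sym (⊕-identityˡ _)
    ⟪⊖⟫ (suc m) zero    = sym (trans (cong (suc m · 1# ⊕_) Rₚ.-0#≈0#) (⊕-identityʳ _))
    ⟪⊖⟫ (suc m) (suc n) = begin
      ⟪ suc m ℤ.⊖ suc n ⟫ ≡⟨ cong ⟪_⟫ (ℤₚ.[1+m]⊖[1+n]≡m⊖n m n) ⟩
      ⟪ m ℤ.⊖ n ⟫ ≡⟨ ⟪⊖⟫ m n ⟩
      m · 1# ⊕ ⊝ (n · 1#) ≡⟨ cong (_⊕ ⊝ (n · 1#)) (trans (sym (⊕-identityʳ _)) (cong (m · 1# ⊕_) (sym (⊝-inverseʳ 1#)))) ⟩
      m · 1# ⊕ (1# ⊕ ⊝ 1#) ⊕ ⊝ (n · 1#) ≡⟨ cong (_⊕ ⊝ (n · 1#)) (trans (sym (R.+-assoc _ _ _)) (cong (_⊕ ⊝ 1#) (R.+-comm _ _))) ⟩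
      1# ⊕ m · 1# ⊕ ⊝ 1# ⊕ ⊝ (n · 1#) ≡⟨ R.+-assoc _ _ _ ⟩
      1# ⊕ m · 1# ⊕ (⊝ 1# ⊕ ⊝ (n · 1#)) ≡⟨ cong (1# ⊕ m · 1# ⊕_) (Rₚ.-‿+-comm 1# (n · 1#)) ⟩
      1# ⊕ m · 1# ⊕ ⊝ (1# ⊕ n · 1#) ≡⟨ cong₂ (λ a b → a ⊕ ⊝ b) (1+× m 1#) (1+× n 1#) ⟨
      suc m · 1# ⊕ ⊝ (suc n · 1#) ∎
      where open ≡-Reasoning

    ⟪+⟫ : ∀ i j → ⟪ i ℤ.+ j ⟫ ≡ ⟪ i ⟫ ⊕ ⟪ j ⟫
    ⟪+⟫ (ℤ.+ m)     (ℤ.+ n)     = ×-homo-+ 1# m n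
    ⟪+⟫ (ℤ.+ m)     ℤ.-[1+ n ]  = ⟪⊖⟫ m (suc n)
    ⟪+⟫ ℤ.-[1+ m ]  (ℤ.+ n)     = trans (⟪⊖⟫ n (suc m)) (R.+-comm _ _)
    ⟪+⟫ ℤ.-[1+ m ]  ℤ.-[1+ n ]  = trans (cong ⊝_ (trans (cong (_· 1#) (cong suc (sym (+-suc m n)))) (×-homo-+ 1# (suc m) (suc n))))
                                        (sym (Rₚ.-‿+-comm _ _))

    ⟪*⟫ : ∀ i j → ⟪ i ℤ.* j ⟫ ≡ ⟪ i ⟫ ⊗ ⟪ j ⟫
    ⟪*⟫ (ℤ.+ m)     (ℤ.+ n)     = trans (cong ⟪_⟫ (ℤₚ.+◃n≡+n (m * n))) (×1-homo-* m n)
    ⟪*⟫ (ℤ.+ m)     ℤ.-[1+ n ]  = trans (cong ⟪_⟫ (ℤₚ.-◃n≡-n (m * suc n))) (trans (⟪-⟫ (ℤ.+ (m * suc n)))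
                                    (trans (cong ⊝_ (×1-homo-* m (suc n))) (Rₚ.-‿distribʳ-* _ _)))
    ⟪*⟫ ℤ.-[1+ m ]  (ℤ.+ n)     = trans (cong ⟪_⟫ (ℤₚ.-◃n≡-n (suc m * n))) (trans (⟪-⟫ (ℤ.+ (suc m * n)))
                                    (trans (cong ⊝_ (×1-homo-* (suc m) n)) (Rₚ.-‿distribˡ-* _ _)))
    ⟪*⟫ ℤ.-[1+ m ]  ℤ.-[1+ n ]  = trans (cong ⟪_⟫ (ℤₚ.+◃n≡+n (suc m * suc n))) (trans (×1-homo-* (suc m) (suc n))
                                    (sym (trans (sym (Rₚ.-‿distribˡ-* _ _)) (trans (cong ⊝_ (sym (Rₚ.-‿distribʳ-* _ _))) (Rₚ.-‿involutive _)))))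

    ℤ⟶𝔽 : ℤ.+-*-rawRing ACR.-Raw-AlmostCommutative⟶ ACR.fromCommutativeRing commutativeRing
    ℤ⟶𝔽 = record { ⟦_⟧ = ⟪_⟫ ; +-homo = ⟪+⟫ ; *-homo = ⟪*⟫ ; -‿homo = ⟪-⟫ ; 0-homo = refl ; 1-homo = refl }

    coeff≟ : ∀ i j → Maybe (⟪ i ⟫ ≡ ⟪ j ⟫)
    coeff≟ i j with i ℤₚ.≟ j
    ... | yes e = just (cong ⟪_⟫ e)
    ... | no _  = nothing

  open Algebra.Solver.Ring ℤ.+-*-rawRing (ACR.fromCommutativeRing commutativeRing) ℤ⟶𝔽 coeff≟
    using (solve; _:=_; _:+_; _:*_; :-_; Polynomial) renaming (con to conℤ)

  :0 :1 : ∀ {n} → Polynomial n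
  :0 = conℤ (ℤ.+ 0)
  :1 = conℤ (ℤ.+ 1)

  inv : (x : 𝔽) → x ≢ 0# → 𝔽
  inv x x≢0 = proj₁ (inverse x x≢0)

  inv-right : (x : 𝔽) (x≢0 : x ≢ 0#) → x ⊗ inv x x≢0 ≡ 1#
  inv-right x x≢0 = proj₂ (inverse x x≢0)

  ⊗-cancelˡ : {x y z : 𝔽} → x ≢ 0# → x ⊗ y ≡ x ⊗ z → y ≡ z
  ⊗-cancelˡ {x} {y} {z} x≢0 e = begin
    y ≡⟨ ⊗-identityˡ y ⟨
    1# ⊗ y ≡⟨ cong (_⊗ y) (inv-right x x≢0) ⟨
    x ⊗ inv x x≢0 ⊗ y ≡⟨ swap x _ y ⟩
    inv x x≢0 ⊗ (x ⊗ y) ≡⟨ cong (inv x x≢0 ⊗_) e ⟩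
    inv x x≢0 ⊗ (x ⊗ z) ≡⟨ swap x _ z ⟨
    x ⊗ inv x x≢0 ⊗ z ≡⟨ cong (_⊗ z) (inv-right x x≢0) ⟩
    1# ⊗ z ≡⟨ ⊗-identityˡ z ⟩
    z ∎
    where
    open ≡-Reasoning
    swap : ∀ a b c → a ⊗ b ⊗ c ≡ b ⊗ (a ⊗ c)
    swap = solve 3 (λ a b c → a :* b :* c := b :* (a :* c)) refl

  ⊗-≢0 : {x y : 𝔽} → x ≢ 0# → y ≢ 0# → x ⊗ y ≢ 0#
  ⊗-≢0 x≢0 y≢0 e = y≢0 (⊗-cancelˡ x≢0 (trans e (sym (⊗-zeroʳ _))))

  inv-≢0 : (x : 𝔽) (x≢0 : x ≢ 0#) → inv x x≢0 ≢ 0#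
  inv-≢0 x x≢0 e = 0≢1 (trans (sym (⊗-zeroʳ x)) (trans (cong (x ⊗_) (sym e)) (inv-right x x≢0)))

  x⊝y≡0⇒x≡y : {x y : 𝔽} → x ⊕ ⊝ y ≡ 0# → x ≡ y
  x⊝y≡0⇒x≡y {x} {y} e = trans (solve 2 (λ x y → x := x :+ :- y :+ y) refl x y) (trans (cong (_⊕ y) e) (⊕-identityˡ y))

  𝔽s : List 𝔽
  𝔽s = map (Inverse.to enum) (allFin q)

  ∈-𝔽s : ∀ x → x ∈ 𝔽s
  ∈-𝔽s x = subst (_∈ 𝔽s) (Inverse.strictlyInverseˡ enum x) (∈-map⁺ (Inverse.to enum) (∈-allFin (Inverse.from enum x)))

  𝔽s-unique : Unique 𝔽s
  𝔽s-unique = Uniq.map⁺ (λ {x} {y} e → trans (sym (Inverse.strictlyInverseʳ enum x))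
    (trans (cong (Inverse.from enum) e) (Inverse.strictlyInverseʳ enum y))) (Uniq.allFin⁺ q)

  length-𝔽s : length 𝔽s ≡ q
  length-𝔽s = trans (length-map _ (allFin q)) (length-tabulate id)

  2≤q : 2 ≤ q
  2≤q = subst (2 ≤_) length-𝔽s (unique-⊆⇒length≤ {xs = 0# ∷ 1# ∷ []} ((0≢1 ∷ []) ∷ [] ∷ []) (λ x _ → ∈-𝔽s x))

  instance
    q-nonZero : NonZero q
    q-nonZero = >-nonZero (≤-trans (s≤s z≤n) 2≤q)

  _≟ᵖ_ : ∀ {n} → DecidableEquality (Point n)
  _≟ᵖ_ = Vecₚ.≡-dec _≟ᶠ_

  points : (n : ℕ) → List (Point n)
  points n = words 𝔽s n

  ∈-points : ∀ {n} (v : Point n) → v ∈ points n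
  ∈-points v = words-complete v (λ i → ∈-𝔽s _)

  points-unique : ∀ n → Unique (points n)
  points-unique n = words-unique n 𝔽s-unique

  length-points : ∀ n → length (points n) ≡ q ^ n
  length-points n = trans (words-length 𝔽s n) (cong (_^ n) length-𝔽s)

  vec-ext : ∀ {n} {v w : Point n} → (∀ t → lookup v t ≡ lookup w t) → v ≡ w
  vec-ext {v = v} {w} h = trans (sym (Vecₚ.tabulate∘lookup v)) (trans (Vecₚ.tabulate-cong h) (Vecₚ.tabulate∘lookup w))

  -- Sums in the field

  ∑ : {A : Set} → List A → (A → 𝔽) → 𝔽
  ∑ []       f = 0#
  ∑ (x ∷ xs) f = f x ⊕ ∑ xs f

  module _ {A : Set} where
    ∑-cong : (xs : List A) {f g : A → 𝔽} → (∀ x → x ∈ xs → f x ≡ g x) → ∑ xs f ≡ ∑ xs g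
    ∑-cong []       h = refl
    ∑-cong (x ∷ xs) h = cong₂ _⊕_ (h x (here refl)) (∑-cong xs (λ y y∈ → h y (there y∈)))

    ∑-zero : (xs : List A) {f : A → 𝔽} → (∀ x → x ∈ xs → f x ≡ 0#) → ∑ xs f ≡ 0#
    ∑-zero []       h = refl
    ∑-zero (x ∷ xs) h = trans (cong₂ _⊕_ (h x (here refl)) (∑-zero xs (λ y y∈ → h y (there y∈)))) (⊕-identityˡ 0#)

    ∑-⊕ : (xs : List A) (f g : A → 𝔽) → ∑ xs (λ x → f x ⊕ g x) ≡ ∑ xs f ⊕ ∑ xs g
    ∑-⊕ []       f g = sym (⊕-identityˡ 0#)
    ∑-⊕ (x ∷ xs) f g = trans (cong (f x ⊕ g x ⊕_) (∑-⊕ xs f g))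
      (solve 4 (λ a b c d → a :+ b :+ (c :+ d) := a :+ c :+ (b :+ d)) refl (f x) (g x) (∑ xs f) (∑ xs g))

    ∑-⊗ : (xs : List A) (c : 𝔽) (f : A → 𝔽) → ∑ xs (λ x → c ⊗ f x) ≡ c ⊗ ∑ xs f
    ∑-⊗ []       c f = sym (⊗-zeroʳ c)
    ∑-⊗ (x ∷ xs) c f = trans (cong (c ⊗ f x ⊕_) (∑-⊗ xs c f))
      (solve 3 (λ c a b → c :* a :+ c :* b := c :* (a :+ b)) refl c (f x) (∑ xs f))

    ∑-⊗ʳ : (xs : List A) (c : 𝔽) (f : A → 𝔽) → ∑ xs (λ x → f x ⊗ c) ≡ ∑ xs f ⊗ c
    ∑-⊗ʳ xs c f = trans (∑-cong xs (λ x _ → R.*-comm (f x) c)) (trans (∑-⊗ xs c f) (R.*-comm c _))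

    ∑-single : {xs : List A} {f : A → 𝔽} {i : A} → Unique xs → i ∈ xs → (∀ x → x ∈ xs → x ≢ i → f x ≡ 0#) → ∑ xs f ≡ f i
    ∑-single {x ∷ xs} {f} (x∉ ∷ u) (here refl) h =
      trans (cong (f x ⊕_) (∑-zero xs (λ y y∈ → h y (there y∈) (λ { refl → All¬⇒¬Any x∉ y∈ })))) (⊕-identityʳ _)
    ∑-single {x ∷ xs} {f} (x∉ ∷ u) (there i∈) h =
      trans (cong₂ _⊕_ (h x (here refl) (λ { refl → All¬⇒¬Any x∉ i∈ })) (∑-single u i∈ (λ y y∈ → h y (there y∈)))) (⊕-identityˡ _)

  ∑-swap : {A B : Set} (xs : List A) (ys : List B) (f : A → B → 𝔽) →
    ∑ xs (λ x → ∑ ys (f x)) ≡ ∑ ys (λ y → ∑ xs (λ x → f x y))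
  ∑-swap []       ys f = sym (∑-zero ys (λ _ _ → refl))
  ∑-swap (x ∷ xs) ys f = trans (cong (∑ ys (f x) ⊕_) (∑-swap xs ys f)) (sym (∑-⊕ ys (f x) _))

  ∑-allFin : ∀ k {A : Set} (g : Fin k → A) (f : A → 𝔽) → ∑ (Data.List.tabulate g) f ≡ sumF (λ j → f (g j))
  ∑-allFin zero    g f = refl
  ∑-allFin (suc k) g f = cong (f (g zero) ⊕_) (∑-allFin k (g ∘ suc) f)

  sumF≡∑ : ∀ k (f : Fin k → 𝔽) → sumF f ≡ ∑ (allFin k) f
  sumF≡∑ k f = sym (∑-allFin k id f)

  sumF-cong : ∀ k {f g : Fin k → 𝔽} → (∀ j → f j ≡ g j) → sumF f ≡ sumF g
  sumF-cong zero    h = refl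
  sumF-cong (suc k) h = cong₂ _⊕_ (h zero) (sumF-cong k (h ∘ suc))

  sumF-⊕ : ∀ k (f g : Fin k → 𝔽) → sumF (λ j → f j ⊕ g j) ≡ sumF f ⊕ sumF g
  sumF-⊕ k f g = trans (sumF≡∑ k _) (trans (∑-⊕ (allFin k) f g) (sym (cong₂ _⊕_ (sumF≡∑ k f) (sumF≡∑ k g))))

  sumF-⊗ : ∀ k (c : 𝔽) (f : Fin k → 𝔽) → sumF (λ j → c ⊗ f j) ≡ c ⊗ sumF f
  sumF-⊗ k c f = trans (sumF≡∑ k _) (trans (∑-⊗ (allFin k) c f) (cong (c ⊗_) (sym (sumF≡∑ k f))))

  sumF-⊗ʳ : ∀ k (c : 𝔽) (f : Fin k → 𝔽) → sumF (λ j → f j ⊗ c) ≡ sumF f ⊗ c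
  sumF-⊗ʳ k c f = trans (sumF≡∑ k _) (trans (∑-⊗ʳ (allFin k) c f) (cong (_⊗ c) (sym (sumF≡∑ k f))))

  sumF-zero : ∀ k {f : Fin k → 𝔽} → (∀ j → f j ≡ 0#) → sumF f ≡ 0#
  sumF-zero k h = trans (sumF≡∑ k _) (∑-zero (allFin k) (λ x _ → h x))

  sumF-swap : ∀ k l (f : Fin k → Fin l → 𝔽) → sumF (λ j → sumF (f j)) ≡ sumF (λ i → sumF (λ j → f j i))
  sumF-swap k l f = begin
    sumF (λ j → sumF (f j)) ≡⟨ sumF-cong k (λ j → sumF≡∑ l (f j)) ⟩
    sumF (λ j → ∑ (allFin l) (f j)) ≡⟨ sumF≡∑ k _ ⟩
    ∑ (allFin k) (λ j → ∑ (allFin l) (f j)) ≡⟨ ∑-swap (allFin k) (allFin l) f ⟩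
    ∑ (allFin l) (λ i → ∑ (allFin k) (λ j → f j i)) ≡⟨ sumF≡∑ l _ ⟨
    sumF (λ i → ∑ (allFin k) (λ j → f j i)) ≡⟨ sumF-cong l (λ i → sumF≡∑ k _) ⟨
    sumF (λ i → sumF (λ j → f j i)) ∎
    where open ≡-Reasoning

  -- The polynomial method

  open import Algebra.Definitions.RawSemiring (Semiring.rawSemiring (CommutativeRing.semiring commutativeRing)) using () renaming (_^_ to infixr 8 _^ᶠ_)

  -- Membership of a function in the linear span of the `m τ`, recorded as a derivation instead of a
  -- list of coefficients: that a linear functional vanishes on the function then follows by
  -- induction. The constructor `ext` replaces function extensionality.
  data Comb {T X : Set} (m : T → X → 𝔽) : (X → 𝔽) → Set where
    mono  : ∀ τ → Comb m (m τ)
    nil   : Comb m (λ _ → 0#)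
    add   : ∀ {f g} → Comb m f → Comb m g → Comb m (λ x → f x ⊕ g x)
    scale : ∀ {f} c → Comb m f → Comb m (λ x → c ⊗ f x)
    ext   : ∀ {f g} → (∀ x → f x ≡ g x) → Comb m f → Comb m g

  comb-map : {T X T′ X′ : Set} {m : T → X → 𝔽} {m′ : T′ → X′ → 𝔽} (p : X′ → X) (u : X′ → 𝔽) →
    (∀ τ → Comb m′ (λ x → u x ⊗ m τ (p x))) → ∀ {f} → Comb m f → Comb m′ (λ x → u x ⊗ f (p x))
  comb-map p u h (mono τ)    = h τ
  comb-map p u h nil         = ext (λ x → sym (⊗-zeroʳ _)) nil
  comb-map p u h (add c d)   = ext (λ x → solve 3 (λ u a b → u :* a :+ u :* b := u :* (a :+ b)) refl (u x) _ _)
                                   (add (comb-map p u h c) (comb-map p u h d))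
  comb-map p u h (scale s c) = ext (λ x → solve 3 (λ u s a → s :* (u :* a) := u :* (s :* a)) refl (u x) s _)
                                   (scale s (comb-map p u h c))
  comb-map p u h (ext e c)   = ext (λ x → cong (u x ⊗_) (e (p x))) (comb-map p u h c)

  comb-mul : {T₁ X₁ T₂ X₂ T₃ X₃ : Set} {m₁ : T₁ → X₁ → 𝔽} {m₂ : T₂ → X₂ → 𝔽} {m₃ : T₃ → X₃ → 𝔽}
    (p₁ : X₃ → X₁) (p₂ : X₃ → X₂) → (∀ τ σ → Comb m₃ (λ x → m₁ τ (p₁ x) ⊗ m₂ σ (p₂ x))) →
    ∀ {f g} → Comb m₁ f → Comb m₂ g → Comb m₃ (λ x → f (p₁ x) ⊗ g (p₂ x))
  comb-mul {m₁ = m₁} p₁ p₂ h {f} {g} c d =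
    ext (λ x → ⊗-comm (g (p₂ x)) (f (p₁ x)))
      (comb-map p₁ (g ∘ p₂) (λ τ → ext (λ x → ⊗-comm (m₁ τ (p₁ x)) (g (p₂ x))) (comb-map p₂ (m₁ τ ∘ p₁) (h τ) d)) c)

  Monomial₁ : ℕ → Set
  Monomial₁ d = Σ (ℕ × ℕ × ℕ) λ (a , b , c) → a + b + c ≤ d

  eval₁ : ∀ {d} → Monomial₁ d → 𝔽 × 𝔽 × 𝔽 → 𝔽
  eval₁ ((a , b , c) , _) (t , x , y) = t ^ᶠ a ⊗ x ^ᶠ b ⊗ y ^ᶠ c

  Π-shift : List 𝔽 → 𝔽 → 𝔽
  Π-shift []       s = 1#
  Π-shift (e ∷ es) s = (e ⊕ ⊝ s) ⊗ Π-shift es s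

  module _ (λ₀ λ₁ λ₂ : 𝔽) where

    form : 𝔽 × 𝔽 × 𝔽 → 𝔽
    form (t , x , y) = λ₀ ⊗ t ⊕ λ₁ ⊗ x ⊕ λ₂ ⊗ y

    Π-shift-comb : (es : List 𝔽) → Comb (eval₁ {length es}) (λ p → Π-shift es (form p))
    Π-shift-comb []       = ext (λ _ → solve 0 (:1 :* :1 :* :1 := :1) refl) (mono ((0 , 0 , 0) , z≤n))
    Π-shift-comb (e ∷ es) = ext
      (λ (t , x , y) → solve 8 (λ e l₀ t l₁ x l₂ y P →
          e :* (:1 :* P) :+ (:- l₀ :* (t :* P) :+ (:- l₁ :* (x :* P) :+ :- l₂ :* (y :* P)))
          := (e :+ :- (l₀ :* t :+ l₁ :* x :+ l₂ :* y)) :* P) refl e λ₀ t λ₁ x λ₂ y _)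
      (add (scale e (times (λ _ → 1#) (λ ((a , b , c) , le) → ext (λ _ → sym (⊗-identityˡ _)) (mono ((a , b , c) , m≤n⇒m≤1+n le)))))
      (add (scale (⊝ λ₀) (times (λ (t , x , y) → t) (λ ((a , b , c) , le) →
          ext (λ (t , x , y) → solve 4 (λ t T X Y → t :* T :* X :* Y := t :* (T :* X :* Y)) refl t (t ^ᶠ a) (x ^ᶠ b) (y ^ᶠ c))
            (mono ((suc a , b , c) , s≤s le)))))
      (add (scale (⊝ λ₁) (times (λ (t , x , y) → x) (λ ((a , b , c) , le) →
          ext (λ (t , x , y) → solve 4 (λ x T X Y → T :* (x :* X) :* Y := x :* (T :* X :* Y)) refl x (t ^ᶠ a) (x ^ᶠ b) (y ^ᶠ c))
            (mono ((a , suc b , c) , ≤-trans (≤-reflexive (cong (_+ c) (+-suc a b))) (s≤s le))))))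
        (scale (⊝ λ₂) (times (λ (t , x , y) → y) (λ ((a , b , c) , le) →
          ext (λ (t , x , y) → solve 4 (λ y T X Y → T :* X :* (y :* Y) := y :* (T :* X :* Y)) refl y (t ^ᶠ a) (x ^ᶠ b) (y ^ᶠ c))
            (mono ((a , b , suc c) , ≤-trans (≤-reflexive (+-suc (a + b) c)) (s≤s le)))))))))
      where
      times : (u : 𝔽 × 𝔽 × 𝔽 → 𝔽) → (∀ τ → Comb (eval₁ {suc (length es)}) (λ p → u p ⊗ eval₁ {length es} τ p)) →
        Comb (eval₁ {suc (length es)}) (λ p → u p ⊗ Π-shift es (form p))
      times u h = comb-map id u h (Π-shift-comb es)

  nonzeros : List 𝔽
  nonzeros = filter (λ x → ¬? (x ≟ᶠ 0#)) 𝔽s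

  length-nonzeros : length nonzeros < q
  length-nonzeros = subst (length nonzeros <_) length-𝔽s
    (unique-⊆⇒length≤ {xs = 0# ∷ nonzeros}
      (¬Any⇒All¬ nonzeros (λ 0∈ → proj₂ (∈-filter⁻ (λ x → ¬? (x ≟ᶠ 0#)) {xs = 𝔽s} 0∈) refl)
        ∷ Uniq.filter⁺ _ 𝔽s-unique) (λ x _ → ∈-𝔽s x))

  -- δ is a nonzero multiple of the indicator function of 0, of degree at most q − 1.
  δ : 𝔽 → 𝔽
  δ = Π-shift nonzeros

  private
    Π-shift-root : ∀ (es : List 𝔽) s → s ∈ es → Π-shift es s ≡ 0#
    Π-shift-root (e ∷ es) s (here refl) = trans (cong (_⊗ Π-shift es e) (⊝-inverseʳ e)) (⊗-zeroˡ _)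
    Π-shift-root (e ∷ es) s (there s∈)  = trans (cong ((e ⊕ ⊝ s) ⊗_) (Π-shift-root es s s∈)) (⊗-zeroʳ _)

    Π-shift-0 : ∀ (es : List 𝔽) → (∀ e → e ∈ es → e ≢ 0#) → Π-shift es 0# ≢ 0#
    Π-shift-0 []       h e = 0≢1 (sym e)
    Π-shift-0 (e ∷ es) h = ⊗-≢0 (λ z → h e (here refl) (x⊝y≡0⇒x≡y z)) (Π-shift-0 es (λ x x∈ → h x (there x∈)))

  δ-0 : δ 0# ≢ 0#
  δ-0 = Π-shift-0 nonzeros (λ e e∈ → proj₂ (∈-filter⁻ (λ x → ¬? (x ≟ᶠ 0#)) {xs = 𝔽s} e∈))

  δ-≢0 : ∀ {s} → s ≢ 0# → δ s ≡ 0#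
  δ-≢0 s≢0 = Π-shift-root nonzeros _ (∈-filter⁺ (λ x → ¬? (x ≟ᶠ 0#)) (∈-𝔽s _) s≢0)

  monomial : ∀ {n} → Vec ℕ n → Point n → 𝔽
  monomial []       _ = 1#
  monomial (a ∷ as) v = Vec.head v ^ᶠ a ⊗ monomial as (Vec.tail v)

  -- The exponents that occur in the expansion of `κ`: each coordinate contributes one factor `δ`,
  -- of total degree at most q - 1 in its three variables.
  Fits : ∀ {n} → Vec ℕ n → Vec ℕ n → Vec ℕ n → Set
  Fits []       []       []       = ⊤
  Fits (a ∷ as) (b ∷ bs) (c ∷ cs) = a + b + c < q × Fits as bs cs

  Monomial : ℕ → Set
  Monomial n = Σ (Vec ℕ n × Vec ℕ n × Vec ℕ n) λ (a , b , c) → Fits a b c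

  Point³ : ℕ → Set
  Point³ n = Point n × Point n × Point n

  eval : ∀ {n} → Monomial n → Point³ n → 𝔽
  eval ((a , b , c) , _) (t , x , y) = monomial a t ⊗ monomial b x ⊗ monomial c y

  module _ (λ₀ λ₁ λ₂ : 𝔽) where

    -- The tensor of the slice-rank argument: by `κ-≢0` and `κ-≢0⁻` it is nonzero exactly at the
    -- solutions of the equation.
    κ : ∀ n → Point³ n → 𝔽
    κ zero    _           = 1#
    κ (suc n) (t , x , y) = δ (form λ₀ λ₁ λ₂ (Vec.head t , Vec.head x , Vec.head y)) ⊗ κ n (Vec.tail t , Vec.tail x , Vec.tail y)

    κ-comb : ∀ n → Comb (eval {n}) (κ n)
    κ-comb zero    = ext (λ _ → solve 0 (:1 :* :1 :* :1 := :1) refl) (mono (([] , [] , []) , tt))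
    κ-comb (suc n) = comb-mul
      (λ (t , x , y) → Vec.head t , Vec.head x , Vec.head y) (λ (t , x , y) → Vec.tail t , Vec.tail x , Vec.tail y)
      (λ ((a , b , c) , le) ((as , bs , cs) , f) →
        ext (λ (t , x , y) → solve 6 (λ a b c A B C → a :* A :* (b :* B) :* (c :* C) := a :* b :* c :* (A :* B :* C)) refl
               (Vec.head t ^ᶠ a) (Vec.head x ^ᶠ b) (Vec.head y ^ᶠ c)
               (monomial as (Vec.tail t)) (monomial bs (Vec.tail x)) (monomial cs (Vec.tail y)))
          (mono ((a ∷ as , b ∷ bs , c ∷ cs) , ≤-<-trans le length-nonzeros , f)))
      (Π-shift-comb λ₀ λ₁ λ₂ nonzeros) (κ-comb n)

    κ-≢0 : ∀ n (t x y : Point n) → (∀ i → form λ₀ λ₁ λ₂ (lookup t i , lookup x i , lookup y i) ≡ 0#) → κ n (t , x , y) ≢ 0#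
    κ-≢0 zero    _        _        _        h e = 0≢1 (sym e)
    κ-≢0 (suc n) (_ ∷ t) (_ ∷ x) (_ ∷ y) h = ⊗-≢0 (λ e → δ-0 (trans (cong δ (sym (h zero))) e)) (κ-≢0 n t x y (h ∘ suc))

    κ-≢0⁻ : ∀ n (t x y : Point n) → κ n (t , x , y) ≢ 0# → ∀ i → form λ₀ λ₁ λ₂ (lookup t i , lookup x i , lookup y i) ≡ 0#
    κ-≢0⁻ (suc n) (t ∷ ts) (x ∷ xs) (y ∷ ys) ne zero    = decidable-stable (_ ≟ᶠ _)
      (λ f≢0 → ne (trans (cong (_⊗ κ n (ts , xs , ys)) (δ-≢0 f≢0)) (⊗-zeroˡ _)))
    κ-≢0⁻ (suc n) (t ∷ ts) (x ∷ xs) (y ∷ ys) ne (suc i) =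
      κ-≢0⁻ n ts xs ys (λ e → ne (trans (cong (δ (form λ₀ λ₁ λ₂ (t , x , y)) ⊗_) e) (⊗-zeroʳ _))) i

  -- The weights satisfy W(a) + W(q − 1 − a) ≤ 19, so that they have mean at most 19/2 < 10, while
  -- W(a) W(b) W(c) ≥ 10³ whenever a + b + c ≤ q − 1.
  W : ℕ → ℕ
  W a with <-cmp (2 * a) (q ∸ 1)
  ... | tri< _ _ _ = 13
  ... | tri≈ _ _ _ = 9
  ... | tri> _ _ _ = 6

  weight : ∀ {n} → Vec ℕ n → ℕ
  weight []       = 1
  weight (a ∷ as) = W a * weight as

  -- Despite the direction of the inequality these are the exponents of low degree, as `W` is larger
  -- on small arguments. The three-valued weight takes the place of the degree and its exponential
  -- moments.
  lows : ∀ n → List (Vec ℕ n)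
  lows n = filter (λ a → 10 ^ n ≤? weight a) (words (upTo q) n)

  private
    1≤q∸1 : 1 ≤ q ∸ 1
    1≤q∸1 = ∸-monoˡ-≤ 1 2≤q

    rot : ∀ a b c → a + b + c ≡ c + a + b
    rot = solve-∀
    flip : ∀ a b c → a + b + c ≡ b + a + c
    flip = solve-∀
    rot* : ∀ a b c → a * b * c ≡ b * c * a
    rot* = solve-∀
    swap* : ∀ a b c → a * b * c ≡ a * c * b
    swap* = solve-∀

    calc : ∀ m n → {T (m ≤ᵇ n)} → m ≤ n
    calc m n {p} = ≤ᵇ⇒≤ m n p

    6≤W : ∀ a → 6 ≤ W a
    6≤W a with <-cmp (2 * a) (q ∸ 1)
    ... | tri< _ _ _ = calc 6 13
    ... | tri≈ _ _ _ = calc 6 9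
    ... | tri> _ _ _ = ≤-refl

    9≤W : ∀ a → 2 * a ≤ q ∸ 1 → 9 ≤ W a
    9≤W a le with <-cmp (2 * a) (q ∸ 1)
    ... | tri< _ _ _  = calc 9 13
    ... | tri≈ _ _ _  = ≤-refl
    ... | tri> _ _ gt = ⊥-elim (<⇒≱ gt le)

    13≤W : ∀ a → 2 * a < q ∸ 1 → 13 ≤ W a
    13≤W a lt with <-cmp (2 * a) (q ∸ 1)
    ... | tri< _ _ _ = ≤-refl
    ... | tri≈ n _ _ = ⊥-elim (n lt)
    ... | tri> n _ _ = ⊥-elim (n lt)

    two-low : ∀ a b c → 2 * a < q ∸ 1 → 2 * b < q ∸ 1 → 1000 ≤ W a * W b * W c
    two-low a b c la lb = ≤-trans (calc 1000 1014) (*-mono-≤ (*-mono-≤ (13≤W a la) (13≤W b lb)) (6≤W c))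

    -- Here b = c = (q − 1) / 2 and a = 0.
    two-high : ∀ a b c → a + b + c ≤ q ∸ 1 → q ∸ 1 ≤ 2 * b → q ∸ 1 ≤ 2 * c → 1000 ≤ W a * W b * W c
    two-high a b c le hb hc = ≤-trans (calc 1000 1053) (*-mono-≤ (*-mono-≤ (13≤W a a<) (9≤W b b≤)) (9≤W c c≤))
      where
      2n : ∀ x y z → a + b + c ≡ x + y + z → q ∸ 1 ≤ 2 * x → 2 * y + 2 * z ≤ q ∸ 1
      2n x y z e h = +-cancelˡ-≤ (q ∸ 1) _ _ (begin
        q ∸ 1 + (2 * y + 2 * z) ≤⟨ +-monoˡ-≤ _ h ⟩
        2 * x + (2 * y + 2 * z) ≡⟨ lem x y z ⟩
        2 * (x + y + z) ≤⟨ *-monoʳ-≤ 2 (subst (_≤ q ∸ 1) e le) ⟩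
        2 * (q ∸ 1) ≡⟨ cong (q ∸ 1 +_) (+-identityʳ _) ⟩
        q ∸ 1 + (q ∸ 1) ∎)
        where
        open ≤-Reasoning
        lem : ∀ x y z → 2 * x + (2 * y + 2 * z) ≡ 2 * (x + y + z)
        lem = solve-∀
      b≤ : 2 * b ≤ q ∸ 1
      b≤ = ≤-trans (m≤n+m (2 * b) (2 * a)) (2n c a b (rot a b c) hc)
      c≤ : 2 * c ≤ q ∸ 1
      c≤ = ≤-trans (m≤n+m (2 * c) (2 * a)) (2n b a c (flip a b c) hb)
      a< : 2 * a < q ∸ 1
      a< = ≤-trans (s≤s (+-cancelʳ-≤ (q ∸ 1) (2 * a) 0 (≤-trans (+-monoʳ-≤ (2 * a) hc) (2n b a c (flip a b c) hb)))) 1≤q∸1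

  -- Of three exponents, either two lie below (q - 1) / 2, and the product is at least 13 · 13 · 6 =
  -- 1014, or two do not, and then the degree bound leaves only a case with product at least 13 · 9
  -- · 9 = 1053.
  W-triple : ∀ a b c → a + b + c < q → 1000 ≤ W a * W b * W c
  W-triple a b c lt with 2 * a <? q ∸ 1 | 2 * b <? q ∸ 1 | 2 * c <? q ∸ 1
  ... | yes x | yes y | _     = two-low a b c x y
  ... | yes x | no _  | yes z = ≤-trans (two-low a c b x z) (≤-reflexive (swap* (W a) (W c) (W b)))
  ... | no _  | yes y | yes z = ≤-trans (two-low b c a y z) (≤-reflexive (sym (rot* (W a) (W b) (W c))))
  ... | yes _ | no y  | no z  = two-high a b c (<⇒≤pred lt) (≮⇒≥ y) (≮⇒≥ z)
  ... | no x  | no y  | _     = ≤-trans (two-high c a b (≤-trans (≤-reflexive (sym (rot a b c))) (<⇒≤pred lt)) (≮⇒≥ x) (≮⇒≥ y))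
                                  (≤-reflexive (rot* (W c) (W a) (W b)))
  ... | no x  | yes _ | no z  = ≤-trans (two-high b a c (≤-trans (≤-reflexive (sym (flip a b c))) (<⇒≤pred lt)) (≮⇒≥ x) (≮⇒≥ z))
                                  (≤-reflexive (cong (_* W c) (*-comm (W b) (W a))))

  private
    too-small : ∀ a b → a + b ≡ q ∸ 1 → 2 * a + 2 * b < q ∸ 1 + (q ∸ 1) → ⊥
    too-small a b e = <-irrefl (trans (sym (*-distribˡ-+ 2 a b)) (trans (cong (2 *_) e) (cong (q ∸ 1 +_) (+-identityʳ _))))

  W-pair : ∀ a b → a + b ≡ q ∸ 1 → W a + W b ≤ 19
  W-pair a b e with <-cmp (2 * a) (q ∸ 1) | <-cmp (2 * b) (q ∸ 1)
  ... | tri< A _ _ | tri< B _ _ = ⊥-elim (too-small a b e (+-mono-<-≤ A (<⇒≤ B)))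
  ... | tri< A _ _ | tri≈ _ B _ = ⊥-elim (too-small a b e (+-mono-<-≤ A (≤-reflexive B)))
  ... | tri< A _ _ | tri> _ _ B = calc 19 19
  ... | tri≈ _ A _ | tri< B _ _ = ⊥-elim (too-small a b e (+-mono-≤-< (≤-reflexive A) B))
  ... | tri≈ _ A _ | tri≈ _ B _ = calc 18 19
  ... | tri≈ _ A _ | tri> _ _ B = calc 15 19
  ... | tri> _ _ A | tri< B _ _ = calc 19 19
  ... | tri> _ _ A | tri≈ _ B _ = calc 15 19
  ... | tri> _ _ A | tri> _ _ B = calc 12 19

  private
    weight-triple : ∀ {n} (a b c : Vec ℕ n) → Fits a b c → 10 ^ n * 10 ^ n * 10 ^ n ≤ weight a * weight b * weight c
    weight-triple []       []       []       _       = ≤-refl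
    weight-triple {suc n} (a ∷ as) (b ∷ bs) (c ∷ cs) (lt , f) = begin
      10 * 10 ^ n * (10 * 10 ^ n) * (10 * 10 ^ n) ≡⟨ lem₁ (10 ^ n) ⟩
      1000 * (10 ^ n * 10 ^ n * 10 ^ n) ≤⟨ *-mono-≤ (W-triple a b c lt) (weight-triple as bs cs f) ⟩
      W a * W b * W c * (weight as * weight bs * weight cs) ≡⟨ lem₂ (W a) (W b) (W c) (weight as) (weight bs) (weight cs) ⟩
      W a * weight as * (W b * weight bs) * (W c * weight cs) ∎
      where
      open ≤-Reasoning
      lem₁ : ∀ x → 10 * x * (10 * x) * (10 * x) ≡ 1000 * (x * x * x)
      lem₁ = solve-∀
      lem₂ : ∀ a b c x y z → a * b * c * (x * y * z) ≡ a * x * (b * y) * (c * z)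
      lem₂ = solve-∀

    fits-bounds : ∀ {n} (a b c : Vec ℕ n) → Fits a b c → ∀ i → lookup a i < q × lookup b i < q × lookup c i < q
    fits-bounds (a ∷ _) (b ∷ _) (c ∷ _) (lt , _) zero =
      ≤-<-trans (≤-trans (m≤m+n a b) (m≤m+n (a + b) c)) lt ,
      ≤-<-trans (≤-trans (m≤n+m b a) (m≤m+n (a + b) c)) lt , ≤-<-trans (m≤n+m c (a + b)) lt
    fits-bounds (_ ∷ a) (_ ∷ b) (_ ∷ c) (_ , f) (suc i) = fits-bounds a b c f i

  -- Three weights below 10^n would have a product below 10^(3n), against `weight-triple`.
  fits⇒low : ∀ {n} (a b c : Vec ℕ n) → Fits a b c → a ∈ lows n ⊎ b ∈ lows n ⊎ c ∈ lows n
  fits⇒low {n} a b c f with 10 ^ n ≤? weight a | 10 ^ n ≤? weight b | 10 ^ n ≤? weight c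
  ... | yes p | _     | _     = inj₁ (∈-filter⁺ _ (words-complete a (λ i → ∈-upTo⁺ (proj₁ (fits-bounds a b c f i)))) p)
  ... | no _  | yes p | _     = inj₂ (inj₁ (∈-filter⁺ _ (words-complete b (λ i → ∈-upTo⁺ (proj₁ (proj₂ (fits-bounds a b c f i))))) p))
  ... | no _  | no _  | yes p = inj₂ (inj₂ (∈-filter⁺ _ (words-complete c (λ i → ∈-upTo⁺ (proj₂ (proj₂ (fits-bounds a b c f i))))) p))
  ... | no x  | no y  | no z  = ⊥-elim (<⇒≱ (*-mono-< (*-mono-< (≰⇒> x) (≰⇒> y)) (≰⇒> z)) (weight-triple a b c f))

  private
    Σ< : ℕ → (ℕ → ℕ) → ℕ
    Σ< zero    f = 0
    Σ< (suc n) f = f 0 + Σ< n (f ∘ suc)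

    Σ<-cong : ∀ n {f g : ℕ → ℕ} → (∀ a → a < n → f a ≡ g a) → Σ< n f ≡ Σ< n g
    Σ<-cong zero    h = refl
    Σ<-cong (suc n) h = cong₂ _+_ (h 0 (s≤s z≤n)) (Σ<-cong n (λ a a< → h (suc a) (s≤s a<)))

    Σ<-last : ∀ n f → Σ< (suc n) f ≡ f n + Σ< n f
    Σ<-last zero    f = refl
    Σ<-last (suc n) f = trans (cong (f 0 +_) (Σ<-last n (f ∘ suc))) (lem (f 0) (f (suc n)) _)
      where
      lem : ∀ a b c → a + (b + c) ≡ b + (a + c)
      lem = solve-∀

    Σ<-rev : ∀ n f → Σ< n (λ a → f (n ∸ 1 ∸ a)) ≡ Σ< n f
    Σ<-rev zero    f = refl
    Σ<-rev (suc n) f = trans (cong (f n +_) (trans (Σ<-cong n (λ a _ → cong f (sym (∸-+-assoc n 1 a)))) (Σ<-rev n f)))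
                             (sym (Σ<-last n f))

    Σ<-pair : ∀ n (f g : ℕ → ℕ) c → (∀ a → a < n → f a + g a ≤ c) → Σ< n f + Σ< n g ≤ n * c
    Σ<-pair zero    f g c h = z≤n
    Σ<-pair (suc n) f g c h = ≤-trans (≤-reflexive (+-interchange (f 0) _ (g 0) _))
      (+-mono-≤ (h 0 (s≤s z≤n)) (Σ<-pair n (f ∘ suc) (g ∘ suc) c (λ a a< → h (suc a) (s≤s a<))))

    Σ<≡Σℕ : ∀ n {A : Set} (g : ℕ → A) (f : A → ℕ) → Σℕ (Data.List.applyUpTo g n) f ≡ Σ< n (f ∘ g)
    Σ<≡Σℕ zero    g f = refl
    Σ<≡Σℕ (suc n) g f = cong (f (g 0) +_) (Σ<≡Σℕ n (g ∘ suc) f)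

  ΣW≤ : 2 * Σℕ (upTo q) W ≤ 19 * q
  ΣW≤ = begin
    2 * Σℕ (upTo q) W ≡⟨ cong (2 *_) (Σ<≡Σℕ q id W) ⟩
    Σ< q W + (Σ< q W + 0) ≡⟨ cong (Σ< q W +_) (trans (+-identityʳ _) (sym (Σ<-rev q W))) ⟩
    Σ< q W + Σ< q (λ a → W (q ∸ 1 ∸ a)) ≤⟨ Σ<-pair q _ _ 19 (λ a a< → W-pair a _ (m+[n∸m]≡n (<⇒≤pred a<))) ⟩
    q * 19 ≡⟨ *-comm q 19 ⟩
    19 * q ∎
    where open ≤-Reasoning

  private
    Σℕ-++ : {A : Set} (xs ys : List A) (f : A → ℕ) → Σℕ (xs ++ ys) f ≡ Σℕ xs f + Σℕ ys f
    Σℕ-++ []       ys f = refl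
    Σℕ-++ (x ∷ xs) ys f = trans (cong (f x +_) (Σℕ-++ xs ys f)) (sym (+-assoc (f x) _ _))

    Σℕ-map : {A B : Set} (g : A → B) (xs : List A) (f : B → ℕ) → Σℕ (map g xs) f ≡ Σℕ xs (f ∘ g)
    Σℕ-map g []       f = refl
    Σℕ-map g (x ∷ xs) f = cong (f (g x) +_) (Σℕ-map g xs f)

    Σ-weight-cons : ∀ {n} (as : List ℕ) (ws : List (Vec ℕ n)) →
      Σℕ (cartesianProductWith _∷_ as ws) weight ≡ Σℕ as W * Σℕ ws weight
    Σ-weight-cons []       ws = refl
    Σ-weight-cons (a ∷ as) ws = begin
      Σℕ (map (a ∷_) ws ++ cartesianProductWith _∷_ as ws) weight ≡⟨ Σℕ-++ (map (a ∷_) ws) _ weight ⟩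
      Σℕ (map (a ∷_) ws) weight + Σℕ (cartesianProductWith _∷_ as ws) weight
        ≡⟨ cong₂ _+_ (trans (Σℕ-map (a ∷_) ws weight) (Σℕ-* ws (W a) weight)) (Σ-weight-cons as ws) ⟩
      W a * Σℕ ws weight + Σℕ as W * Σℕ ws weight ≡⟨ *-distribʳ-+ (Σℕ ws weight) (W a) (Σℕ as W) ⟨
      Σℕ (a ∷ as) W * Σℕ ws weight ∎
      where open ≡-Reasoning

    Σ-weight : ∀ n → Σℕ (words (upTo q) n) weight ≡ Σℕ (upTo q) W ^ n
    Σ-weight zero    = refl
    Σ-weight (suc n) = trans (Σ-weight-cons (upTo q) (words (upTo q) n)) (cong (Σℕ (upTo q) W *_) (Σ-weight n))

    Σℕ-filter : {A : Set} {P : A → Set} (P? : Decidable P) (xs : List A) (f : A → ℕ) → Σℕ (filter P? xs) f ≤ Σℕ xs f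
    Σℕ-filter P? []       f = z≤n
    Σℕ-filter P? (x ∷ xs) f with P? x
    ... | yes _ = +-monoʳ-≤ (f x) (Σℕ-filter P? xs f)
    ... | no  _ = ≤-trans (Σℕ-filter P? xs f) (m≤n+m _ (f x))

  -- Markov's inequality: every member has weight at least 10^n, while the weights of all exponents
  -- sum to the n-th power of the sum of `W`, hence to at most (19 q / 2)^n.
  length-lows : ∀ n → length (lows n) * 20 ^ n ≤ (19 * q) ^ n
  length-lows n = begin
    length (lows n) * 20 ^ n ≡⟨ cong (length (lows n) *_) (^-distribʳ-* n 2 10) ⟩
    length (lows n) * (2 ^ n * 10 ^ n) ≡⟨ lem (length (lows n)) (2 ^ n) (10 ^ n) ⟩
    2 ^ n * (length (lows n) * 10 ^ n) ≤⟨ *-monoʳ-≤ (2 ^ n) (Σℕ-≥ (lows n) (λ a a∈ → proj₂ (∈-filter⁻ (λ a → 10 ^ n ≤? weight a) {xs = words (upTo q) n} a∈))) ⟩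
    2 ^ n * Σℕ (lows n) weight ≤⟨ *-monoʳ-≤ (2 ^ n) (Σℕ-filter _ (words (upTo q) n) weight) ⟩
    2 ^ n * Σℕ (words (upTo q) n) weight ≡⟨ cong (2 ^ n *_) (Σ-weight n) ⟩
    2 ^ n * Σℕ (upTo q) W ^ n ≡⟨ ^-distribʳ-* n 2 (Σℕ (upTo q) W) ⟨
    (2 * Σℕ (upTo q) W) ^ n ≤⟨ ^-monoˡ-≤ n ΣW≤ ⟩
    (19 * q) ^ n ∎
    where
    open ≤-Reasoning
    lem : ∀ a b c → a * (b * c) ≡ b * (a * c)
    lem = solve-∀

  -- Orthogonality and elimination

  module _ {I : Set} where

    ⟨_∣_,_⟩ : List I → (I → 𝔽) → (I → 𝔽) → 𝔽
    ⟨ B ∣ f , φ ⟩ = ∑ B (λ t → f t ⊗ φ t)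

    pair-linear : (B : List I) (f u v : I → 𝔽) (s : 𝔽) → ⟨ B ∣ f , (λ t → u t ⊕ s ⊗ v t) ⟩ ≡ ⟨ B ∣ f , u ⟩ ⊕ s ⊗ ⟨ B ∣ f , v ⟩
    pair-linear B f u v s = begin
      ∑ B (λ t → f t ⊗ (u t ⊕ s ⊗ v t)) ≡⟨ ∑-cong B (λ t _ → solve 4 (λ f u s v → f :* (u :+ s :* v) := f :* u :+ s :* (f :* v)) refl (f t) (u t) s (v t)) ⟩
      ∑ B (λ t → f t ⊗ u t ⊕ s ⊗ (f t ⊗ v t)) ≡⟨ ∑-⊕ B _ _ ⟩
      ⟨ B ∣ f , u ⟩ ⊕ ∑ B (λ t → s ⊗ (f t ⊗ v t)) ≡⟨ cong (⟨ B ∣ f , u ⟩ ⊕_) (∑-⊗ B s _) ⟩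
      ⟨ B ∣ f , u ⟩ ⊕ s ⊗ ⟨ B ∣ f , v ⟩ ∎
      where open ≡-Reasoning

    module _ (_≟_ : DecidableEquality I) (B : List I) where
      open import Data.List.Membership.DecPropositional _≟_ using (_∈?_)

      -- A reduced echelon basis for functions orthogonal to `L`. The list `J` holds the pivots, and
      -- `e i`, for `i` outside `J`, is the basis vector belonging to the free position `i`.
      record Elimination (L : List (I → 𝔽)) : Set where
        field
          J          : List I
          e          : I → I → 𝔽
          J-small    : length J ≤ length L
          orthogonal : ∀ i → i ∈ B → i ∉ J → ∀ f → f ∈ L → ⟨ B ∣ f , e i ⟩ ≡ 0#
          e-off      : ∀ i j → i ∉ J → j ∉ J → j ≢ i → e i j ≡ 0#
          e-diag     : ∀ i → i ∉ J → e i i ≡ 1#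

      private
        unit : I → I → 𝔽
        unit i j with i ≟ j
        ... | yes _ = 1#
        ... | no  _ = 0#

        unit-diag : ∀ i → unit i i ≡ 1#
        unit-diag i with i ≟ i
        ... | yes _ = refl
        ... | no ne = ⊥-elim (ne refl)

        unit-off : ∀ i j → j ≢ i → unit i j ≡ 0#
        unit-off i j ne with i ≟ j
        ... | yes e = ⊥-elim (ne (sym e))
        ... | no _  = refl

      eliminate : ∀ L → Elimination L
      eliminate [] = record
        { J = [] ; e = unit ; J-small = z≤n ; orthogonal = λ _ _ _ _ () ; e-off = λ i j _ _ → unit-off i j ; e-diag = λ i _ → unit-diag i }
      eliminate (f ∷ L) with eliminate L
      ... | E with Any.any? (λ i → ¬? (i ∈? Elimination.J E) ×-dec ¬? (⟨ B ∣ f , Elimination.e E i ⟩ ≟ᶠ 0#)) B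
      ... | no none = record
        { Elimination E
        ; J-small    = m≤n⇒m≤1+n (Elimination.J-small E)
        ; orthogonal = λ { i i∈ i∉ g (here refl) → decidable-stable (_ ≟ᶠ 0#) (λ ne → none (Any.map (λ { refl → i∉ , ne }) i∈))
                         ; i i∈ i∉ g (there g∈)  → Elimination.orthogonal E i i∈ i∉ g g∈ } }
      ... | yes some with find some
      ... | i₀ , i₀∈ , i₀∉ , ne = record
        { J          = i₀ ∷ J
        ; e          = e′
        ; J-small    = s≤s J-small
        ; orthogonal = orth
        ; e-off      = λ i j i∉ j∉ j≢i → trans (cong₂ (λ a b → a ⊕ s i ⊗ b) (e-off i j (i∉ ∘ there) (j∉ ∘ there) j≢i)
                                            (e-off i₀ j i₀∉ (j∉ ∘ there) (λ { refl → j∉ (here refl) }))) (0+s0 (s i))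
        ; e-diag     = λ i i∉ → trans (cong₂ (λ a b → a ⊕ s i ⊗ b) (e-diag i (i∉ ∘ there))
                                         (e-off i₀ i i₀∉ (i∉ ∘ there) (λ { refl → i∉ (here refl) }))) (1+s0 (s i))
        }
        where
        open Elimination E
        c = inv ⟨ B ∣ f , e i₀ ⟩ ne
        -- The multiple of `e i₀` that makes `e i` orthogonal to the new functional. The vector
        -- `e i₀` itself is used up, so `i₀` becomes a pivot.
        s : I → 𝔽
        s i = ⊝ (⟨ B ∣ f , e i ⟩ ⊗ c)
        e′ : I → I → 𝔽
        e′ i j = e i j ⊕ s i ⊗ e i₀ j
        0+s0 : ∀ s → 0# ⊕ s ⊗ 0# ≡ 0#
        0+s0 = solve 1 (λ s → :0 :+ s :* :0 := :0) refl
        1+s0 : ∀ s → 1# ⊕ s ⊗ 0# ≡ 1#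
        1+s0 = solve 1 (λ s → :1 :+ s :* :0 := :1) refl
        orth : ∀ i → i ∈ B → i ∉ i₀ ∷ J → ∀ g → g ∈ f ∷ L → ⟨ B ∣ g , e′ i ⟩ ≡ 0#
        orth i i∈ i∉ g (there g∈) = trans (pair-linear B g (e i) (e i₀) (s i))
          (trans (cong₂ (λ a b → a ⊕ s i ⊗ b) (orthogonal i i∈ (i∉ ∘ there) g g∈) (orthogonal i₀ i₀∈ i₀∉ g g∈)) (0+s0 (s i)))
        orth i i∈ i∉ g (here refl) = begin
          ⟨ B ∣ f , e′ i ⟩ ≡⟨ pair-linear B f (e i) (e i₀) (s i) ⟩
          ⟨ B ∣ f , e i ⟩ ⊕ ⊝ (⟨ B ∣ f , e i ⟩ ⊗ c) ⊗ ⟨ B ∣ f , e i₀ ⟩ ≡⟨ solve 3 (λ a c b → a :+ :- (a :* c) :* b := a :+ :- (a :* (b :* c))) refl _ c _ ⟩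
          ⟨ B ∣ f , e i ⟩ ⊕ ⊝ (⟨ B ∣ f , e i ⟩ ⊗ (⟨ B ∣ f , e i₀ ⟩ ⊗ c)) ≡⟨ cong (λ z → ⟨ B ∣ f , e i ⟩ ⊕ ⊝ (⟨ B ∣ f , e i ⟩ ⊗ z)) (inv-right _ ne) ⟩
          ⟨ B ∣ f , e i ⟩ ⊕ ⊝ (⟨ B ∣ f , e i ⟩ ⊗ 1#) ≡⟨ solve 1 (λ a → a :+ :- (a :* :1) := :0) refl _ ⟩
          0# ∎
          where open ≡-Reasoning

      private
        pair-unit : Unique B → ∀ j → j ∈ B → (φ : I → 𝔽) → ⟨ B ∣ unit j , φ ⟩ ≡ φ j
        pair-unit u j j∈ φ = trans (∑-single u j∈ (λ x _ x≢j → trans (cong (_⊗ φ x) (unit-off j x x≢j)) (⊗-zeroˡ _)))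
                               (trans (cong (_⊗ φ j) (unit-diag j)) (⊗-identityˡ _))

      -- φ vanishes on the exceptional set of the elimination of L that supplies ψ.
      orthogonal-pair : Unique B → ∀ L → 2 * length L < length B →
        ∃[ i ] ∃[ φ ] ∃[ ψ ] (i ∈ B × φ i ≡ 1# × ψ i ≡ 1# × (∀ j → j ∈ B → j ≢ i → φ j ⊗ ψ j ≡ 0#) ×
          (∀ f → f ∈ L → ⟨ B ∣ f , φ ⟩ ≡ 0# × ⟨ B ∣ f , ψ ⟩ ≡ 0#))
      orthogonal-pair u L lt with eliminate L
      ... | E with eliminate (L ++ map unit (Elimination.J E))
      ... | E′ with outside _≟_ u (≤-<-trans (≤-trans (Elimination.J-small E′) (≤-trans (≤-reflexive (length-++ L))
                     (+-monoʳ-≤ (length L) (≤-trans (≤-reflexive (length-map unit (Elimination.J E)))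
                       (≤-trans (Elimination.J-small E) (m≤m+n (length L) 0)))))) lt)
      ... | i , i∈ , i∉ = i , φ , E.e i , i∈ , φi , E.e-diag i i∉J , off ,
            (λ f f∈ → E′.orthogonal i i∈ i∉ f (∈-++⁺ˡ f∈) , E.orthogonal i i∈ i∉J f f∈)
        where
        module E = Elimination E
        module E′ = Elimination E′
        φ = E′.e i
        φi : φ i ≡ 1#
        φi = E′.e-diag i i∉
        φ-J : ∀ j → j ∈ B → j ∈ E.J → φ j ≡ 0#
        φ-J j j∈ j∈J = trans (sym (pair-unit u j j∈ φ)) (E′.orthogonal i i∈ i∉ (unit j) (∈-++⁺ʳ L (∈-map⁺ unit j∈J)))
        i∉J : i ∉ E.J
        i∉J i∈J = 0≢1 (trans (sym (φ-J i i∈ i∈J)) φi)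
        off : ∀ j → j ∈ B → j ≢ i → φ j ⊗ E.e i j ≡ 0#
        off j j∈ j≢i with j ∈? E.J
        ... | yes j∈J = trans (cong (_⊗ E.e i j) (φ-J j j∈ j∈J)) (⊗-zeroˡ _)
        ... | no j∉J  = trans (cong (φ j ⊗_) (E.e-off i j i∉J j∉J j≢i)) (⊗-zeroʳ _)

  -- Slice rank

  ∑-cartesian : {A B C : Set} (f : A → B → C) (xs : List A) (ys : List B) (g : C → 𝔽) →
    ∑ (cartesianProductWith f xs ys) g ≡ ∑ xs (λ x → ∑ ys (λ y → g (f x y)))
  ∑-cartesian f []       ys g = refl
  ∑-cartesian f (x ∷ xs) ys g = trans (∑-++ (map (f x) ys)) (cong₂ _⊕_ (∑-map ys) (∑-cartesian f xs ys g))
    where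
    ∑-++ : ∀ as {bs} → ∑ (as ++ bs) g ≡ ∑ as g ⊕ ∑ bs g
    ∑-++ []       = sym (⊕-identityˡ _)
    ∑-++ (a ∷ as) = trans (cong (g a ⊕_) (∑-++ as)) (sym (⊕-assoc _ _ _))
    ∑-map : ∀ as → ∑ (map (f x) as) g ≡ ∑ as (λ y → g (f x y))
    ∑-map []       = refl
    ∑-map (a ∷ as) = cong (g (f x a) ⊕_) (∑-map as)

  module _ {n : ℕ} (B : List (Point n)) where

    triples : List (Point³ n)
    triples = cartesianProductWith _,_ B (cartesianProductWith _,_ B B)

    ∑-product : (f g h : Point n → 𝔽) → ∑ triples (λ (t , x , y) → f t ⊗ (g x ⊗ h y)) ≡ ∑ B f ⊗ (∑ B g ⊗ ∑ B h)
    ∑-product f g h = begin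
      ∑ triples (λ (t , x , y) → f t ⊗ (g x ⊗ h y))
        ≡⟨ ∑-cartesian _,_ B _ _ ⟩
      ∑ B (λ t → ∑ (cartesianProductWith _,_ B B) (λ (x , y) → f t ⊗ (g x ⊗ h y)))
        ≡⟨ ∑-cong B (λ t _ → trans (∑-⊗ (cartesianProductWith _,_ B B) (f t) _) (cong (f t ⊗_) (∑-cartesian _,_ B B _))) ⟩
      ∑ B (λ t → f t ⊗ ∑ B (λ x → ∑ B (λ y → g x ⊗ h y)))
        ≡⟨ ∑-⊗ʳ B _ f ⟩
      ∑ B f ⊗ ∑ B (λ x → ∑ B (λ y → g x ⊗ h y))
        ≡⟨ cong (∑ B f ⊗_) (trans (∑-cong B (λ x _ → ∑-⊗ B (g x) h)) (∑-⊗ʳ B _ g)) ⟩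
      ∑ B f ⊗ (∑ B g ⊗ ∑ B h) ∎
      where open ≡-Reasoning

    weighted : (φ ψ χ : Point n → 𝔽) → (Point³ n → 𝔽) → 𝔽
    weighted φ ψ χ f = ∑ triples (λ (t , x , y) → φ t ⊗ (ψ x ⊗ χ y) ⊗ f (t , x , y))

    -- On a monomial the triple sum factors into three pairings. By `fits⇒low` one of its exponents
    -- is low, so one factor is zero. The remaining constructors of `Comb` amount to linearity.
    weighted-vanishes : (φ ψ χ : Point n → 𝔽) →
      (∀ a → a ∈ lows n → ⟨ B ∣ monomial a , φ ⟩ ≡ 0# × ⟨ B ∣ monomial a , ψ ⟩ ≡ 0# × ⟨ B ∣ monomial a , χ ⟩ ≡ 0#) →
      ∀ {f} → Comb (eval {n}) f → weighted φ ψ χ f ≡ 0#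
    weighted-vanishes φ ψ χ h (mono ((a , b , c) , fits)) = begin
      ∑ triples (λ (t , x , y) → φ t ⊗ (ψ x ⊗ χ y) ⊗ (monomial a t ⊗ monomial b x ⊗ monomial c y))
        ≡⟨ ∑-cong triples (λ (t , x , y) _ → solve 6 (λ f g h A B C → f :* (g :* h) :* (A :* B :* C) := A :* f :* (B :* g :* (C :* h))) refl
             (φ t) (ψ x) (χ y) (monomial a t) (monomial b x) (monomial c y)) ⟩
      ∑ triples (λ (t , x , y) → monomial a t ⊗ φ t ⊗ (monomial b x ⊗ ψ x ⊗ (monomial c y ⊗ χ y)))
        ≡⟨ ∑-product (λ t → monomial a t ⊗ φ t) _ _ ⟩
      ⟨ B ∣ monomial a , φ ⟩ ⊗ (⟨ B ∣ monomial b , ψ ⟩ ⊗ ⟨ B ∣ monomial c , χ ⟩)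
        ≡⟨ vanish (fits⇒low a b c fits) ⟩
      0# ∎
      where
      open ≡-Reasoning
      vanish : a ∈ lows n ⊎ b ∈ lows n ⊎ c ∈ lows n →
        ⟨ B ∣ monomial a , φ ⟩ ⊗ (⟨ B ∣ monomial b , ψ ⟩ ⊗ ⟨ B ∣ monomial c , χ ⟩) ≡ 0#
      vanish (inj₁ a∈)        = trans (cong (_⊗ _) (proj₁ (h a a∈))) (⊗-zeroˡ _)
      vanish (inj₂ (inj₁ b∈)) = trans (cong (λ z → ⟨ B ∣ monomial a , φ ⟩ ⊗ (z ⊗ ⟨ B ∣ monomial c , χ ⟩)) (proj₁ (proj₂ (h b b∈))))
                                  (solve 2 (λ x y → x :* (:0 :* y) := :0) refl _ _)
      vanish (inj₂ (inj₂ c∈)) = trans (cong (λ z → ⟨ B ∣ monomial a , φ ⟩ ⊗ (⟨ B ∣ monomial b , ψ ⟩ ⊗ z)) (proj₂ (proj₂ (h c c∈))))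
                                  (solve 2 (λ x y → x :* (y :* :0) := :0) refl _ _)
    weighted-vanishes φ ψ χ h nil         = ∑-zero triples (λ _ _ → ⊗-zeroʳ _)
    weighted-vanishes φ ψ χ h (add c d)   = trans (∑-cong triples (λ _ _ → solve 3 (λ w a b → w :* (a :+ b) := w :* a :+ w :* b) refl _ _ _))
      (trans (∑-⊕ triples _ _) (trans (cong₂ _⊕_ (weighted-vanishes φ ψ χ h c) (weighted-vanishes φ ψ χ h d)) (⊕-identityˡ 0#)))
    weighted-vanishes φ ψ χ h (scale s c) = trans (∑-cong triples (λ _ _ → solve 3 (λ w s a → w :* (s :* a) := s :* (w :* a)) refl _ s _))
      (trans (∑-⊗ triples s _) (trans (cong (s ⊗_) (weighted-vanishes φ ψ χ h c)) (⊗-zeroʳ s)))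
    weighted-vanishes φ ψ χ h (ext e c)   = trans (∑-cong triples (λ p _ → cong (_ ⊗_) (sym (e p)))) (weighted-vanishes φ ψ χ h c)

  -- The slice-rank bound for a diagonal tensor, proved by pairing. If `B` were larger,
  -- `orthogonal-pair` would give φ and ψ orthogonal to all low monomials, so that φ(t) ψ(x) φ(y)
  -- `κ`(t, x, y) sums to zero over triples from `B`. But `κ` is supported on the diagonal there,
  -- and φψ only at one point i, which leaves `κ`(i, i, i) ≠ 0.
  trinomial-bound : ∀ {n} (λ₀ λ₁ λ₂ : 𝔽) → λ₀ ⊕ λ₁ ⊕ λ₂ ≡ 0# → (B : List (Point n)) → Unique B →
    (∀ t x y → t ∈ B → x ∈ B → y ∈ B → (∀ i → λ₀ ⊗ lookup t i ⊕ λ₁ ⊗ lookup x i ⊕ λ₂ ⊗ lookup y i ≡ 0#) → x ≡ t × y ≡ t) →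
    length B ≤ 2 * length (lows n)
  trinomial-bound {n} λ₀ λ₁ λ₂ sum0 B u only = ≮⇒≥ contra
    where
    contra : 2 * length (lows n) < length B → ⊥
    contra lt with orthogonal-pair _≟ᵖ_ B u (map monomial (lows n)) (subst (λ l → 2 * l < length B) (sym (length-map _ (lows n))) lt)
    ... | i , φ , ψ , i∈ , φi , ψi , off , orth = κ-≢0 λ₀ λ₁ λ₂ n i i i trivial (begin
      K (i , i , i) ≡⟨ solve 1 (λ k → k := :1 :* (:1 :* :1) :* k) refl _ ⟩
      1# ⊗ (1# ⊗ 1#) ⊗ K (i , i , i) ≡⟨ cong₂ (λ a b → a ⊗ (b ⊗ a) ⊗ K (i , i , i)) φi ψi ⟨
      φ i ⊗ (ψ i ⊗ φ i) ⊗ K (i , i , i) ≡⟨ ∑-single triples-unique i∈triples single ⟨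
      weighted B φ ψ φ K ≡⟨ weighted-vanishes B φ ψ φ
                                            (λ a a∈ → let p , r = orth (monomial a) (∈-map⁺ monomial a∈) in p , r , p)
                                            (κ-comb λ₀ λ₁ λ₂ n) ⟩
      0# ∎)
      where
      open ≡-Reasoning
      K = κ λ₀ λ₁ λ₂ n
      trivial : ∀ j → form λ₀ λ₁ λ₂ (lookup i j , lookup i j , lookup i j) ≡ 0#
      trivial j = trans (solve 4 (λ a b c x → a :* x :+ b :* x :+ c :* x := (a :+ b :+ c) :* x) refl λ₀ λ₁ λ₂ (lookup i j))
                    (trans (cong (_⊗ lookup i j) sum0) (⊗-zeroˡ _))
      pairs-unique = Uniq.cartesianProductWith⁺ _,_ (λ { refl → refl , refl }) u u
      triples-unique : Unique (triples B)
      triples-unique = Uniq.cartesianProductWith⁺ _,_ (λ { refl → refl , refl }) u pairs-unique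
      i∈triples : (i , i , i) ∈ triples B
      i∈triples = ∈-cartesianProductWith⁺ _,_ i∈ (∈-cartesianProductWith⁺ _,_ i∈ i∈)
      single : ∀ p → p ∈ triples B → p ≢ (i , i , i) → φ (proj₁ p) ⊗ (ψ (proj₁ (proj₂ p)) ⊗ φ (proj₂ (proj₂ p))) ⊗ K p ≡ 0#
      single p p∈ p≢ with K p ≟ᶠ 0#
      ... | yes e = trans (cong (_ ⊗_) e) (⊗-zeroʳ _)
      ... | no ne with ∈-cartesianProductWith⁻ _,_ B _ p∈
      ... | t , _ , t∈ , r∈ , refl with ∈-cartesianProductWith⁻ _,_ B B r∈
      ... | x , y , x∈ , y∈ , refl with only t x y t∈ x∈ y∈ (κ-≢0⁻ λ₀ λ₁ λ₂ n t x y ne)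
      ... | refl , refl = trans (solve 3 (λ a b k → a :* (b :* a) :* k := a :* b :* (a :* k)) refl (φ t) (ψ t) (K (t , t , t)))
                            (trans (cong (_⊗ (φ t ⊗ K (t , t , t))) (off t t∈ (λ { refl → p≢ refl }))) (⊗-zeroˡ _))

  -- Exponentially small families

  -- This is N ≤ c γ^n with γ = q (1 + d) / (2 + d) < q, cleared of denominators. As γ increases
  -- with d, two bounds can be brought to a common rate by adding their values of d.
  record Small (d c n N : ℕ) : Set where
    constructor small
    field smallness : N * (2 + d) ^ n ≤ c * (q * (1 + d)) ^ n

  open Small

  -- The exit from double negation in all counting arguments: an inequality between natural numbers
  -- is decidable.
  small-stable : ∀ {d c n N} → ¬ ¬ Small d c n N → Small d c n N
  small-stable h = small (decidable-stable (_ ≤? _) (¬¬-map smallness h))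

  small-≤ : ∀ {d c n M N} → M ≤ N → Small d c n N → Small d c n M
  small-≤ {d} {c} {n} M≤N s = small (≤-trans (*-monoˡ-≤ ((2 + d) ^ n) M≤N) (smallness s))

  small-scale : ∀ {d c n N} k → Small d c n N → Small d (k * c) n (k * N)
  small-scale {d} {c} {n} {N} k s = small (begin
    k * N * (2 + d) ^ n ≡⟨ *-assoc k N _ ⟩
    k * (N * (2 + d) ^ n) ≤⟨ *-monoʳ-≤ k (smallness s) ⟩
    k * (c * (q * (1 + d)) ^ n) ≡⟨ *-assoc k c _ ⟨
    k * c * (q * (1 + d)) ^ n ∎)
    where open ≤-Reasoning

  small-slower : ∀ {d d′ c n N} → d ≤ d′ → Small d c n N → Small d′ c n N
  small-slower {d} {d′} {c} {n} {N} d≤d′ s = small (*-cancelʳ-≤ _ _ ((1 + d) ^ n) {{m^n≢0 (1 + d) n}} (begin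
    N * (2 + d′) ^ n * (1 + d) ^ n ≡⟨ trans (*-assoc N _ _) (cong (N *_) (sym (^-distribʳ-* n (2 + d′) (1 + d)))) ⟩
    N * ((2 + d′) * (1 + d)) ^ n ≤⟨ *-monoʳ-≤ N (^-monoˡ-≤ n (begin
      (2 + d′) * (1 + d) ≡⟨ lem₁ d d′ ⟩
      2 + d + d′ + d + d * d′ ≤⟨ +-monoˡ-≤ (d * d′) (+-monoʳ-≤ (2 + d + d′) d≤d′) ⟩
      2 + d + d′ + d′ + d * d′ ≡⟨ lem₂ d d′ ⟩
      (2 + d) * (1 + d′) ∎)) ⟩
    N * ((2 + d) * (1 + d′)) ^ n ≡⟨ trans (cong (N *_) (^-distribʳ-* n (2 + d) (1 + d′))) (sym (*-assoc N _ _)) ⟩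
    N * (2 + d) ^ n * (1 + d′) ^ n ≤⟨ *-monoˡ-≤ ((1 + d′) ^ n) (smallness s) ⟩
    c * (q * (1 + d)) ^ n * (1 + d′) ^ n ≡⟨ trans (*-assoc c _ _) (cong (c *_) (sym (^-distribʳ-* n (q * (1 + d)) (1 + d′)))) ⟩
    c * (q * (1 + d) * (1 + d′)) ^ n ≡⟨ cong (λ z → c * z ^ n) (lem₃ q (1 + d) (1 + d′)) ⟩
    c * (q * (1 + d′) * (1 + d)) ^ n ≡⟨ trans (cong (c *_) (^-distribʳ-* n (q * (1 + d′)) (1 + d))) (sym (*-assoc c _ _)) ⟩
    c * (q * (1 + d′)) ^ n * (1 + d) ^ n ∎))
    where
    open ≤-Reasoning
    lem₁ : ∀ d d′ → (2 + d′) * (1 + d) ≡ 2 + d + d′ + d + d * d′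
    lem₁ = solve-∀
    lem₂ : ∀ d d′ → 2 + d + d′ + d′ + d * d′ ≡ (2 + d) * (1 + d′)
    lem₂ = solve-∀
    lem₃ : ∀ a b c → a * b * c ≡ a * c * b
    lem₃ = solve-∀

  small-+ : ∀ {d c d′ c′ n M N} → Small d c n M → Small d′ c′ n N → Small (d + d′) (c + c′) n (M + N)
  small-+ {d} {c} {d′} {c′} {n} {M} {N} s t = small (begin
    (M + N) * (2 + (d + d′)) ^ n ≡⟨ *-distribʳ-+ _ M N ⟩
    M * (2 + (d + d′)) ^ n + N * (2 + (d + d′)) ^ n ≤⟨ +-mono-≤ (smallness (small-slower (m≤m+n d d′) s))
                                            (smallness (small-slower (m≤n+m d′ d) t)) ⟩
    c * (q * (1 + (d + d′))) ^ n + c′ * (q * (1 + (d + d′))) ^ n ≡⟨ *-distribʳ-+ _ c c′ ⟨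
    (c + c′) * (q * (1 + (d + d′))) ^ n ∎)
    where open ≤-Reasoning

  small-const : ∀ {d c n N} → N ≤ c → Small d c n N
  small-const {d} {c} {n} N≤c = small (*-mono-≤ N≤c (^-monoˡ-≤ n (begin
    2 + d ≤⟨ m≤m+n (2 + d) d ⟩
    2 + d + d ≡⟨ lem d ⟩
    2 * (1 + d) ≤⟨ *-monoˡ-≤ (1 + d) 2≤q ⟩
    q * (1 + d) ∎)))
    where
    open ≤-Reasoning
    lem : ∀ d → 2 + d + d ≡ 2 * (1 + d)
    lem = solve-∀

  private
    -- A division-free form of (1 + 1/a)^j ≤ 1 / (1 − j/a).
    bernoulli : ∀ a j m → j + m ≡ a → (a + 1) ^ j * m ≤ a * a ^ j
    bernoulli a zero    m e = ≤-reflexive (trans (*-identityˡ m) (trans e (sym (*-identityʳ a))))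
    bernoulli a (suc j) m e = begin
      (a + 1) * (a + 1) ^ j * m ≡⟨ lem₁ a ((a + 1) ^ j) m ⟩
      (a + 1) ^ j * (a * m + m) ≤⟨ *-monoʳ-≤ ((a + 1) ^ j) (+-monoʳ-≤ (a * m) (subst (m ≤_) e (m≤n+m m (suc j)))) ⟩
      (a + 1) ^ j * (a * m + a) ≡⟨ lem₂ a ((a + 1) ^ j) m ⟩
      a * ((a + 1) ^ j * suc m) ≤⟨ *-monoʳ-≤ a (bernoulli a j (suc m) (trans (+-suc j m) e)) ⟩
      a * (a * a ^ j) ∎
      where
      open ≤-Reasoning
      lem₁ : ∀ a x m → (a + 1) * x * m ≡ x * (a * m + m)
      lem₁ = solve-∀
      lem₂ : ∀ a x m → x * (a * m + a) ≡ a * (x * (1 + m))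
      lem₂ = solve-∀

    -- With a = 1 + 2ℓ, `bernoulli` gives (1 + 1/a)^ℓ ≤ a / (1 + ℓ) < 2, and q is at least 2.
    growth : ∀ ℓ → (2 + 2 * ℓ) ^ ℓ ≤ q * (1 + 2 * ℓ) ^ ℓ
    growth ℓ = *-cancelˡ-≤ (1 + 2 * ℓ) (begin
      a * (2 + 2 * ℓ) ^ ℓ ≤⟨ *-monoˡ-≤ ((2 + 2 * ℓ) ^ ℓ) (n≤1+n a) ⟩
      (2 + 2 * ℓ) * (2 + 2 * ℓ) ^ ℓ ≡⟨ cong (λ z → (2 + 2 * ℓ) * z ^ ℓ) (lem₁ ℓ) ⟩
      (2 + 2 * ℓ) * (a + 1) ^ ℓ ≡⟨ lem₂ ℓ ((a + 1) ^ ℓ) ⟩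
      2 * ((a + 1) ^ ℓ * (1 + ℓ)) ≤⟨ *-mono-≤ 2≤q (bernoulli a ℓ (1 + ℓ) (lem₃ ℓ)) ⟩
      q * (a * a ^ ℓ) ≡⟨ lem₄ q a (a ^ ℓ) ⟩
      a * (q * a ^ ℓ) ∎)
      where
      open ≤-Reasoning
      a = 1 + 2 * ℓ
      lem₁ : ∀ ℓ → 2 + 2 * ℓ ≡ 1 + 2 * ℓ + 1
      lem₁ = solve-∀
      lem₂ : ∀ ℓ x → (2 + 2 * ℓ) * x ≡ 2 * (x * (1 + ℓ))
      lem₂ = solve-∀
      lem₃ : ∀ ℓ → ℓ + (1 + ℓ) ≡ 1 + 2 * ℓ
      lem₃ = solve-∀
      lem₄ : ∀ x y z → x * (y * z) ≡ y * (x * z)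
      lem₄ = solve-∀

    ^-comm : ∀ a m n → (a ^ m) ^ n ≡ (a ^ n) ^ m
    ^-comm a m n = trans (^-*-assoc a m n) (trans (cong (a ^_) (*-comm m n)) (sym (^-*-assoc a n m)))

    ^-cancel-≤ : ∀ ℓ {x y} → x ^ suc ℓ ≤ y ^ suc ℓ → x ≤ y
    ^-cancel-≤ ℓ {x} {y} le = ≮⇒≥ (λ lt → <⇒≱ (^-monoˡ-< (suc ℓ) lt) le)

  -- With L = `suc ℓ`, the hypothesis says that M is at most the L-th root of C times q^((1 - 1/L)
  -- n). Such a root may be irrational; `growth` replaces q^(-1/L) by the larger fraction (1 + 2L) /
  -- (2 + 2L), which is the rate d = 2L.
  small-root : ∀ ℓ {C n M} → 1 ≤ C → M ^ suc ℓ * q ^ n ≤ (q ^ n) ^ suc ℓ * C → Small (2 * suc ℓ) C n M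
  small-root ℓ′ {C} {n} {M} 1≤C h = small (^-cancel-≤ ℓ′ (*-cancelʳ-≤ _ _ (q ^ n) {{m^n≢0 q n}} (begin
    (M * (1 + a) ^ n) ^ ℓ * q ^ n ≡⟨ cong (_* q ^ n) (trans (^-distribʳ-* ℓ M _) (cong (M ^ ℓ *_) (^-comm (1 + a) n ℓ))) ⟩
    M ^ ℓ * ((1 + a) ^ ℓ) ^ n * q ^ n ≡⟨ lem₁ (M ^ ℓ) _ (q ^ n) ⟩
    M ^ ℓ * q ^ n * ((1 + a) ^ ℓ) ^ n ≤⟨ *-mono-≤ h (^-monoˡ-≤ n (growth ℓ)) ⟩
    (q ^ n) ^ ℓ * C * (q * a ^ ℓ) ^ n ≤⟨ *-monoˡ-≤ _ (*-monoʳ-≤ ((q ^ n) ^ ℓ) C≤) ⟩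
    (q ^ n) ^ ℓ * C ^ ℓ * (q * a ^ ℓ) ^ n ≡⟨ cong ((q ^ n) ^ ℓ * C ^ ℓ *_) (trans (^-distribʳ-* n q (a ^ ℓ)) (cong (q ^ n *_) (^-comm a ℓ n))) ⟩
    (q ^ n) ^ ℓ * C ^ ℓ * (q ^ n * (a ^ n) ^ ℓ) ≡⟨ lem₂ ((q ^ n) ^ ℓ) (C ^ ℓ) (q ^ n) _ ⟩
    C ^ ℓ * ((q ^ n) ^ ℓ * (a ^ n) ^ ℓ) * q ^ n ≡⟨ cong (λ z → C ^ ℓ * z * q ^ n) (^-distribʳ-* ℓ (q ^ n) (a ^ n)) ⟨
    C ^ ℓ * (q ^ n * a ^ n) ^ ℓ * q ^ n ≡⟨ cong (λ z → C ^ ℓ * z ^ ℓ * q ^ n) (^-distribʳ-* n q a) ⟨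
    C ^ ℓ * ((q * a) ^ n) ^ ℓ * q ^ n ≡⟨ cong (_* q ^ n) (^-distribʳ-* ℓ C _) ⟨
    (C * (q * a) ^ n) ^ ℓ * q ^ n ∎)))
    where
    open ≤-Reasoning
    ℓ = suc ℓ′
    a = 1 + 2 * ℓ
    C≤ : C ≤ C ^ ℓ
    C≤ = ≤-trans (≤-reflexive (sym (*-identityʳ C))) (*-monoʳ-≤ C (≤-trans (≤-reflexive (sym (^-zeroˡ ℓ′))) (^-monoˡ-≤ ℓ′ 1≤C)))
    lem₁ : ∀ a b c → a * b * c ≡ a * c * b
    lem₁ = solve-∀
    lem₂ : ∀ a b c d → a * b * (c * d) ≡ b * (a * d) * c
    lem₂ = solve-∀

  small-split : ∀ {d c d′ c′ n} {A : Set} {P : A → Set} (P? : Decidable P) (B : List A) →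
    Small d c n (count (¬? ∘ P?) B) → Small d′ c′ n (count P? B) → Small (d + d′) (c + c′) n (length B)
  small-split P? B s t = small-≤ (count-+ (¬? ∘ P?) P? B (λ x _ → case P? x of λ { (yes p) → inj₂ p ; (no p) → inj₁ p })) (small-+ s t)

  -- Linear spans

  -- The coefficient of each generator is moved to the side of `v`, so that the base case is simply
  -- v = 0. Taking `v` as a function saves packing linear expressions into vectors.
  Span : ∀ {n} → List (Point n) → (Fin n → 𝔽) → Set
  Span []       v = ∀ t → v t ≡ 0#
  Span (g ∷ gs) v = ∃[ c ] Span gs (λ t → v t ⊕ c ⊗ lookup g t)

  span-resp : ∀ {n} (gs : List (Point n)) {v w} → (∀ t → v t ≡ w t) → Span gs v → Span gs w
  span-resp []       e h       = λ t → trans (sym (e t)) (h t)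
  span-resp (g ∷ gs) e (c , h) = c , span-resp gs (λ t → cong (_⊕ c ⊗ lookup g t) (e t)) h

  span-⊗ : ∀ {n} (gs : List (Point n)) {v} s → Span gs v → Span gs (λ t → s ⊗ v t)
  span-⊗ []       s h       = λ t → trans (cong (s ⊗_) (h t)) (⊗-zeroʳ s)
  span-⊗ (g ∷ gs) s (c , h) = s ⊗ c , span-resp gs (λ t → solve 4 (λ s v c g → s :* (v :+ c :* g) := s :* v :+ s :* c :* g) refl s _ c _) (span-⊗ gs s h)

  span-⊕ : ∀ {n} (gs : List (Point n)) {v w} → Span gs v → Span gs w → Span gs (λ t → v t ⊕ w t)
  span-⊕ []       h k = λ t → trans (cong₂ _⊕_ (h t) (k t)) (⊕-identityˡ 0#)
  span-⊕ (g ∷ gs) (c , h) (d , k) = c ⊕ d ,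
    span-resp gs (λ t → solve 5 (λ v w c d g → v :+ c :* g :+ (w :+ d :* g) := v :+ w :+ (c :+ d) :* g) refl _ _ c d _) (span-⊕ gs h k)

  span-0 : ∀ {n} (gs : List (Point n)) {v} → (∀ t → v t ≡ 0#) → Span gs v
  span-0 []       h = h
  span-0 (g ∷ gs) h = 0# , span-0 gs (λ t → trans (cong (_⊕ 0# ⊗ lookup g t) (h t)) (solve 1 (λ g → :0 :+ :0 :* g := :0) refl _))

  span-linear : ∀ {n} (gs : List (Point n)) {u v w} a b → Span gs u → Span gs v → (∀ t → a ⊗ u t ⊕ b ⊗ v t ≡ w t) → Span gs w
  span-linear gs a b h k e = span-resp gs e (span-⊕ gs (span-⊗ gs a h) (span-⊗ gs b k))

  span-∷ : ∀ {n} (g : Point n) (gs : List (Point n)) {v} → Span gs v → Span (g ∷ gs) v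
  span-∷ g gs h = 0# , span-resp gs (λ t → solve 2 (λ v g → v := v :+ :0 :* g) refl _ _) h

  span-∈ : ∀ {n} (gs : List (Point n)) {g} → g ∈ gs → Span gs (lookup g)
  span-∈ (g ∷ gs) (here refl) = ⊝ 1# , span-0 gs (λ t → solve 1 (λ g → g :+ :- :1 :* g := :0) refl _)
  span-∈ (g ∷ gs) (there g∈)  = span-∷ g gs (span-∈ gs g∈)

  span-⊆ : ∀ {n} (gs hs : List (Point n)) {v} → (∀ g → g ∈ gs → Span hs (lookup g)) → Span gs v → Span hs v
  span-⊆ []       hs sub h       = span-0 hs h
  span-⊆ (g ∷ gs) hs sub (c , h) = span-linear hs 1# (⊝ c) (span-⊆ gs hs (λ x x∈ → sub x (there x∈)) h) (sub g (here refl))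
    (λ t → solve 3 (λ v c g → :1 :* (v :+ c :* g) :+ :- c :* g := v) refl _ c _)

  span-++ʳ : ∀ {n} (gs hs : List (Point n)) {v} → Span hs v → Span (gs ++ hs) v
  span-++ʳ gs hs = span-⊆ hs (gs ++ hs) (λ g g∈ → span-∈ (gs ++ hs) (∈-++⁺ʳ gs g∈))

  span-cancel : ∀ {n} (gs : List (Point n)) {v} s → s ≢ 0# → Span gs (λ t → s ⊗ v t) → Span gs v
  span-cancel gs {v} s s≢0 h = span-resp gs
    (λ t → trans (solve 3 (λ i s v → i :* (s :* v) := s :* i :* v) refl (inv s s≢0) s (v t))
             (trans (cong (_⊗ v t) (inv-right s s≢0)) (⊗-identityˡ _))) (span-⊗ gs (inv s s≢0) h)

  shift : ∀ {n} → Point n → 𝔽 → Point n → Point n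
  shift a w z = tabulate (λ t → lookup a t ⊕ w ⊗ lookup z t)

  lookup-shift : ∀ {n} (a : Point n) w z t → lookup (shift a w z) t ≡ lookup a t ⊕ w ⊗ lookup z t
  lookup-shift a w z t = Vecₚ.lookup∘tabulate _ t

  shift-inverse : ∀ {n} (a : Point n) w z → shift (shift a (⊝ w) z) w z ≡ a
  shift-inverse a w z = vec-ext (λ t → trans (lookup-shift (shift a (⊝ w) z) w z t) (trans (cong (_⊕ w ⊗ lookup z t) (lookup-shift a (⊝ w) z t))
    (solve 3 (λ a w z → a :+ :- w :* z :+ w :* z := a) refl (lookup a t) w (lookup z t))))

  spanned : ∀ {n} → List (Point n) → List (Point n)
  spanned []       = Vec.replicate _ 0# ∷ []
  spanned (g ∷ gs) = cartesianProductWith (λ c v → shift v c g) 𝔽s (spanned gs)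

  length-spanned : ∀ {n} (gs : List (Point n)) → length (spanned gs) ≡ q ^ length gs
  length-spanned []       = refl
  length-spanned (g ∷ gs) = trans (length-cartesianProductWith _ 𝔽s (spanned gs)) (cong₂ _*_ length-𝔽s (length-spanned gs))

  ∈-spanned : ∀ {n} (gs : List (Point n)) {v} → Span gs (lookup v) → v ∈ spanned gs
  ∈-spanned []       {v} h       = here (vec-ext (λ t → trans (h t) (sym (Vecₚ.lookup-replicate t 0#))))
  ∈-spanned (g ∷ gs) {v} (c , h) = subst (_∈ spanned (g ∷ gs)) (trans (cong (λ z → shift (shift v z g) (⊝ c) g) (solve 1 (λ c → c := :- :- c) refl c)) (shift-inverse v (⊝ c) g))
    (∈-cartesianProductWith⁺ (λ c v → shift v c g) (∈-𝔽s (⊝ c)) (∈-spanned gs {shift v c g} (span-resp gs (λ t → sym (lookup-shift v c g t)) h)))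

  spanned-≤ : ∀ {n} (gs : List (Point n)) {K} → length gs ≤ K → length (spanned gs) ≤ q ^ K
  spanned-≤ gs le = ≤-trans (≤-reflexive (length-spanned gs)) (^-monoʳ-≤ q le)

  outside-span : ∀ {n} (gs : List (Point n)) {B} → Unique B → q ^ length gs < length B → ∃[ b ] (b ∈ B × ¬ Span gs (lookup b))
  outside-span gs {B} u lt with outside _≟ᵖ_ u (subst (_< length B) (sym (length-spanned gs)) lt)
  ... | b , b∈ , b∉ = b , b∈ , λ h → b∉ (∈-spanned gs h)

  -- Averaging over translates

  _∈ᵖ?_ : ∀ {n} (v : Point n) (vs : List (Point n)) → Dec (v ∈ vs)
  v ∈ᵖ? vs = Any.any? (v ≟ᵖ_) vs

  -- Double counting of the pairs (a, z) with a + w z in `T` and a outside `X`. Every z has at least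
  -- |T| - |X| partners, since translation is injective, and each of the at most q^n values of a has
  -- at most C / p partners. The factor p carries the power still to be treated in the recursion of
  -- `select`.
  average : ∀ {n} (w : 𝔽) (Z T X : List (Point n)) → Unique T → (p C : ℕ) →
    (∀ a → a ∉ X → count (λ z → shift a w z ∈ᵖ? T) Z * p ≤ C) →
    length Z * (length T ∸ length X) * p ≤ q ^ n * C
  average {n} w Z T X uT p C h = begin
    length Z * (length T ∸ length X) * p ≤⟨ *-monoˡ-≤ p (Σℕ-≥ Z (λ z _ → many z)) ⟩
    Σℕ Z (λ z → count (λ a → shift a w z ∈ᵖ? T) As) * p ≡⟨ cong (_* p) (double-count (λ a z → shift a w z ∈ᵖ? T) As Z) ⟨
    Σℕ As (λ a → count (λ z → shift a w z ∈ᵖ? T) Z) * p ≡⟨ *-comm _ p ⟩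
    p * Σℕ As (λ a → count (λ z → shift a w z ∈ᵖ? T) Z) ≡⟨ Σℕ-* As p _ ⟨
    Σℕ As (λ a → p * count (λ z → shift a w z ∈ᵖ? T) Z) ≤⟨ Σℕ-≤ As (λ a a∈ → ≤-trans (≤-reflexive (*-comm p _))
                                            (h a (proj₂ (∈-filter⁻ ∉X? {xs = points n} a∈)))) ⟩
    length As * C ≤⟨ *-monoˡ-≤ C (≤-trans (length-filter ∉X? (points n)) (≤-reflexive (length-points n))) ⟩
    q ^ n * C ∎
    where
    open ≤-Reasoning
    ∉X? : Decidable (_∉ X)
    ∉X? a = ¬? (a ∈ᵖ? X)
    As = filter ∉X? (points n)
    many : ∀ z → length T ∸ length X ≤ count (λ a → shift a w z ∈ᵖ? T) As
    many z = m≤n+o⇒m∸n≤o (length T) (length X) (begin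
      length T ≡⟨ length-map _ T ⟨
      length (map (λ t → shift t (⊝ w) z) T) ≤⟨ unique-⊆⇒length≤ (Uniq.map⁺ (λ {x} {y} e → trans (sym (shift-inverse x w z))
                                            (trans (cong (λ v → shift v w z) e) (shift-inverse y w z))) uT) sub ⟩
      length (X ++ filter (λ a → shift a w z ∈ᵖ? T) As) ≡⟨ length-++ X ⟩
      length X + count (λ a → shift a w z ∈ᵖ? T) As ∎)
      where
      sub : ∀ a → a ∈ map (λ t → shift t (⊝ w) z) T → a ∈ X ++ filter (λ a → shift a w z ∈ᵖ? T) As
      sub a a∈ with ∈-map⁻ _ a∈ | a ∈ᵖ? X
      ... | _ | yes a∈X = ∈-++⁺ˡ a∈X
      ... | t , t∈ , refl | no a∉X = ∈-++⁺ʳ X (∈-filter⁺ (λ a → shift a w z ∈ᵖ? T) (∈-filter⁺ ∉X? (∈-points a) a∉X)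
                                       (subst (_∈ T) (sym (shift-inverse t w z)) t∈))

  -- Properties of most points

  Property : Set₁
  Property = ∀ n → List (Point n) → Point n → Set

  -- The constants depend neither on n nor on `S`. As `G` need not be decidable, there is no list of
  -- all exceptions; instead every list `B` of exceptions is bounded.
  record Mostly (G : Property) : Set where
    constructor mostly
    field
      rate  : ℕ
      factor : ℕ
      bound : ∀ n (S B : List (Point n)) → Unique S → Unique B → (∀ b → b ∈ B → b ∈ S) → (∀ b → b ∈ B → ¬ G n S b) →
              Small rate factor n (length B)

  open Mostly

  mostly-const : ∀ {G : Property} → (∀ n S t → t ∈ S → G n S t) → Mostly G
  mostly-const {G} h = mostly 0 0 λ
    { n S [] _ _ _ _          → small z≤n
    ; n S (b ∷ B) _ _ B⊆S bad → ⊥-elim (bad b (here refl) (h n S b (B⊆S b (here refl)))) }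

  mostly-map : ∀ {G H : Property} → (∀ n S t → G n S t → H n S t) → Mostly G → Mostly H
  mostly-map h g = mostly (rate g) (factor g) λ n S B uS uB B⊆S bad → bound g n S B uS uB B⊆S (λ b b∈ Gb → bad b b∈ (h n S b Gb))

  -- Points failing `G` are discarded before `H` is applied. Every point that `H` then supplies has
  -- property `G` with respect to the original `S`, which is what allows it to be replaced by
  -- further points of `S`.
  mostly-restrict : ∀ {G H L : Property} → Mostly G → Mostly H →
    (∀ n S (G? : Decidable (G n S)) t → t ∈ filter G? S → H n (filter G? S) t → L n S t) → Mostly L
  mostly-restrict {G} {H} {L} g h step = mostly (rate g + rate h) (factor g + factor h) λ n S B uS uB B⊆S bad →
    small-stable (¬¬-dec (points n) ∈-points (G n S) >>= λ G? → pure (small-split G? B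
      (bound g n S (filter (¬? ∘ G?) B) uS (Uniq.filter⁺ (¬? ∘ G?) uB) (λ b b∈ → B⊆S b (proj₁ (∈-filter⁻ (¬? ∘ G?) {xs = B} b∈)))
        (λ b b∈ → proj₂ (∈-filter⁻ (¬? ∘ G?) {xs = B} b∈)))
      (let B₁⊆S₁ : ∀ b → b ∈ filter G? B → b ∈ filter G? S
           B₁⊆S₁ b b∈ = let b∈B , Gb = ∈-filter⁻ G? {xs = B} b∈ in ∈-filter⁺ G? (B⊆S b b∈B) Gb
       in bound h n (filter G? S) (filter G? B) (Uniq.filter⁺ G? uS) (Uniq.filter⁺ G? uB) B₁⊆S₁
            (λ b b∈ Hb → bad b (proj₁ (∈-filter⁻ G? {xs = B} b∈)) (step n S G? b (B₁⊆S₁ b b∈) Hb)))))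

  mostly-× : ∀ {G H : Property} → Mostly G → Mostly H → Mostly (λ n S t → G n S t × H n S t)
  mostly-× {G} {H} g h = mostly (rate g + rate h) (factor g + factor h) λ n S B uS uB B⊆S bad →
    small-stable (¬¬-dec (points n) ∈-points (G n S) >>= λ G? → pure (small-split G? B
      (bound g n S (filter (¬? ∘ G?) B) uS (Uniq.filter⁺ (¬? ∘ G?) uB) (λ b b∈ → B⊆S b (proj₁ (∈-filter⁻ (¬? ∘ G?) {xs = B} b∈)))
        (λ b b∈ → proj₂ (∈-filter⁻ (¬? ∘ G?) {xs = B} b∈)))
      (bound h n S (filter G? B) uS (Uniq.filter⁺ G? uB) (λ b b∈ → B⊆S b (proj₁ (∈-filter⁻ G? {xs = B} b∈)))
        (λ b b∈ Hb → let b∈B , Gb = ∈-filter⁻ G? {xs = B} b∈ in bad b b∈B (Gb , Hb)))))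

  mostly-∀ : ∀ r {G : Fin r → Property} → (∀ c → Mostly (G c)) → Mostly (λ n S t → ∀ c → G c n S t)
  mostly-∀ zero    g = mostly-const (λ _ _ _ _ ())
  mostly-∀ (suc r) {G} g = mostly (rate gs) (factor gs) λ n S B uS uB B⊆S bad →
    bound gs n S B uS uB B⊆S (λ b b∈ (p , ps) → bad b b∈ λ { zero → p ; (suc c) → ps c })
    where gs = mostly-× (g zero) (mostly-∀ r (g ∘ suc))

  -- Existence is asserted classically only: the solution itself is found by exhaustive search at the end.
  Generic : ∀ {n} → ℕ → (List (Point n) → Set) → Set
  Generic {n} K P = ∀ (U : List (Point n)) → length U ≤ K → ¬ ¬ P U

  mostly-outside : ∀ K → Mostly (λ n S t → Generic K λ U → ∃[ u ] (u ∈ S × ¬ Span U (lookup u)))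
  mostly-outside K = mostly 0 (q ^ K) λ
    { n S [] _ _ _ _            → small z≤n
    ; n S (b ∷ B) _ uB B⊆S bad → small-const (≮⇒≥ λ lt → bad b (here refl) λ U le k →
        let u , u∈ , u∉ = outside-span U uB (≤-<-trans (^-monoʳ-≤ q le) lt) in k (u , B⊆S u u∈ , u∉)) }

  private
    ¬generic : ∀ {n K} {P : List (Point n) → Set} → ¬ Generic K P → ¬ ¬ (Σ (List (Point n)) λ U → length U ≤ K × ¬ P U)
    ¬generic h k = h (λ U le ¬P → k (U , le , ¬P))

  private
    -- Finite choice under double negation, giving each failing point its own exceptional space.
    -- Outside `B` the value is the empty list, because `spread` asks for the length bound at every
    -- point.
    choose : ∀ {n K} (B : List (Point n)) {P : Point n → List (Point n) → Set} →
      (∀ b → b ∈ B → ¬ ¬ (Σ (List (Point n)) λ U → length U ≤ K × P b U)) →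
      ¬ ¬ (Σ (Point n → List (Point n)) λ U → (∀ b → length (U b) ≤ K) × (∀ b → b ∈ B → P b (U b)))
    choose {n} {K} B {P} h = ¬¬-∀∈ B h >>= λ f → pure (U f , U-small f , U-P f)
      where
      Choice = ∀ b → b ∈ B → Σ (List (Point n)) λ U → length U ≤ K × P b U
      U : Choice → Point n → List (Point n)
      U f b with b ∈ᵖ? B
      ... | yes b∈ = proj₁ (f b b∈)
      ... | no _   = []
      U-small : ∀ f b → length (U f b) ≤ K
      U-small f b with b ∈ᵖ? B
      ... | yes b∈ = proj₁ (proj₂ (f b b∈))
      ... | no _   = z≤n
      U-P : ∀ f b → b ∈ B → P b (U f b)
      U-P f b b∈ with b ∈ᵖ? B
      ... | yes b∈′ = proj₂ (proj₂ (f b b∈′))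
      ... | no b∉   = ⊥-elim (b∉ b∈)

  -- `independent-set` for the digraph that joins b to all points of the span of `U b`, of which
  -- there are at most q^K. Only a constant factor of the size of `B` is lost.
  spread : ∀ {n} K (U : Point n → List (Point n)) → (∀ b → length (U b) ≤ K) → (B : List (Point n)) → Unique B →
    Σ (List (Point n)) λ B′ → Unique B′ × (∀ b → b ∈ B′ → b ∈ B) ×
      (∀ b x → b ∈ B′ → x ∈ B′ → ¬ ¬ Span (U b) (lookup x) → x ≡ b) × length B ≤ (2 * q ^ K + 1) * length B′
  spread K U U-small B uB with independent-set _≟ᵖ_ (spanned ∘ U) (q ^ K) (λ b → spanned-≤ (U b) (U-small b)) B uB
  ... | B′ , uB′ , sub , ind , le = B′ , uB′ , sub ,
        (λ b x b∈ x∈ h → ind b x b∈ x∈ (decidable-stable (x ∈ᵖ? spanned (U b)) (¬¬-map (∈-spanned (U b)) h))) , le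

  PairOutside : ∀ {n} → 𝔽 → 𝔽 → List (Point n) → Point n → List (Point n) → Set
  PairOutside {n} α β S t U = Σ (Point n) λ x → Σ (Point n) λ y → x ∈ S × y ∈ S ×
    (∀ i → α ⊗ lookup x i ⊕ β ⊗ lookup y i ≡ (α ⊕ β) ⊗ lookup t i) × ¬ Span U (lookup x)

  Pair : 𝔽 → 𝔽 → ℕ → Property
  Pair α β K n S t = Generic K (PairOutside α β S t)

  -- If all of `B` fails, the space `U t` contains x for every solution of α x + β y = (α + β) t in
  -- `S`. Within the spread-out part of `B` this forces x = t, and then y = t because β ≠ 0, so
  -- `trinomial-bound` applies.
  mostly-pair : ∀ α β → β ≢ 0# → ∀ K → Mostly (Pair α β K)
  -- The rate 18 stands for the ratio 19 / 20 of `length-lows`, the factor 2 comes from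
  -- `trinomial-bound`, and k is the loss in `spread`.
  mostly-pair α β β≢0 K = mostly 18 (k * 2) λ n S B uS uB B⊆S bad → small-stable 
    (choose B (λ b b∈ → ¬generic (bad b b∈)) >>= λ (U , U-small , none) → pure (main n S B uB B⊆S U U-small none))
    where
    k = 2 * q ^ K + 1
    main : ∀ n (S B : List (Point n)) → Unique B → (∀ b → b ∈ B → b ∈ S) →
      (U : Point n → List (Point n)) → (∀ b → length (U b) ≤ K) → (∀ b → b ∈ B → ¬ PairOutside α β S b (U b)) →
      Small 18 (k * 2) n (length B)
    main n S B uB B⊆S U U-small none with spread K U U-small B uB
    ... | B′ , uB′ , sub , ind , le = small-≤ le (small-scale k spread-small)
      where
      only : ∀ t x y → t ∈ B′ → x ∈ B′ → y ∈ B′ →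
        (∀ i → ⊝ (α ⊕ β) ⊗ lookup t i ⊕ α ⊗ lookup x i ⊕ β ⊗ lookup y i ≡ 0#) → x ≡ t × y ≡ t
      only t x y t∈ x∈ y∈ e = x≡t , vec-ext (λ i → ⊗-cancelˡ β≢0 (begin
        β ⊗ lookup y i
          ≡⟨ solve 4 (λ a b t y → b :* y := :- (a :+ b) :* t :+ a :* t :+ b :* y :+ b :* t) refl α β (lookup t i) (lookup y i) ⟩
        ⊝ (α ⊕ β) ⊗ lookup t i ⊕ α ⊗ lookup t i ⊕ β ⊗ lookup y i ⊕ β ⊗ lookup t i
          ≡⟨ cong (λ z → ⊝ (α ⊕ β) ⊗ lookup t i ⊕ α ⊗ lookup z i ⊕ β ⊗ lookup y i ⊕ β ⊗ lookup t i) x≡t ⟨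
        ⊝ (α ⊕ β) ⊗ lookup t i ⊕ α ⊗ lookup x i ⊕ β ⊗ lookup y i ⊕ β ⊗ lookup t i
          ≡⟨ cong (_⊕ β ⊗ lookup t i) (e i) ⟩
        0# ⊕ β ⊗ lookup t i
          ≡⟨ ⊕-identityˡ _ ⟩
        β ⊗ lookup t i ∎))
        where
        open ≡-Reasoning
        x≡t : x ≡ t
        x≡t = ind t x t∈ x∈ (λ ¬s → none t (sub t t∈)
          (x , y , B⊆S x (sub x x∈) , B⊆S y (sub y y∈) ,
            (λ i → x⊝y≡0⇒x≡y (trans (solve 5 (λ a b t x y → a :* x :+ b :* y :+ :- ((a :+ b) :* t) := :- (a :+ b) :* t :+ a :* x :+ b :* y) refl
                     α β (lookup t i) (lookup x i) (lookup y i)) (e i))) , ¬s))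

      spread-small : Small 18 2 n (length B′)
      spread-small = small (begin
          length B′ * 20 ^ n ≤⟨ *-monoˡ-≤ (20 ^ n) (trinomial-bound (⊝ (α ⊕ β)) α β
            (solve 2 (λ a b → :- (a :+ b) :+ a :+ b := :0) refl α β) B′ uB′ only) ⟩
          2 * length (lows n) * 20 ^ n ≡⟨ *-assoc 2 (length (lows n)) _ ⟩
          2 * (length (lows n) * 20 ^ n) ≤⟨ *-monoʳ-≤ 2 (length-lows n) ⟩
          2 * (19 * q) ^ n ≡⟨ cong (λ z → 2 * z ^ n) (*-comm 19 q) ⟩
          2 * (q * 19) ^ n ∎)
        where open ≤-Reasoning

  TripleOutside : ∀ {n} → List (Point n) → Point n → List (Point n) → Set
  TripleOutside {n} S t U = Σ (Point n) λ x → Σ (Point n) λ y → Σ (Point n) λ z → x ∈ S × y ∈ S × z ∈ S ×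
    (∀ i → lookup x i ⊕ lookup y i ⊕ lookup z i ≡ lookup t i) × ¬ Span U (lookup x) × ¬ Span (x ∷ U) (lookup y)

  Triple : ℕ → Property
  Triple K n S t = Generic K (TripleOutside S t)

  -- In characteristic 2, two translates of the same pair {0, a} in S give x + y = t + z.
  mostly-triple : 1# ⊕ 1# ≡ 0# → ∀ K → Mostly (Triple K)
  mostly-triple char2 K = mostly 4 (k * (C + 1)) λ n S B uS uB B⊆S bad → small-stable 
    (choose B (λ b b∈ → ¬generic (bad b b∈)) >>= λ (U , U-small , none) → pure (main n S B uB B⊆S U U-small none))
    where
    k = 2 * q ^ (1 + K) + 1
    -- More than this many translates contain one outside the span of t, t + a and the at most K
    -- generators in `U t`.
    C = q ^ (2 + K)
    double : ∀ x → x ⊕ x ≡ 0#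
    double x = trans (solve 1 (λ x → x :+ x := (:1 :+ :1) :* x) refl x) (trans (cong (_⊗ x) char2) (⊗-zeroˡ x))
    main : ∀ n (S B : List (Point n)) → Unique B → (∀ b → b ∈ B → b ∈ S) →
      (U : Point n → List (Point n)) → (∀ b → length (U b) ≤ K) → (∀ b → b ∈ B → ¬ TripleOutside S b (U b)) →
      Small 4 (k * (C + 1)) n (length B)
    -- Each point is added to its own exceptional space: then t + a, being another point of `B′`,
    -- avoids the span of t and `U t`.
    main n S B uB B⊆S U U-small none with spread (1 + K) (λ b → b ∷ U b) (s≤s ∘ U-small) B uB
    ... | B′ , uB′ , sub , ind , le = small-≤ le (small-scale k
        (small-≤ (m≤n+m∸n′ (length B′)) (small-+ 
          (small-root 1 (m^n>0 q (2 + K)) square) (small-const {0} ≤-refl))))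
      where
      m≤n+m∸n′ : ∀ m → m ≤ m ∸ 1 + 1
      m≤n+m∸n′ zero    = z≤n
      m≤n+m∸n′ (suc m) = ≤-reflexive (+-comm 1 m)
      o = Vec.replicate n 0#
      few : ∀ a → a ∉ o ∷ [] → count (λ z → shift a 1# z ∈ᵖ? B′) B′ * 1 ≤ C
      few a a≢0 = subst (_≤ C) (sym (*-identityʳ _)) (≮⇒≥ contra)
        where
        Z = filter (λ z → shift a 1# z ∈ᵖ? B′) B′
        Z⁻ : ∀ {z} → z ∈ Z → z ∈ B′ × shift a 1# z ∈ B′
        Z⁻ = ∈-filter⁻ (λ z → shift a 1# z ∈ᵖ? B′) {xs = B′}
        at : ∀ z i → lookup (shift a 1# z) i ≡ lookup a i ⊕ 1# ⊗ lookup z i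
        at = lookup-shift a 1#
        far : C < length Z → (gs : List (Point n)) → length gs ≤ 2 + K → ∃[ z ] (z ∈ Z × ¬ Span gs (lookup z))
        far lt gs le = outside-span gs (Uniq.filter⁺ (λ z → shift a 1# z ∈ᵖ? B′) uB′) (≤-<-trans (^-monoʳ-≤ q {length gs} {2 + K} le) lt)
        impossible : ∀ t → t ∈ Z → ∃[ x ] (x ∈ Z × ¬ Span (shift a 1# t ∷ t ∷ U t) (lookup x)) → ⊥
        impossible t t∈ (x , x∈ , x∉) =
          none t (sub t (proj₁ (Z⁻ t∈))) (x , shift a 1# x , t′ , inS (proj₁ (Z⁻ x∈)) , inS (proj₂ (Z⁻ x∈)) , inS (proj₂ (Z⁻ t∈)) , total , x∉U , y∉)
          where
          t′ = shift a 1# t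
          inS : ∀ {z} → z ∈ B′ → z ∈ S
          inS {z} z∈ = B⊆S z (sub z z∈)
          total : ∀ i → lookup x i ⊕ lookup (shift a 1# x) i ⊕ lookup t′ i ≡ lookup t i
          total i = trans (cong₂ (λ b c → lookup x i ⊕ b ⊕ c) (at x i) (at t i))
            (trans (solve 3 (λ a x t → x :+ (a :+ :1 :* x) :+ (a :+ :1 :* t) := (x :+ x) :+ (a :+ a) :+ t) refl (lookup a i) (lookup x i) (lookup t i))
              (trans (cong₂ (λ b c → b ⊕ c ⊕ lookup t i) (double _) (double _)) (solve 1 (λ t → :0 :+ :0 :+ t := t) refl _)))
          x∉U : ¬ Span (U t) (lookup x)
          x∉U s = x∉ (span-∷ t′ (t ∷ U t) (span-∷ t (U t) s))
          t′∉ : ¬ Span (t ∷ U t) (lookup t′)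
          t′∉ s = a≢0 (here (vec-ext (λ i → trans
            (trans (solve 2 (λ a t → a := a :+ :1 :* t :+ :- t) refl (lookup a i) (lookup t i))
              (trans (cong (_⊕ ⊝ lookup t i) (trans (sym (at t i)) (cong (λ v → lookup v i) t′≡t))) (⊝-inverseʳ _)))
            (sym (Vecₚ.lookup-replicate i 0#)))))
            where
            t′≡t : t′ ≡ t
            t′≡t = ind t t′ (proj₁ (Z⁻ t∈)) (proj₂ (Z⁻ t∈)) (λ ¬s → ¬s s)
          y∉ : ¬ Span (x ∷ U t) (lookup (shift a 1# x))
          -- Modulo `U t` the assumed relation is a + (1 + c) x = 0. If 1 + c = 0, then a lies in
          -- the span of `U t`, hence t + a in that of t and `U t`. Otherwise x lies in the span of
          -- t + a, t and `U t`. Both are excluded.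
          y∉ (c , s) with (1# ⊕ c) ≟ᶠ 0#
          ... | yes e = t′∉ (⊝ 1# , span-∷′)
            where
            span-∷′ : Span (U t) (λ i → lookup t′ i ⊕ ⊝ 1# ⊗ lookup t i)
            span-∷′ = span-resp (U t) (λ i → trans (cong (_⊕ c ⊗ lookup x i) (at x i))
              (trans (solve 3 (λ a c x → a :+ :1 :* x :+ c :* x := a :+ (:1 :+ c) :* x) refl (lookup a i) c (lookup x i))
                (trans (cong (λ z → lookup a i ⊕ z ⊗ lookup x i) e)
                  (trans (solve 3 (λ a x t → a :+ :0 :* x := a :+ :1 :* t :+ :- :1 :* t) refl (lookup a i) (lookup x i) (lookup t i))
                    (cong (_⊕ ⊝ 1# ⊗ lookup t i) (sym (at t i))))))) s
          ... | no ne = x∉ (span-cancel (t′ ∷ t ∷ U t) (1# ⊕ c) ne (span-linear (t′ ∷ t ∷ U t) 1# 1#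
              (span-∷ t′ (t ∷ U t) (span-∷ t (U t) s))
              (span-linear (t′ ∷ t ∷ U t) (⊝ 1#) 1# (span-∈ (t′ ∷ t ∷ U t) (here refl)) (span-∈ (t′ ∷ t ∷ U t) (there (here refl))) (λ _ → refl))
              (λ i → trans (cong₂ (λ b b′ → 1# ⊗ (b ⊕ c ⊗ lookup x i) ⊕ 1# ⊗ (⊝ 1# ⊗ b′ ⊕ 1# ⊗ lookup t i)) (at x i) (at t i))
                (solve 4 (λ a c x t → :1 :* (a :+ :1 :* x :+ c :* x) :+ :1 :* (:- :1 :* (a :+ :1 :* t) :+ :1 :* t) := (:1 :+ c) :* x) refl
                  (lookup a i) c (lookup x i) (lookup t i)))))
        contra : C < length Z → ⊥
        contra lt = let t , t∈ , _ = far lt [] z≤n in impossible t t∈ (far lt (shift a 1# t ∷ t ∷ U t) (s≤s (s≤s (U-small t))))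
      square : (length B′ ∸ 1) ^ 2 * q ^ n ≤ (q ^ n) ^ 2 * C
      square = begin
        (length B′ ∸ 1) ^ 2 * q ^ n ≤⟨ *-monoˡ-≤ (q ^ n) (*-monoˡ-≤ ((length B′ ∸ 1) * 1) (m∸n≤m (length B′) 1)) ⟩
        length B′ * ((length B′ ∸ 1) * 1) * q ^ n ≡⟨ cong (_* q ^ n) (sym (*-assoc (length B′) _ 1)) ⟩
        length B′ * (length B′ ∸ 1) * 1 * q ^ n ≤⟨ *-monoˡ-≤ (q ^ n) (average 1# B′ B′ (o ∷ []) uB′ 1 C few) ⟩
        q ^ n * C * q ^ n ≡⟨ lem (q ^ n) C ⟩
        (q ^ n) ^ 2 * C ∎
        where
        open ≤-Reasoning
        lem : ∀ x c → x * c * x ≡ x * (x * 1) * c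
        lem = solve-∀

  -- Generic solutions of a single equation

  dot : ∀ {r n} → Vec 𝔽 r → Vec (Point n) r → Fin n → 𝔽
  dot []       []       t = 0#
  dot (b ∷ bs) (x ∷ xs) t = b ⊗ lookup x t ⊕ dot bs xs t

  total : ∀ {r} → Vec 𝔽 r → 𝔽
  total []       = 0#
  total (l ∷ ls) = l ⊕ total ls

  infixr 7 _∙_
  _∙_ : ∀ {r} → 𝔽 → Vec 𝔽 r → Vec 𝔽 r
  μ ∙ ls = Vec.map (μ ⊗_) ls

  infix 4 _∝_
  _∝_ : ∀ {r} → Vec 𝔽 r → Vec 𝔽 r → Set
  bs ∝ ls = ∃[ μ ] (bs ≡ μ ∙ ls)

  dot-∙ : ∀ {r n} μ (ls : Vec 𝔽 r) (xs : Vec (Point n) r) t → dot (μ ∙ ls) xs t ≡ μ ⊗ dot ls xs t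
  dot-∙ μ []       []       t = sym (⊗-zeroʳ μ)
  dot-∙ μ (l ∷ ls) (x ∷ xs) t = trans (cong (μ ⊗ l ⊗ lookup x t ⊕_) (dot-∙ μ ls xs t))
    (solve 4 (λ m l x d → m :* l :* x :+ m :* d := m :* (l :* x :+ d)) refl μ l (lookup x t) (dot ls xs t))

  span-dot : ∀ {r n} (gs : List (Point n)) (bs : Vec 𝔽 r) (xs : Vec (Point n) r) → (∀ i → lookup xs i ∈ gs) → Span gs (dot bs xs)
  span-dot gs []       []       h = span-0 gs (λ _ → refl)
  span-dot gs (b ∷ bs) (x ∷ xs) h = span-linear gs b 1# (span-∈ gs (h zero)) (span-dot gs bs xs (h ∘ suc)) (λ t → cong (b ⊗ lookup x t ⊕_) (⊗-identityˡ _))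

  annihilates : ∀ {n} (U : List (Point n)) (x : Point n) s → ¬ Span U (lookup x) → Span U (λ i → s ⊗ lookup x i) → s ≡ 0#
  annihilates U x s x∉ h = decidable-stable (s ≟ᶠ 0#) (λ s≢0 → x∉ (span-cancel U s s≢0 h))

  -- Independence is required modulo `U` because `U` will hold the points placed for other classes,
  -- so that relations across the classes are excluded too.
  record Solution {r n} (ls : Vec 𝔽 r) (S : List (Point n)) (t : Point n) (U : List (Point n)) : Set where
    constructor solution
    field
      xs          : Vec (Point n) r
      xs∈S        : ∀ i → lookup xs i ∈ S
      satisfies   : ∀ i → dot ls xs i ≡ total ls ⊗ lookup t i
      independent : ∀ bs → Span U (dot bs xs) → bs ∝ ls

  Good : ∀ {r} → Vec 𝔽 r → ℕ → Property
  Good ls K n S t = Generic K (Solution ls S t)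

  private
    ∀-∷ : ∀ {n r} {S : List (Point n)} {x : Point n} {xs : Vec (Point n) r} → x ∈ S → (∀ i → lookup xs i ∈ S) → ∀ i → lookup (x ∷ xs) i ∈ S
    ∀-∷ h k zero    = h
    ∀-∷ h k (suc i) = k i

    ∷-≡ : ∀ {r} {a b : 𝔽} {as bs : Vec 𝔽 r} → a ∷ as ≡ b ∷ bs → a ≡ b × as ≡ bs
    ∷-≡ refl = refl , refl

    solution-swap₁ : ∀ {r n a b} {ls : Vec 𝔽 r} {S : List (Point n)} {t U} → Solution (a ∷ b ∷ ls) S t U → Solution (b ∷ a ∷ ls) S t U
    solution-swap₁ {a = a} {b} {ls} {t = t} {U} (solution (x ∷ y ∷ xs) xs∈ sat ind) = solution (y ∷ x ∷ xs)
      (λ { zero → xs∈ (suc zero) ; (suc zero) → xs∈ zero ; (suc (suc i)) → xs∈ (suc (suc i)) })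
      (λ i → trans (comm (b ⊗ lookup y i) (a ⊗ lookup x i) (dot ls xs i)) (trans (sat i) (cong (_⊗ lookup t i) (comm a b (total ls)))))
      (λ { (c ∷ d ∷ bs) s → let μ , e = ind (d ∷ c ∷ bs) (span-resp U (λ i → comm (c ⊗ lookup y i) (d ⊗ lookup x i) (dot bs xs i)) s)
                                e₁ , e₂ = ∷-≡ e ; e₃ , e₄ = ∷-≡ e₂
                            in μ , cong₂ _∷_ e₃ (cong₂ _∷_ e₁ e₄) })
      where
      comm : ∀ x y z → x ⊕ (y ⊕ z) ≡ y ⊕ (x ⊕ z)
      comm = solve 3 (λ x y z → x :+ (y :+ z) := y :+ (x :+ z)) refl

    solution-swap₂ : ∀ {r n a b c} {ls : Vec 𝔽 r} {S : List (Point n)} {t U} → Solution (a ∷ b ∷ c ∷ ls) S t U → Solution (a ∷ c ∷ b ∷ ls) S t U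
    solution-swap₂ {a = a} {b} {c} {ls} {t = t} {U} (solution (x ∷ y ∷ z ∷ xs) xs∈ sat ind) = solution (x ∷ z ∷ y ∷ xs)
      (λ { zero → xs∈ zero ; (suc zero) → xs∈ (suc (suc zero)) ; (suc (suc zero)) → xs∈ (suc zero) ; (suc (suc (suc i))) → xs∈ (suc (suc (suc i))) })
      (λ i → trans (comm (a ⊗ lookup x i) (c ⊗ lookup z i) (b ⊗ lookup y i) (dot ls xs i)) (trans (sat i) (cong (_⊗ lookup t i) (comm a b c (total ls)))))
      (λ { (d ∷ e ∷ f ∷ bs) s → let μ , eq = ind (d ∷ f ∷ e ∷ bs) (span-resp U (λ i → comm (d ⊗ lookup x i) (e ⊗ lookup z i) (f ⊗ lookup y i) (dot bs xs i)) s)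
                                    e₁ , e₂ = ∷-≡ eq ; e₃ , e₄ = ∷-≡ e₂ ; e₅ , e₆ = ∷-≡ e₄
                                in μ , cong₂ _∷_ e₁ (cong₂ _∷_ e₅ (cong₂ _∷_ e₃ e₆)) })
      where
      comm : ∀ w x y z → w ⊕ (x ⊕ (y ⊕ z)) ≡ w ⊕ (y ⊕ (x ⊕ z))
      comm = solve 4 (λ w x y z → w :+ (x :+ (y :+ z)) := w :+ (y :+ (x :+ z))) refl

    -- The space that the new points of an extended solution have to avoid.
    hull : ∀ {r n} → Point n → Vec (Point n) r → List (Point n) → List (Point n)
    hull u xs U = u ∷ Vec.toList xs ++ U

    hull-length : ∀ {r n K} (u : Point n) (xs : Vec (Point n) r) U → length U ≤ K → length (hull u xs U) ≤ suc (r + K)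
    hull-length {r} u xs U le = s≤s (≤-trans (≤-reflexive (length-++ (Vec.toList xs))) (+-mono-≤ (≤-reflexive (Vecₚ.length-toList xs)) le))

    hull-dot : ∀ {r n} (u : Point n) (xs : Vec (Point n) r) U bs → Span (hull u xs U) (dot bs (u ∷ xs))
    hull-dot u xs U bs = span-dot (hull u xs U) bs (u ∷ xs) λ { zero → here refl ; (suc i) → there (∈-++⁺ˡ (Vec∈.∈-toList⁺ (Vec∈.∈-lookup i xs))) }

    hull-⊇ : ∀ {r n} (u : Point n) (xs : Vec (Point n) r) U {v} → Span U v → Span (hull u xs U) v
    hull-⊇ u xs U = span-++ʳ (u ∷ Vec.toList xs) U

    -- The point u with coefficient a + b is replaced by x and y. In a relation c x + d y + ... put
    -- s = d / b: eliminating y leaves (c - s a) x plus a combination of u and `xs`. As x avoids the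
    -- hull, c = s a, and what remains is a relation of the shorter solution.
    extend-pair : ∀ {r n a b} {ls : Vec 𝔽 r} {S : List (Point n)} {t U} (x y u : Point n) (xs : Vec (Point n) r) → b ≢ 0# →
      x ∈ S → y ∈ S → (∀ i → lookup xs i ∈ S) →
      (∀ i → a ⊗ lookup x i ⊕ b ⊗ lookup y i ≡ (a ⊕ b) ⊗ lookup u i) → ¬ Span (hull u xs U) (lookup x) →
      (∀ i → dot (a ⊕ b ∷ ls) (u ∷ xs) i ≡ total (a ⊕ b ∷ ls) ⊗ lookup t i) →
      (∀ bs → Span U (dot bs (u ∷ xs)) → bs ∝ (a ⊕ b ∷ ls)) → a ⊕ b ≢ 0# →
      Solution (a ∷ b ∷ ls) S t U
    extend-pair {a = a} {b} {ls} {t = t} {U} x y u xs b≢0 x∈ y∈ xs∈ eq x∉ sat ind ab≢0 = solution (x ∷ y ∷ xs) (∀-∷ x∈ (∀-∷ y∈ xs∈)) sat′ ind′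
      where
      sat′ : ∀ i → dot (a ∷ b ∷ ls) (x ∷ y ∷ xs) i ≡ total (a ∷ b ∷ ls) ⊗ lookup t i
      sat′ i = trans (sym (⊕-assoc _ _ _)) (trans (cong (_⊕ dot ls xs i) (eq i)) (trans (sat i) (cong (_⊗ lookup t i) (⊕-assoc a b (total ls)))))
      ind′ : ∀ bs → Span U (dot bs (x ∷ y ∷ xs)) → bs ∝ (a ∷ b ∷ ls)
      ind′ (c ∷ d ∷ bs) h = finish (ind (s ⊗ (a ⊕ b) ∷ bs) (span-resp U split′ h))
        where
        s = d ⊗ inv b b≢0
        d≡ : d ≡ s ⊗ b
        d≡ = sym (trans (solve 3 (λ d i b → d :* i :* b := d :* (b :* i)) refl d (inv b b≢0) b)
               (trans (cong (d ⊗_) (inv-right b b≢0)) (⊗-identityʳ d)))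
        D = dot (s ⊗ (a ⊕ b) ∷ bs) (u ∷ xs)
        split : ∀ i → dot (c ∷ d ∷ bs) (x ∷ y ∷ xs) i ≡ (c ⊕ ⊝ (s ⊗ a)) ⊗ lookup x i ⊕ D i
        split i = begin
          c ⊗ lookup x i ⊕ (d ⊗ lookup y i ⊕ dot bs xs i)
            ≡⟨ cong (λ z → c ⊗ lookup x i ⊕ (z ⊗ lookup y i ⊕ dot bs xs i)) d≡ ⟩
          c ⊗ lookup x i ⊕ (s ⊗ b ⊗ lookup y i ⊕ dot bs xs i)
            ≡⟨ solve 7 (λ c x s a b y D → c :* x :+ (s :* b :* y :+ D) := (c :+ :- (s :* a)) :* x :+ (s :* (a :* x :+ b :* y) :+ D)) refl
                 c (lookup x i) s a b (lookup y i) (dot bs xs i) ⟩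
          (c ⊕ ⊝ (s ⊗ a)) ⊗ lookup x i ⊕ (s ⊗ (a ⊗ lookup x i ⊕ b ⊗ lookup y i) ⊕ dot bs xs i)
            ≡⟨ cong (λ z → (c ⊕ ⊝ (s ⊗ a)) ⊗ lookup x i ⊕ (z ⊕ dot bs xs i)) (trans (cong (s ⊗_) (eq i)) (sym (⊗-assoc s (a ⊕ b) (lookup u i)))) ⟩
          (c ⊕ ⊝ (s ⊗ a)) ⊗ lookup x i ⊕ (s ⊗ (a ⊕ b) ⊗ lookup u i ⊕ dot bs xs i) ∎
          where open ≡-Reasoning
        c-sa≡0 : c ⊕ ⊝ (s ⊗ a) ≡ 0#
        c-sa≡0 = annihilates (hull u xs U) x _ x∉ (span-linear (hull u xs U) 1# (⊝ 1#) (hull-⊇ u xs U h) (hull-dot u xs U (s ⊗ (a ⊕ b) ∷ bs))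
          (λ i → trans (cong (λ z → 1# ⊗ z ⊕ ⊝ 1# ⊗ D i) (split i))
            (solve 2 (λ x y → :1 :* (x :+ y) :+ :- :1 :* y := x) refl _ (D i))))
        split′ : ∀ i → dot (c ∷ d ∷ bs) (x ∷ y ∷ xs) i ≡ D i
        split′ i = trans (split i) (trans (cong (λ z → z ⊗ lookup x i ⊕ D i) c-sa≡0)
          (trans (cong (_⊕ D i) (⊗-zeroˡ _)) (⊕-identityˡ _)))
        finish : (s ⊗ (a ⊕ b) ∷ bs) ∝ (a ⊕ b ∷ ls) → (c ∷ d ∷ bs) ∝ (a ∷ b ∷ ls)
        finish (μ , e) = μ , cong₂ _∷_ (trans (x⊝y≡0⇒x≡y c-sa≡0) (cong (_⊗ a) s≡μ)) (cong₂ _∷_ (trans d≡ (cong (_⊗ b) s≡μ)) (proj₂ (∷-≡ e)))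
          where
          s≡μ : s ≡ μ
          s≡μ = ⊗-cancelˡ ab≢0 (trans (⊗-comm _ s) (trans (proj₁ (∷-≡ e)) (⊗-comm μ _)))

    -- In characteristic 2, 3a = a, so splitting one coefficient into three equal ones keeps the
    -- total. In a relation b x + c y + d z + ..., eliminating z leaves x and y with coefficients b
    -- - d and c - d. The second vanishes because y avoids the hull together with x, and then the
    -- first because x avoids the hull.
    extend-triple : ∀ {r n a} {ls : Vec 𝔽 r} {S : List (Point n)} {t U} (x y z u : Point n) (xs : Vec (Point n) r) → 1# ⊕ 1# ≡ 0# →
      x ∈ S → y ∈ S → z ∈ S → (∀ i → lookup xs i ∈ S) →
      (∀ i → lookup x i ⊕ lookup y i ⊕ lookup z i ≡ lookup u i) → ¬ Span (hull u xs U) (lookup x) → ¬ Span (x ∷ hull u xs U) (lookup y) →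
      (∀ i → dot (a ∷ ls) (u ∷ xs) i ≡ total (a ∷ ls) ⊗ lookup t i) →
      (∀ bs → Span U (dot bs (u ∷ xs)) → bs ∝ (a ∷ ls)) →
      Solution (a ∷ a ∷ a ∷ ls) S t U
    extend-triple {a = a} {ls} {t = t} {U} x y z u xs char2 x∈ y∈ z∈ xs∈ eq x∉ y∉ sat ind =
      solution (x ∷ y ∷ z ∷ xs) (∀-∷ x∈ (∀-∷ y∈ (∀-∷ z∈ xs∈))) sat′ ind′
      where
      H = hull u xs U
      three : ∀ b → a ⊕ (a ⊕ (a ⊕ b)) ≡ a ⊕ b
      three b = trans (solve 2 (λ a b → a :+ (a :+ (a :+ b)) := (:1 :+ :1) :* a :+ (a :+ b)) refl a b)
        (trans (cong (λ o → o ⊗ a ⊕ (a ⊕ b)) char2) (solve 2 (λ a b → :0 :* a :+ (a :+ b) := a :+ b) refl a b))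
      sat′ : ∀ i → dot (a ∷ a ∷ a ∷ ls) (x ∷ y ∷ z ∷ xs) i ≡ total (a ∷ a ∷ a ∷ ls) ⊗ lookup t i
      sat′ i = trans (solve 5 (λ a x y z D → a :* x :+ (a :* y :+ (a :* z :+ D)) := a :* (x :+ y :+ z) :+ D) refl a (lookup x i) (lookup y i) (lookup z i) (dot ls xs i))
        (trans (cong (λ v → a ⊗ v ⊕ dot ls xs i) (eq i)) (trans (sat i) (cong (_⊗ lookup t i) (sym (three (total ls))))))
      ind′ : ∀ bs → Span U (dot bs (x ∷ y ∷ z ∷ xs)) → bs ∝ (a ∷ a ∷ a ∷ ls)
      ind′ (b ∷ c ∷ d ∷ bs) h = finish (ind (d ∷ bs) (span-resp U split′ h))
        where
        D = dot (d ∷ bs) (u ∷ xs)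
        b-d = b ⊕ ⊝ d
        c-d = c ⊕ ⊝ d
        split : ∀ i → dot (b ∷ c ∷ d ∷ bs) (x ∷ y ∷ z ∷ xs) i ≡ b-d ⊗ lookup x i ⊕ c-d ⊗ lookup y i ⊕ D i
        split i = trans (solve 7 (λ b c d x y z E → b :* x :+ (c :* y :+ (d :* z :+ E)) :=
                            (b :+ :- d) :* x :+ (c :+ :- d) :* y :+ (d :* (x :+ y :+ z) :+ E)) refl b c d (lookup x i) (lookup y i) (lookup z i) (dot bs xs i))
                    (cong (λ v → b-d ⊗ lookup x i ⊕ c-d ⊗ lookup y i ⊕ (d ⊗ v ⊕ dot bs xs i)) (eq i))
        D∈ : Span H D
        D∈ = hull-dot u xs U (d ∷ bs)
        xy∈ : Span H (λ i → b-d ⊗ lookup x i ⊕ c-d ⊗ lookup y i)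
        xy∈ = span-linear H 1# (⊝ 1#) (hull-⊇ u xs U h) D∈ (λ i → trans (cong (λ v → 1# ⊗ v ⊕ ⊝ 1# ⊗ D i) (split i))
                (solve 2 (λ x y → :1 :* (x :+ y) :+ :- :1 :* y := x) refl _ (D i)))
        c-d≡0 : c-d ≡ 0#
        c-d≡0 = annihilates (x ∷ H) y c-d y∉ (b-d , span-resp H (λ i → ⊕-comm _ _) xy∈)
        b-d≡0 : b-d ≡ 0#
        b-d≡0 = annihilates H x b-d x∉ (span-resp H (λ i → trans (cong (λ v → b-d ⊗ lookup x i ⊕ v ⊗ lookup y i) c-d≡0)
                  (solve 2 (λ v y → v :+ :0 :* y := v) refl _ (lookup y i))) xy∈)
        split′ : ∀ i → dot (b ∷ c ∷ d ∷ bs) (x ∷ y ∷ z ∷ xs) i ≡ D i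
        split′ i = trans (split i) (trans (cong₂ (λ v w → v ⊗ lookup x i ⊕ w ⊗ lookup y i ⊕ D i) b-d≡0 c-d≡0)
                     (solve 3 (λ x y D → :0 :* x :+ :0 :* y :+ D := D) refl (lookup x i) (lookup y i) (D i)))
        finish : (d ∷ bs) ∝ (a ∷ ls) → (b ∷ c ∷ d ∷ bs) ∝ (a ∷ a ∷ a ∷ ls)
        finish (μ , e) = μ , cong₂ _∷_ (trans (x⊝y≡0⇒x≡y b-d≡0) (proj₁ (∷-≡ e))) (cong₂ _∷_ (trans (x⊝y≡0⇒x≡y c-d≡0) (proj₁ (∷-≡ e))) e)

    -- With total zero the right-hand side is 0. Then u may be any point of `S` outside the span of
    -- `U`, and the rest of the equation, with right-hand side -a u, is just the equation for `ls`
    -- at u.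
    extend-zero : ∀ {r n a} {ls : Vec 𝔽 r} {S : List (Point n)} {t U} (u : Point n) → u ∈ S → ¬ Span U (lookup u) →
      total (a ∷ ls) ≡ 0# → Solution ls S u (u ∷ U) → Solution (a ∷ ls) S t U
    extend-zero {a = a} {ls} {t = t} {U} u u∈ u∉ zs (solution xs xs∈ sat ind) = solution (u ∷ xs) (∀-∷ u∈ xs∈) sat′ ind′
      where
      sat′ : ∀ i → dot (a ∷ ls) (u ∷ xs) i ≡ total (a ∷ ls) ⊗ lookup t i
      sat′ i = trans (cong (a ⊗ lookup u i ⊕_) (sat i)) (trans (solve 3 (λ a u s → a :* u :+ s :* u := (a :+ s) :* u) refl a (lookup u i) (total ls))
        (trans (cong (_⊗ lookup u i) zs) (trans (⊗-zeroˡ _) (sym (trans (cong (_⊗ lookup t i) zs) (⊗-zeroˡ _))))))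
      ind′ : ∀ bs → Span U (dot bs (u ∷ xs)) → bs ∝ (a ∷ ls)
      ind′ (b ∷ bs) h with ind bs (b , span-resp U (λ i → ⊕-comm _ _) h)
      -- Since `dot ls xs` equals -a u, the relation becomes (b - μ a) u modulo `U`, whence b = μ a.
      ... | μ , refl = μ , cong (_∷ μ ∙ ls) (x⊝y≡0⇒x≡y (annihilates U u (b ⊕ ⊝ (μ ⊗ a)) u∉ (span-resp U (λ i →
            trans (cong (b ⊗ lookup u i ⊕_) (trans (dot-∙ μ ls xs i) (cong (μ ⊗_) (sat i))))
              (trans (solve 5 (λ b u m s a → b :* u :+ m :* (s :* u) := (b :+ :- (m :* a)) :* u :+ m :* ((a :+ s) :* u)) refl b (lookup u i) μ (total ls) a)
                (trans (cong (λ v → (b ⊕ ⊝ (μ ⊗ a)) ⊗ lookup u i ⊕ μ ⊗ (v ⊗ lookup u i)) zs)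
                  (solve 3 (λ v m u → v :+ m :* (:0 :* u) := v) refl _ μ (lookup u i))))) h)))

  private
    AllGood : ℕ → Set
    AllGood r = (ls : Vec 𝔽 r) → (∀ i → lookup ls i ≢ 0#) → ∀ K → Mostly (Good ls K)

    good-single : AllGood 1
    good-single (a ∷ []) ne K = mostly-const λ n S t t∈ U le → pure (solution (t ∷ []) (λ { zero → t∈ })
      (λ i → solve 2 (λ a t → a :* t :+ :0 := (a :+ :0) :* t) refl a (lookup t i))
      (λ { (b ∷ []) _ → b ⊗ inv a (ne zero) , cong (_∷ []) (sym (trans (solve 3 (λ b i a → b :* i :* a := b :* (a :* i)) refl b (inv a (ne zero)) a)
                                            (trans (cong (b ⊗_) (inv-right a (ne zero))) (⊗-identityʳ b)))) }))

    good-zero : ∀ r → AllGood r → ∀ a (ls : Vec 𝔽 r) → (∀ i → lookup ls i ≢ 0#) → ∀ K → total (a ∷ ls) ≡ 0# → Mostly (Good (a ∷ ls) K)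
    good-zero r IH a ls ne K zs = mostly-restrict (IH ls ne (suc K)) (mostly-outside K)
      λ n S G? t t∈ outside U le → outside U le >>= λ (u , u∈ , u∉) →
        let u∈S , good = ∈-filter⁻ G? {xs = S} u∈ in ¬¬-map (extend-zero u u∈S u∉ zs) (good (u ∷ U) (s≤s le))

    good-merge : ∀ r → AllGood (suc r) → ∀ a b (ls : Vec 𝔽 r) → b ≢ 0# → (∀ i → lookup ls i ≢ 0#) → ∀ K → a ⊕ b ≢ 0# →
      Mostly (Good (a ∷ b ∷ ls) K)
    good-merge r IH a b ls b≢0 ne K ab≢0 = mostly-restrict (mostly-pair a b b≢0 (suc (r + K)))
      (IH (a ⊕ b ∷ ls) (λ { zero → ab≢0 ; (suc i) → ne i }) K)
      λ n S G? t t∈ good U le → good U le >>= λ { (solution (u ∷ xs) xs∈ sat ind) →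
        let u∈S , pair = ∈-filter⁻ G? {xs = S} (xs∈ zero) in
        pair (hull u xs U) (hull-length u xs U le) >>= λ (x , y , x∈ , y∈ , eq , x∉) →
        pure (extend-pair x y u xs b≢0 x∈ y∈ (λ i → proj₁ (∈-filter⁻ G? {xs = S} (xs∈ (suc i)))) eq x∉ sat ind ab≢0) }

    good-merge₃ : ∀ r → AllGood (suc r) → ∀ a (ls : Vec 𝔽 r) → a ≢ 0# → (∀ i → lookup ls i ≢ 0#) → ∀ K → 1# ⊕ 1# ≡ 0# →
      Mostly (Good (a ∷ a ∷ a ∷ ls) K)
    good-merge₃ r IH a ls a≢0 ne K char2 = mostly-restrict (mostly-triple char2 (suc (r + K)))
      (IH (a ∷ ls) (λ { zero → a≢0 ; (suc i) → ne i }) K)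
      λ n S G? t t∈ good U le → good U le >>= λ { (solution (u ∷ xs) xs∈ sat ind) →
        let u∈S , triple = ∈-filter⁻ G? {xs = S} (xs∈ zero) in
        triple (hull u xs U) (hull-length u xs U le) >>= λ (x , y , z , x∈ , y∈ , z∈ , eq , x∉ , y∉) →
        pure (extend-triple x y z u xs char2 x∈ y∈ z∈ (λ i → proj₁ (∈-filter⁻ G? {xs = S} (xs∈ (suc i)))) eq x∉ y∉ sat ind) }

    ⊕-cancel : ∀ {a b c} → a ⊕ b ≡ 0# → a ⊕ c ≡ 0# → b ≡ c
    ⊕-cancel {a} {b} {c} e f = trans (solve 2 (λ a b → b := a :+ b :+ :- a) refl a b)
      (trans (cong (_⊕ ⊝ a) (trans e (sym f))) (solve 2 (λ a c → a :+ c :+ :- a := c) refl a c))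

    -- Two coefficients with nonzero sum can be merged. If all three pairwise sums vanish, then a =
    -- b = c and 2a = 0, so the characteristic is 2 and the three merge into one.
    good-three : ∀ r → AllGood (suc r) → AllGood (suc (suc r)) → ∀ a b c (ls : Vec 𝔽 r) → a ≢ 0# → b ≢ 0# → c ≢ 0# →
      (∀ i → lookup ls i ≢ 0#) → ∀ K → Mostly (Good (a ∷ b ∷ c ∷ ls) K)
    good-three r IH₁ IH₂ a b c ls a≢0 b≢0 c≢0 ne K with a ⊕ b ≟ᶠ 0# | a ⊕ c ≟ᶠ 0# | b ⊕ c ≟ᶠ 0#
    ... | no ab | _     | _     = good-merge (suc r) IH₂ a b (c ∷ ls) b≢0 (λ { zero → c≢0 ; (suc i) → ne i }) K ab
    ... | yes _ | no ac | _     = mostly-map (λ n S t g U le → ¬¬-map solution-swap₂ (g U le))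
      (good-merge (suc r) IH₂ a c (b ∷ ls) c≢0 (λ { zero → b≢0 ; (suc i) → ne i }) K ac)
    ... | yes _ | yes _ | no bc = mostly-map (λ n S t g U le → ¬¬-map (solution-swap₁ ∘ solution-swap₂) (g U le))
      (good-merge (suc r) IH₂ b c (a ∷ ls) c≢0 (λ { zero → a≢0 ; (suc i) → ne i }) K bc)
    ... | yes ab | yes ac | yes bc with ⊕-cancel ab ac
    ... | refl with ⊕-cancel bc (trans (⊕-comm b a) ab)
    ... | refl = good-merge₃ r IH₁ a ls a≢0 ne K (⊗-cancelˡ a≢0 (trans (solve 1 (λ a → a :* (:1 :+ :1) := a :+ a) refl a) (trans ab (sym (⊗-zeroʳ a)))))

    -- Two opposite coefficients have no nonzero sum to merge into, and there is no third one to
    -- turn to; but then the total is zero and one point can be chosen freely.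
    good-two : AllGood 2
    good-two (a ∷ b ∷ []) ne K with total (a ∷ b ∷ []) ≟ᶠ 0#
    ... | yes zs = good-zero 1 good-single a (b ∷ []) (ne ∘ suc) K zs
    ... | no nz  = good-merge 0 good-single a b [] (ne (suc zero)) (λ ()) K (λ e → nz (trans (cong (a ⊕_) (⊕-identityʳ b)) e))

  mostly-good : ∀ r → AllGood r
  mostly-good zero [] _ K = mostly-const λ n S t t∈ U le → pure (solution [] (λ ()) (λ i → sym (⊗-zeroˡ _)) (λ { [] _ → 0# , refl }))
  mostly-good (suc zero)          = good-single
  mostly-good (suc (suc zero))    = good-two
  mostly-good (suc (suc (suc r))) (a ∷ b ∷ c ∷ ls) ne =
    good-three r (mostly-good (suc r)) (mostly-good (suc (suc r))) a b c ls (ne zero) (ne (suc zero)) (ne (suc (suc zero))) (λ i → ne (suc (suc (suc i))))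

  -- Combining the column classes

  span-sumF : ∀ {n} (U : List (Point n)) r {f : Fin r → Fin n → 𝔽} → (∀ c → Span U (f c)) → Span U (λ i → sumF (λ c → f c i))
  span-sumF U zero    h = span-0 U (λ _ → refl)
  span-sumF U (suc r) h = span-⊕ U (h zero) (span-sumF U r (h ∘ suc))

  gate : {P : Set} → Dec P → 𝔽 → 𝔽
  gate (yes _) x = x
  gate (no _)  x = 0#

  ∑-filter : {A : Set} {P : A → Set} (P? : Decidable P) (xs : List A) (f : A → 𝔽) → ∑ (filter P? xs) f ≡ ∑ xs (λ x → gate (P? x) (f x))
  ∑-filter P? []       f = refl
  ∑-filter P? (x ∷ xs) f with P? x
  ... | yes _ = cong (f x ⊕_) (∑-filter P? xs f)
  ... | no _  = trans (∑-filter P? xs f) (sym (⊕-identityˡ _))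

  module _ {k : ℕ} where

    weights : (Fin k → 𝔽) → (js : List (Fin k)) → Vec 𝔽 (length js)
    weights b js = Vec.map b (Vec.fromList js)

    assign : ∀ {n} (js : List (Fin k)) → Vec (Point n) (length js) → Fin k → Point n
    -- A default for indices outside `js`, over which no sum extends.
    assign []       []       j = Vec.replicate _ 0#
    assign (i ∷ js) (x ∷ xs) j with i Fin.≟ j
    ... | yes _ = x
    ... | no _  = assign js xs j

    assign-∈ : ∀ {n} {S : List (Point n)} js xs → (∀ i → lookup xs i ∈ S) → ∀ j → j ∈ js → assign js xs j ∈ S
    assign-∈ (i ∷ js) (x ∷ xs) h j j∈ with i Fin.≟ j
    ... | yes _ = h zero
    assign-∈ (i ∷ js) (x ∷ xs) h j (here refl) | no ne = ⊥-elim (ne refl)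
    assign-∈ (i ∷ js) (x ∷ xs) h j (there j∈)  | no ne = assign-∈ js xs (h ∘ suc) j j∈

    ∑-assign : ∀ {n} (b : Fin k → 𝔽) js (xs : Vec (Point n) (length js)) → Unique js →
      ∀ t → ∑ js (λ j → b j ⊗ lookup (assign js xs j) t) ≡ dot (weights b js) xs t
    ∑-assign b []       []       _        t = refl
    ∑-assign b (i ∷ js) (x ∷ xs) (i∉ ∷ u) t = cong₂ _⊕_ (cong (λ v → b i ⊗ lookup v t) head)
        (trans (∑-cong js (λ j j∈ → cong (λ v → b j ⊗ lookup v t) (tail j j∈))) (∑-assign b js xs u t))
      where
      head : assign (i ∷ js) (x ∷ xs) i ≡ x
      head with i Fin.≟ i
      ... | yes _ = refl
      ... | no ne = ⊥-elim (ne refl)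
      tail : ∀ j → j ∈ js → assign (i ∷ js) (x ∷ xs) j ≡ assign js xs j
      tail j j∈ with i Fin.≟ j
      ... | yes refl = ⊥-elim (All¬⇒¬Any i∉ j∈)
      ... | no _     = refl

    total-weights : (b : Fin k → 𝔽) (js : List (Fin k)) → total (weights b js) ≡ ∑ js b
    total-weights b []       = refl
    total-weights b (j ∷ js) = cong (b j ⊕_) (total-weights b js)

    weights-≡ : ∀ {b wt : Fin k → 𝔽} {μ} js → weights b js ≡ μ ∙ weights wt js → ∀ j → j ∈ js → b j ≡ μ ⊗ wt j
    weights-≡ (i ∷ js) e j (here refl) = cong Vec.head e
    weights-≡ (i ∷ js) e j (there j∈)  = weights-≡ js (cong Vec.tail e) j j∈

    weights-≢0 : (wt : Fin k → 𝔽) → (∀ j → wt j ≢ 0#) → ∀ js i → lookup (weights wt js) i ≢ 0#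
    weights-≢0 wt h (j ∷ js) zero    = h j
    weights-≢0 wt h (j ∷ js) (suc i) = weights-≢0 wt h js i

    module _ (wt : Fin k → 𝔽) {n} (S : List (Point n)) (K m : ℕ) where

      record Family (r : ℕ) (js : Fin r → List (Fin k)) (t : Fin r → Point n) (U : List (Point n)) : Set where
        field
          X         : Fin r → Fin k → Point n
          X∈S       : ∀ c j → j ∈ js c → X c j ∈ S
          satisfies : ∀ c i → ∑ (js c) (λ j → wt j ⊗ lookup (X c j) i) ≡ ∑ (js c) wt ⊗ lookup (t c) i
          jointly   : ∀ (b : Fin r → Fin k → 𝔽) → Span U (λ i → sumF (λ c → ∑ (js c) (λ j → b c j ⊗ lookup (X c j) i))) →
                      ∀ c → ∃[ μ ] (∀ j → j ∈ js c → b c j ≡ μ ⊗ wt j)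

      proportional-∑ : ∀ {t : Point n} {X : Fin k → Point n} {μ} {b : Fin k → 𝔽} js →
        (∀ i → ∑ js (λ j → wt j ⊗ lookup (X j) i) ≡ ∑ js wt ⊗ lookup t i) → (∀ j → j ∈ js → b j ≡ μ ⊗ wt j) →
        ∀ i → ∑ js (λ j → b j ⊗ lookup (X j) i) ≡ μ ⊗ (∑ js wt ⊗ lookup t i)
      proportional-∑ {t} {X} {μ} js sat h i = trans (∑-cong js (λ j j∈ → trans (cong (_⊗ lookup (X j) i) (h j j∈)) (⊗-assoc μ (wt j) _)))
        (trans (∑-⊗ js μ _) (cong (μ ⊗_) (sat i)))

      -- The equations are solved one after another, with the points already chosen added to `U`. A
      -- joint relation is therefore proportional to each of the later equations. Their contribution
      -- is then a combination of the right-hand sides `t c`, which lie in the span of `U`, so the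
      -- first equation's part is a relation modulo `U` as well.
      build : ∀ r (js : Fin r → List (Fin k)) (t : Fin r → Point n) (U : List (Point n)) →
        (∀ c → Unique (js c)) → (∀ c → length (js c) ≤ m) → r * m + length U ≤ K →
        (∀ c → Span U (lookup (t c))) → (∀ c → Good (weights wt (js c)) K n S (t c)) → ¬ ¬ Family r js t U
      build zero    js t U uniq short le t∈ good = pure record { X = λ () ; X∈S = λ () ; satisfies = λ () ; jointly = λ _ _ () }
      build (suc r) js t U uniq short le t∈ good =
        good zero U (≤-trans (m≤n+m _ _) le) >>= λ (solution xs xs∈ sat ind) →
        build r (js ∘ suc) (t ∘ suc) (Vec.toList xs ++ U) (uniq ∘ suc) (short ∘ suc) (bound′ xs) (span-++ʳ (Vec.toList xs) U ∘ t∈ ∘ suc) (good ∘ suc) >>= λ f →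
        pure (extend xs xs∈ sat ind f)
        where
        js₀ = js zero
        bound′ : (xs : Vec (Point n) (length js₀)) → r * m + length (Vec.toList xs ++ U) ≤ K
        bound′ xs = begin
          r * m + length (Vec.toList xs ++ U) ≡⟨ cong (r * m +_) (length-++ (Vec.toList xs)) ⟩
          r * m + (length (Vec.toList xs) + length U) ≤⟨ +-monoʳ-≤ (r * m) (+-monoˡ-≤ (length U) (≤-trans (≤-reflexive (Vecₚ.length-toList xs)) (short zero))) ⟩
          r * m + (m + length U) ≡⟨ lem (r * m) m (length U) ⟩
          m + r * m + length U ≤⟨ le ⟩
          K ∎
          where
          open ≤-Reasoning
          lem : ∀ a b c → a + (b + c) ≡ b + a + c
          lem = solve-∀
        extend : ∀ xs → (∀ i → lookup xs i ∈ S) → (∀ i → dot (weights wt js₀) xs i ≡ total (weights wt js₀) ⊗ lookup (t zero) i) →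
          (∀ bs → Span U (dot bs xs) → ∃[ μ ] (bs ≡ μ ∙ weights wt js₀)) →
          Family r (js ∘ suc) (t ∘ suc) (Vec.toList xs ++ U) → Family (suc r) js t U
        extend xs xs∈ sat ind f = record
          { X         = X′
          ; X∈S       = λ { zero → assign-∈ js₀ xs xs∈ ; (suc c) → X∈S c }
          ; satisfies = λ { zero i → trans (∑-assign wt js₀ xs (uniq zero) i) (trans (sat i) (cong (_⊗ lookup (t zero) i) (total-weights wt js₀)))
                          ; (suc c) → satisfies c }
          ; jointly   = joint
          }
          where
          open Family f
          X′ : Fin (suc r) → Fin k → Point n
          X′ zero    = assign js₀ xs
          X′ (suc c) = X c
          V = Vec.toList xs ++ U
          xs∈V : ∀ i → lookup xs i ∈ V
          xs∈V i = ∈-++⁺ˡ (Vec∈.∈-toList⁺ (Vec∈.∈-lookup i xs))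
          joint : ∀ b → Span U (λ i → sumF (λ c → ∑ (js c) (λ j → b c j ⊗ lookup (X′ c j) i))) → ∀ c → ∃[ μ ] (∀ j → j ∈ js c → b c j ≡ μ ⊗ wt j)
          joint b h = λ { zero → proj₁ first , weights-≡ js₀ (proj₂ first) ; (suc c) → later c }
            where
            A R : Fin n → 𝔽
            A i = ∑ js₀ (λ j → b zero j ⊗ lookup (assign js₀ xs j) i)
            R i = sumF (λ c → ∑ (js (suc c)) (λ j → b (suc c) j ⊗ lookup (X c j) i))
            A∈V : Span V A
            A∈V = span-resp V (λ i → sym (∑-assign (b zero) js₀ xs (uniq zero) i)) (span-dot V (weights (b zero) js₀) xs xs∈V)
            later : ∀ c → ∃[ μ ] (∀ j → j ∈ js (suc c) → b (suc c) j ≡ μ ⊗ wt j)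
            later = jointly (b ∘ suc) (span-linear V 1# (⊝ 1#) (span-++ʳ (Vec.toList xs) U h) A∈V
              (λ i → solve 2 (λ a r → :1 :* (a :+ r) :+ :- :1 :* a := r) refl (A i) (R i)))
            R∈U : Span U R
            R∈U = span-sumF U r (λ c → span-resp U (λ i → sym (proportional-∑ {t (suc c)} {X c} (js (suc c)) (satisfies c) (proj₂ (later c)) i))
                    (span-⊗ U (proj₁ (later c)) (span-⊗ U (∑ (js (suc c)) wt) (t∈ (suc c)))))
            first : ∃[ μ ] (weights (b zero) js₀ ≡ μ ∙ weights wt js₀)
            first = ind (weights (b zero) js₀) (span-linear U 1# (⊝ 1#) h R∈U
              (λ i → trans (solve 2 (λ a r → :1 :* (a :+ r) :+ :- :1 :* r := a) refl (A i) (R i)) (∑-assign (b zero) js₀ xs (uniq zero) i)))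

  -- Translates with prescribed differences

  IndependentMod : ∀ {n r} → List (Point n) → (Fin r → Point n) → Point n → Point n → Set
  IndependentMod {r = r} U a z₀ z₁ = ∀ (p : Fin r → 𝔽) s₀ s₁ →
    Span U (λ i → sumF (λ c → p c ⊗ lookup (a c) i) ⊕ s₀ ⊗ lookup z₀ i ⊕ s₁ ⊗ lookup z₁ i) →
    (∀ c → p c ≡ 0#) × s₀ ≡ 0# × s₁ ≡ 0#

  -- For each class a pair of points of `T` with difference v_c d, where d = z₁ - z₀ is common to
  -- all classes.
  record Config {r : ℕ} (v : Fin r → 𝔽) {n} (T : List (Point n)) : Set where
    constructor config
    field
      a          : Fin r → Point n
      z₀ z₁      : Point n
      a+vz₀∈     : ∀ c → shift (a c) (v c) z₀ ∈ T
      a+vz₁∈     : ∀ c → shift (a c) (v c) z₁ ∈ T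
      independent : IndependentMod [] a z₀ z₁

  -- Induction on the number of classes left, in contrapositive form. Averaging finds a translate
  -- outside the span of `as` for which many z remain in `Z`; it joins `as`, and each class costs a
  -- factor of q^n over |T| - q^L. When no class is left, z₀ and z₁ exist as soon as `Z` has more
  -- than q^(L + 1) points.
  select : ∀ {n} L (T : List (Point n)) → Unique T → ∀ r (v : Fin r → 𝔽) (as Z : List (Point n)) → Unique Z → r + length as ≤ L →
    (∀ (a : Fin r → Point n) z₀ z₁ → z₀ ∈ Z → z₁ ∈ Z → (∀ c → shift (a c) (v c) z₀ ∈ T × shift (a c) (v c) z₁ ∈ T) →
      IndependentMod as a z₀ z₁ → ⊥) →
    length Z * (length T ∸ q ^ L) ^ r ≤ (q ^ n) ^ r * q ^ suc L
  select L T uT zero v as Z uZ le none = ≤-trans (≤-reflexive (*-identityʳ (length Z))) (≤-trans (≮⇒≥ contra) (≤-reflexive (sym (*-identityˡ _))))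
    where
    contra : q ^ suc L < length Z → ⊥
    contra lt with outside-span as uZ (≤-<-trans (^-monoʳ-≤ q (m≤n⇒m≤1+n le)) lt)
    ... | z₀ , z₀∈ , z₀∉ with outside-span (z₀ ∷ as) uZ (≤-<-trans (^-monoʳ-≤ q (s≤s le)) lt)
    ... | z₁ , z₁∈ , z₁∉ = none (λ ()) z₀ z₁ z₀∈ z₁∈ (λ ()) (λ p s₀ s₁ h → (λ ()) , indep₀ s₀ s₁ h , indep₁ s₀ s₁ h)
      where
      indep₁ : ∀ s₀ s₁ → Span as (λ i → 0# ⊕ s₀ ⊗ lookup z₀ i ⊕ s₁ ⊗ lookup z₁ i) → s₁ ≡ 0#
      indep₁ s₀ s₁ h = annihilates (z₀ ∷ as) z₁ s₁ z₁∉ (s₀ , span-resp as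
        (λ i → solve 4 (λ s x u y → :0 :+ s :* x :+ u :* y := u :* y :+ s :* x) refl s₀ (lookup z₀ i) s₁ (lookup z₁ i)) h)
      indep₀ : ∀ s₀ s₁ → Span as (λ i → 0# ⊕ s₀ ⊗ lookup z₀ i ⊕ s₁ ⊗ lookup z₁ i) → s₀ ≡ 0#
      indep₀ s₀ s₁ h = annihilates as z₀ s₀ z₀∉ (span-resp as
        (λ i → trans (cong (λ s → 0# ⊕ s₀ ⊗ lookup z₀ i ⊕ s ⊗ lookup z₁ i) (indep₁ s₀ s₁ h))
          (solve 3 (λ s x y → :0 :+ s :* x :+ :0 :* y := s :* x) refl s₀ (lookup z₀ i) (lookup z₁ i))) h)
  select {n} L T uT (suc r) v as Z uZ le none = begin
    length Z * (τ * τ ^ r) ≡⟨ *-assoc (length Z) τ _ ⟨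
    length Z * τ * τ ^ r ≤⟨ *-monoˡ-≤ (τ ^ r) (*-monoʳ-≤ (length Z) (∸-monoʳ-≤ (length T) (spanned-≤ as (≤-trans (m≤n+m _ (suc r)) le)))) ⟩
    length Z * (length T ∸ length (spanned as)) * τ ^ r ≤⟨ average (v zero) Z T (spanned as) uT (τ ^ r) ((q ^ n) ^ r * q ^ suc L) step ⟩
    q ^ n * ((q ^ n) ^ r * q ^ suc L) ≡⟨ *-assoc (q ^ n) _ _ ⟨
    q ^ n * (q ^ n) ^ r * q ^ suc L ∎
    where
    open ≤-Reasoning
    τ = length T ∸ q ^ L
    step : ∀ a → a ∉ spanned as → count (λ z → shift a (v zero) z ∈ᵖ? T) Z * τ ^ r ≤ (q ^ n) ^ r * q ^ suc L
    step a₀ a₀∉ = select L T uT r (v ∘ suc) (a₀ ∷ as) Z′ (Uniq.filter⁺ (λ z → shift a₀ (v zero) z ∈ᵖ? T) uZ) (≤-trans (≤-reflexive (+-suc r _)) le)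
      (λ a z₀ z₁ z₀∈ z₁∈ in-T indep → none (Functional._∷_ a₀ a) z₀ z₁ (proj₁ (Z′⁻ z₀∈)) (proj₁ (Z′⁻ z₁∈))
        (λ { zero → proj₂ (Z′⁻ z₀∈) , proj₂ (Z′⁻ z₁∈) ; (suc c) → in-T c }) (extended a z₀ z₁ indep))
      where
      Z′ = filter (λ z → shift a₀ (v zero) z ∈ᵖ? T) Z
      Z′⁻ : ∀ {z} → z ∈ Z′ → z ∈ Z × shift a₀ (v zero) z ∈ T
      Z′⁻ = ∈-filter⁻ (λ z → shift a₀ (v zero) z ∈ᵖ? T) {xs = Z}
      extended : ∀ (a : Fin r → Point n) z₀ z₁ → IndependentMod (a₀ ∷ as) a z₀ z₁ → IndependentMod as (Functional._∷_ a₀ a) z₀ z₁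
      extended a z₀ z₁ indep p s₀ s₁ h = (λ { zero → p₀≡0 ; (suc c) → proj₁ rest c }) , proj₂ rest
        where
        E : Fin n → 𝔽
        E i = sumF (λ c → p (suc c) ⊗ lookup (a c) i) ⊕ s₀ ⊗ lookup z₀ i ⊕ s₁ ⊗ lookup z₁ i
        regroup : ∀ i → p zero ⊗ lookup a₀ i ⊕ sumF (λ c → p (suc c) ⊗ lookup (a c) i) ⊕ s₀ ⊗ lookup z₀ i ⊕ s₁ ⊗ lookup z₁ i ≡ E i ⊕ p zero ⊗ lookup a₀ i
        regroup i = solve 4 (λ a b c d → a :+ b :+ c :+ d := b :+ c :+ d :+ a) refl (p zero ⊗ lookup a₀ i) _ (s₀ ⊗ lookup z₀ i) (s₁ ⊗ lookup z₁ i)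
        rest = indep (p ∘ suc) s₀ s₁ (p zero , span-resp as regroup h)
        p₀≡0 : p zero ≡ 0#
        p₀≡0 = decidable-stable (p zero ≟ᶠ 0#) (λ ne → a₀∉ (∈-spanned as (span-cancel as (p zero) ne (span-resp as last h))))
          where
          last : ∀ i → p zero ⊗ lookup a₀ i ⊕ sumF (λ c → p (suc c) ⊗ lookup (a c) i) ⊕ s₀ ⊗ lookup z₀ i ⊕ s₁ ⊗ lookup z₁ i ≡ p zero ⊗ lookup a₀ i
          last i = trans (cong₂ (λ s s′ → p zero ⊗ lookup a₀ i ⊕ s ⊕ s₀ ⊗ lookup z₀ i ⊕ s′ ⊗ lookup z₁ i)
              (sumF-zero r (λ c → trans (cong (_⊗ lookup (a c) i) (proj₁ rest c)) (⊗-zeroˡ _))) (proj₂ (proj₂ rest)))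
            (trans (cong (λ s → p zero ⊗ lookup a₀ i ⊕ 0# ⊕ s ⊗ lookup z₀ i ⊕ 0# ⊗ lookup z₁ i) (proj₁ (proj₂ rest)))
              (solve 3 (λ a x y → a :+ :0 :+ :0 :* x :+ :0 :* y := a) refl _ (lookup z₀ i) (lookup z₁ i)))

  -- Started with all q^n points as `Z`, `select` delivers the hypothesis of `small-root`. The
  -- truncated subtraction of q^(r + 1) adds only a constant.
  mostly-config : ∀ r (v : Fin (suc r) → 𝔽) → Mostly (λ n S t → ¬ ¬ Config v S)
  mostly-config r v = mostly (2 * suc r) (C + q ^ suc r) λ
    { n S []       uS uB B⊆S bad → small z≤n
    ; n S B@(b ∷ _) uS uB B⊆S bad → small-≤ (≤-trans (unique-⊆⇒length≤ uB B⊆S) (split (length S)))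
        (small-slower (≤-reflexive (+-identityʳ _)) (small-+ (small-root r (m^n>0 q (2 + r)) (root n S uS (λ f → bad b (here refl) (λ k → k f))))
          (small-const {0} ≤-refl))) }
    where
    C = q ^ (2 + r)
    split : ∀ m → m ≤ m ∸ q ^ suc r + q ^ suc r
    split m = ≤-trans (m≤n+m∸n m (q ^ suc r)) (≤-reflexive (+-comm (q ^ suc r) _))
    root : ∀ n (S : List (Point n)) → Unique S → ¬ Config v S → (length S ∸ q ^ suc r) ^ suc r * q ^ n ≤ (q ^ n) ^ suc r * C
    root n S uS none = ≤-trans (≤-reflexive (trans (*-comm _ (q ^ n)) (cong (_* (length S ∸ q ^ suc r) ^ suc r) (sym (length-points n)))))
      (select (suc r) S uS (suc r) v [] (points n) (points-unique n) (≤-reflexive (+-identityʳ _))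
        (λ a z₀ z₁ _ _ in-S indep → none (config a z₀ z₁ (proj₁ ∘ in-S) (proj₂ ∘ in-S) indep)))

  -- Solutions of the whole system

  module Classes {k ℓ : ℕ} (cls : Fin k → Fin ℓ) (rep : Fin ℓ → Fin k) (cls-rep : ∀ c → cls (rep c) ≡ c)
    (wt : Fin k → 𝔽) (wt≢0 : ∀ j → wt j ≢ 0#) where

    tail? : ∀ c → Decidable (λ j → cls j ≡ c × j ≢ rep c)
    tail? c j = (cls j Fin.≟ c) ×-dec ¬? (j Fin.≟ rep c)

    members tails : Fin ℓ → List (Fin k)
    members c = filter (λ j → cls j Fin.≟ c) (allFin k)
    tails c   = filter (tail? c) (allFin k)

    class-weight : Fin ℓ → 𝔽
    class-weight c = ∑ (members c) wt

    fibres : (f : Fin ℓ → Fin k → 𝔽) → sumF (λ j → f (cls j) j) ≡ sumF (λ c → ∑ (members c) (f c))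
    fibres f = sym (begin
      sumF (λ c → ∑ (members c) (f c)) ≡⟨ sumF-cong ℓ (λ c → trans (∑-filter _ (allFin k) (f c)) (sym (sumF≡∑ k _))) ⟩
      sumF (λ c → sumF (λ j → gate (cls j Fin.≟ c) (f c j))) ≡⟨ sumF-swap ℓ k _ ⟩
      sumF (λ j → sumF (λ c → gate (cls j Fin.≟ c) (f c j))) ≡⟨ sumF-cong k (λ j → trans (sumF≡∑ ℓ _)
                                            (∑-single (Uniq.allFin⁺ ℓ) (∈-allFin (cls j)) (λ c _ ne → off (cls j Fin.≟ c) ne))) ⟩
      sumF (λ j → gate (cls j Fin.≟ cls j) (f (cls j) j)) ≡⟨ sumF-cong k (λ j → on (cls j Fin.≟ cls j)) ⟩
      sumF (λ j → f (cls j) j) ∎)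
      where
      open ≡-Reasoning
      off : ∀ {c d x} (e : Dec (c ≡ d)) → d ≢ c → gate e x ≡ 0#
      off (yes refl) ne = ⊥-elim (ne refl)
      off (no _)     _  = refl
      on : ∀ {c : Fin ℓ} {x} (e : Dec (c ≡ c)) → gate e x ≡ x
      on (yes _) = refl
      on (no ne) = ⊥-elim (ne refl)

    members-split : ∀ c (g : Fin k → 𝔽) → ∑ (members c) g ≡ g (rep c) ⊕ ∑ (tails c) g
    members-split c g = begin
      ∑ (members c) g
        ≡⟨ ∑-filter _ (allFin k) g ⟩
      ∑ (allFin k) (λ j → gate (cls j Fin.≟ c) (g j))
        ≡⟨ ∑-cong (allFin k) (λ j _ → split j) ⟩
      ∑ (allFin k) (λ j → gate (j Fin.≟ rep c) (g j) ⊕ gate (tail? c j) (g j))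
        ≡⟨ ∑-⊕ (allFin k) _ _ ⟩
      ∑ (allFin k) (λ j → gate (j Fin.≟ rep c) (g j)) ⊕ ∑ (allFin k) (λ j → gate (tail? c j) (g j))
        ≡⟨ cong₂ _⊕_ (trans (∑-single (Uniq.allFin⁺ k) (∈-allFin (rep c)) (λ j _ ne → off j ne)) on) (sym (∑-filter _ (allFin k) g)) ⟩
      g (rep c) ⊕ ∑ (tails c) g ∎
      where
      open ≡-Reasoning
      off : ∀ j → j ≢ rep c → gate (j Fin.≟ rep c) (g j) ≡ 0#
      off j ne with j Fin.≟ rep c
      ... | yes e = ⊥-elim (ne e)
      ... | no _  = refl
      on : gate (rep c Fin.≟ rep c) (g (rep c)) ≡ g (rep c)
      on with rep c Fin.≟ rep c
      ... | yes _ = refl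
      ... | no ne = ⊥-elim (ne refl)
      split : ∀ j → gate (cls j Fin.≟ c) (g j) ≡ gate (j Fin.≟ rep c) (g j) ⊕ gate (tail? c j) (g j)
      split j with cls j Fin.≟ c | j Fin.≟ rep c
      ... | yes _ | yes _    = sym (⊕-identityʳ _)
      ... | yes _ | no _     = sym (⊕-identityˡ _)
      ... | no ne | yes refl = ⊥-elim (ne (cls-rep c))
      ... | no _  | no _     = sym (⊕-identityˡ _)

    ClassRelation : (w : Fin ℓ → 𝔽) (b : Fin k → 𝔽) → Set
    ClassRelation w b = Σ (Fin ℓ → 𝔽) λ μ → (∀ j → b j ≡ μ (cls j) ⊗ wt j) × sumF (λ c → μ c ⊗ w c) ≡ 0#

    -- Two inclusions that determine the relations between the points: `solves` provides those with
    -- multipliers orthogonal to `w`, and `relations` shows that there are no others.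
    record Found {n} (S : List (Point n)) (w : Fin ℓ → 𝔽) : Set where
      field
        x         : Fin k → Point n
        x∈S       : ∀ j → x j ∈ S
        solves    : ∀ (V : Fin ℓ → 𝔽) → sumF (λ c → V c ⊗ w c) ≡ 0# → ∀ i → sumF (λ j → V (cls j) ⊗ wt j ⊗ lookup (x j) i) ≡ 0#
        relations : ∀ (b : Fin k → 𝔽) → (∀ i → sumF (λ j → b j ⊗ lookup (x j) i) ≡ 0#) → ClassRelation w b

    private
      tails⁻ : ∀ {c j} → j ∈ tails c → cls j ≡ c × j ≢ rep c
      tails⁻ j∈ = proj₂ (∈-filter⁻ _ {xs = allFin k} j∈)

      short : ∀ {js : List (Fin k)} → Unique js → length js ≤ k
      short {js} u = subst (length js ≤_) (length-tabulate {n = k} id) (unique-⊆⇒length≤ u (λ j _ → ∈-allFin j))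

      members-unique : ∀ c → Unique (members c)
      members-unique c = Uniq.filter⁺ _ (Uniq.allFin⁺ k)

      tails-unique : ∀ c → Unique (tails c)
      tails-unique c = Uniq.filter⁺ _ (Uniq.allFin⁺ k)

      -- Room for at most k points from each of the ℓ classes, for z₀ and z₁, and for ℓ translates.
      K : ℕ
      K = ℓ * k + (2 + ℓ)

    -- A relation with multipliers μ_c evaluates to (Σ μ_c σ_c) t, because all classes share the
    -- same t. As t ≠ 0, the scalar vanishes.
    found-concentric : ∀ {n} (S : List (Point n)) t → ¬ Span [] (lookup t) → (∀ c → Good (weights wt (members c)) K n S t) → ¬ ¬ Found S class-weight
    found-concentric {n} S t t≢0 good =
      build wt S K k ℓ members (λ _ → t) (t ∷ []) members-unique (λ c → short (members-unique c)) (+-monoʳ-≤ (ℓ * k) (s≤s z≤n))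
        (λ _ → span-∈ (t ∷ []) (here refl)) good >>= λ f → pure (found f)
      where
      found : Family wt S K k ℓ members (λ _ → t) (t ∷ []) → Found S class-weight
      found f = record
        { x         = λ j → X (cls j) j
        ; x∈S       = λ j → X∈S (cls j) j (∈-filter⁺ _ (∈-allFin j) refl)
        ; solves    = λ V V⊥w i → begin
            sumF (λ j → V (cls j) ⊗ wt j ⊗ lookup (X (cls j) j) i) ≡⟨ fibres (λ c j → V c ⊗ wt j ⊗ lookup (X c j) i) ⟩
            sumF (λ c → ∑ (members c) (λ j → V c ⊗ wt j ⊗ lookup (X c j) i)) ≡⟨ sumF-cong ℓ (λ c → each c V i) ⟩
            sumF (λ c → V c ⊗ class-weight c ⊗ lookup t i) ≡⟨ sumF-⊗ʳ ℓ (lookup t i) _ ⟩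
            sumF (λ c → V c ⊗ class-weight c) ⊗ lookup t i ≡⟨ cong (_⊗ lookup t i) V⊥w ⟩
            0# ⊗ lookup t i ≡⟨ ⊗-zeroˡ _ ⟩
            0# ∎
        ; relations = λ b h → let μ = λ c → proj₁ (prop b h c) in
            μ , (λ j → proj₂ (prop b h (cls j)) j (∈-filter⁺ _ (∈-allFin j) refl)) , orthogonal b h
        }
        where
        open Family f
        open ≡-Reasoning
        each : ∀ c (V : Fin ℓ → 𝔽) i → ∑ (members c) (λ j → V c ⊗ wt j ⊗ lookup (X c j) i) ≡ V c ⊗ class-weight c ⊗ lookup t i
        each c V i = trans (proportional-∑ wt S K k {t} {X c} {V c} {λ j → V c ⊗ wt j} (members c) (satisfies c) (λ _ _ → refl) i) (sym (⊗-assoc _ _ _))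
        module _ (b : Fin k → 𝔽) (h : ∀ i → sumF (λ j → b j ⊗ lookup (X (cls j) j) i) ≡ 0#) where
          regroup : ∀ i → sumF (λ c → ∑ (members c) (λ j → b j ⊗ lookup (X c j) i)) ≡ 0#
          regroup i = trans (sym (fibres (λ c j → b j ⊗ lookup (X c j) i))) (h i)
          prop : ∀ c → ∃[ μ ] (∀ j → j ∈ members c → b j ≡ μ ⊗ wt j)
          prop = jointly (λ _ → b) (span-0 (t ∷ []) regroup)
          orthogonal : sumF (λ c → proj₁ (prop c) ⊗ class-weight c) ≡ 0#
          orthogonal = annihilates [] t _ t≢0 (λ i → begin
            sumF (λ c → proj₁ (prop c) ⊗ class-weight c) ⊗ lookup t i ≡⟨ sumF-⊗ʳ ℓ (lookup t i) _ ⟨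
            sumF (λ c → proj₁ (prop c) ⊗ class-weight c ⊗ lookup t i) ≡⟨ sumF-cong ℓ (λ c → trans (⊗-assoc _ _ _)
                                            (sym (proportional-∑ wt S K k {t} {X c} (members c) (satisfies c) (proj₂ (prop c)) i))) ⟩
            sumF (λ c → ∑ (members c) (λ j → b j ⊗ lookup (X c j) i)) ≡⟨ regroup i ⟩
            0# ∎)

    -- The representative of class c is put at a_c + v_c z₁, and the other members solve their part
    -- of the equation at a_c + v_c z₀. As the class weight is zero, their coefficients sum to
    -- -`wt (rep c)`, so the whole class sums to `wt (rep c)` v_c (z₁ - z₀).
    found-translates : ∀ {n} (S T : List (Point n)) → (∀ t → t ∈ T → t ∈ S) → (v : Fin ℓ → 𝔽) → (∀ c → class-weight c ≡ 0#) →
      (∀ t → t ∈ T → ∀ c → Good (weights wt (tails c)) K n S t) → Config v T → ¬ ¬ Found S (λ c → wt (rep c) ⊗ v c)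
    found-translates {n} S T T⊆S v balanced good (config a z₀ z₁ a+vz₀∈ a+vz₁∈ indep) =
      build wt S K k ℓ tails t U tails-unique (λ c → short (tails-unique c)) (+-monoʳ-≤ (ℓ * k) (s≤s (s≤s (≤-reflexive (length-tabulate a)))))
        t∈U (λ c → good (t c) (a+vz₀∈ c) c) >>= λ f → pure (found f)
      where
      t h : Fin ℓ → Point n
      t c = shift (a c) (v c) z₀
      h c = shift (a c) (v c) z₁
      U : List (Point n)
      U = z₁ ∷ z₀ ∷ Data.List.tabulate a
      shift∈U : ∀ z → z ∈ U → ∀ c → Span U (lookup (shift (a c) (v c) z))
      shift∈U z z∈ c = span-linear U 1# (v c) (span-∈ U (there (there (∈-tabulate⁺ c)))) (span-∈ U z∈)
        (λ i → trans (cong (_⊕ v c ⊗ lookup z i) (⊗-identityˡ _)) (sym (lookup-shift (a c) (v c) z i)))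
      t∈U : ∀ c → Span U (lookup (t c))
      t∈U = shift∈U z₀ (there (here refl))
      w : Fin ℓ → 𝔽
      w c = wt (rep c) ⊗ v c
      tail-weight : ∀ c → ∑ (tails c) wt ≡ ⊝ wt (rep c)
      tail-weight c = trans (solve 2 (λ s r → s := r :+ s :+ :- r) refl (∑ (tails c) wt) (wt (rep c)))
        (trans (cong (_⊕ ⊝ wt (rep c)) (trans (sym (members-split c wt)) (balanced c))) (⊕-identityˡ _))
      found : Family wt S K k ℓ tails t U → Found S w
      found f = record
        { x         = λ j → Y (cls j) j
        ; x∈S       = λ j → Y∈S (cls j) j refl
        ; solves    = λ V V⊥w i → begin
            sumF (λ j → V (cls j) ⊗ wt j ⊗ lookup (Y (cls j) j) i)
              ≡⟨ expand (λ c j → V c ⊗ wt j) i ⟩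
            sumF (λ c → V c ⊗ wt (rep c) ⊗ lookup (h c) i ⊕ ∑ (tails c) (λ j → V c ⊗ wt j ⊗ lookup (X c j) i))
              ≡⟨ sumF-cong ℓ (λ c → each V c i) ⟩
            sumF (λ c → V c ⊗ w c ⊗ (lookup z₁ i ⊕ ⊝ lookup z₀ i))
              ≡⟨ sumF-⊗ʳ ℓ _ _ ⟩
            sumF (λ c → V c ⊗ w c) ⊗ (lookup z₁ i ⊕ ⊝ lookup z₀ i)
              ≡⟨ trans (cong (_⊗ (lookup z₁ i ⊕ ⊝ lookup z₀ i)) V⊥w) (⊗-zeroˡ _) ⟩
            0# ∎
        ; relations = rel
        }
        where
        open Family f
        open ≡-Reasoning
        Y : Fin ℓ → Fin k → Point n
        Y c j with j Fin.≟ rep c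
        ... | yes _ = h c
        ... | no _  = X c j
        Y-rep : ∀ c → Y c (rep c) ≡ h c
        Y-rep c with rep c Fin.≟ rep c
        ... | yes _ = refl
        ... | no ne = ⊥-elim (ne refl)
        Y-tail : ∀ {c j} → j ≢ rep c → Y c j ≡ X c j
        Y-tail {c} {j} ne with j Fin.≟ rep c
        ... | yes e = ⊥-elim (ne e)
        ... | no _  = refl
        Y∈S : ∀ c j → cls j ≡ c → Y c j ∈ S
        Y∈S c j e with j Fin.≟ rep c
        ... | yes _ = T⊆S (h c) (a+vz₁∈ c)
        ... | no ne = X∈S c j (∈-filter⁺ (tail? c) (∈-allFin j) (e , ne))
        expand : ∀ (g : Fin ℓ → Fin k → 𝔽) i → sumF (λ j → g (cls j) j ⊗ lookup (Y (cls j) j) i) ≡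
          sumF (λ c → g c (rep c) ⊗ lookup (h c) i ⊕ ∑ (tails c) (λ j → g c j ⊗ lookup (X c j) i))
        expand g i = trans (fibres (λ c j → g c j ⊗ lookup (Y c j) i)) (sumF-cong ℓ (λ c → trans (members-split c (λ j → g c j ⊗ lookup (Y c j) i))
          (cong₂ _⊕_ (cong (λ y → g c (rep c) ⊗ lookup y i) (Y-rep c))
            (∑-cong (tails c) (λ j j∈ → cong (λ y → g c j ⊗ lookup y i) (Y-tail (proj₂ (tails⁻ j∈))))))))
        tail-sum : ∀ c μ (b : Fin k → 𝔽) → (∀ j → j ∈ tails c → b j ≡ μ ⊗ wt j) → ∀ i →
          ∑ (tails c) (λ j → b j ⊗ lookup (X c j) i) ≡ ⊝ (μ ⊗ wt (rep c) ⊗ (lookup (a c) i ⊕ v c ⊗ lookup z₀ i))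
        tail-sum c μ b e i = trans (proportional-∑ wt S K k {t c} {X c} (tails c) (satisfies c) e i)
          (trans (cong₂ (λ s y → μ ⊗ (s ⊗ y)) (tail-weight c) (lookup-shift (a c) (v c) z₀ i))
            (solve 3 (λ m r y → m :* (:- r :* y) := :- (m :* r :* y)) refl μ (wt (rep c)) _))
        each : ∀ V c i → V c ⊗ wt (rep c) ⊗ lookup (h c) i ⊕ ∑ (tails c) (λ j → V c ⊗ wt j ⊗ lookup (X c j) i) ≡
          V c ⊗ w c ⊗ (lookup z₁ i ⊕ ⊝ lookup z₀ i)
        each V c i = trans (cong₂ (λ y s → V c ⊗ wt (rep c) ⊗ y ⊕ s) (lookup-shift (a c) (v c) z₁ i) (tail-sum c (V c) (λ j → V c ⊗ wt j) (λ _ _ → refl) i))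
          (solve 6 (λ V r a v y z → V :* r :* (a :+ v :* y) :+ :- (V :* r :* (a :+ v :* z)) := V :* (r :* v) :* (y :+ :- z)) refl
            (V c) (wt (rep c)) (lookup (a c) i) (v c) (lookup z₁ i) (lookup z₀ i))
        rel : ∀ (b : Fin k → 𝔽) → (∀ i → sumF (λ j → b j ⊗ lookup (Y (cls j) j) i) ≡ 0#) → ClassRelation w b
        rel b hyp = μ , (λ j → everywhere (cls j) j refl) , orthogonal
          where
          heads : Fin n → 𝔽
          heads i = sumF (λ c → b (rep c) ⊗ lookup (h c) i)
          rest : Fin n → 𝔽
          rest i = sumF (λ c → ∑ (tails c) (λ j → b j ⊗ lookup (X c j) i))
          total≡0 : ∀ i → heads i ⊕ rest i ≡ 0#
          total≡0 i = trans (sym (sumF-⊕ ℓ (λ c → b (rep c) ⊗ lookup (h c) i) _)) (trans (sym (expand (λ _ → b) i)) (hyp i))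
          heads∈U : Span U heads
          heads∈U = span-sumF U ℓ (λ c → span-⊗ U (b (rep c)) (shift∈U z₁ (here refl) c))
          prop : ∀ c → ∃[ μ ] (∀ j → j ∈ tails c → b j ≡ μ ⊗ wt j)
          prop = jointly (λ _ → b) (span-resp U (λ i → trans (solve 2 (λ a r → :- :1 :* a := r :+ :- (a :+ r)) refl (heads i) (rest i))
            (trans (cong (λ z → rest i ⊕ ⊝ z) (total≡0 i)) (solve 1 (λ r → r :+ :- :0 := r) refl (rest i)))) (span-⊗ U (⊝ 1#) heads∈U))
          μ : Fin ℓ → 𝔽
          μ c = proj₁ (prop c)
          -- The relation is rewritten in the independent vectors a_c, z₀, z₁, with coefficients
          -- `p c`, `s₀`, `s₁`. Here `p c` = 0 gives the representative the multiplier of its class,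
          -- and `s₀` = 0 makes μ orthogonal to `w`.
          p : Fin ℓ → 𝔽
          p c = b (rep c) ⊕ ⊝ (μ c ⊗ wt (rep c))
          s₀ s₁ : 𝔽
          s₀ = ⊝ sumF (λ c → μ c ⊗ w c)
          s₁ = sumF (λ c → b (rep c) ⊗ v c)
          independent : (∀ c → p c ≡ 0#) × s₀ ≡ 0# × s₁ ≡ 0#
          independent = indep p s₀ s₁ (λ i → begin
            sumF (λ c → p c ⊗ lookup (a c) i) ⊕ s₀ ⊗ lookup z₀ i ⊕ s₁ ⊗ lookup z₁ i
              ≡⟨ cong₂ (λ x y → sumF (λ c → p c ⊗ lookup (a c) i) ⊕ x ⊕ y)
                   (trans (solve 2 (λ m z → :- m :* z := m :* (:- z)) refl _ (lookup z₀ i)) (sym (sumF-⊗ʳ ℓ (⊝ lookup z₀ i) _))) (sym (sumF-⊗ʳ ℓ (lookup z₁ i) _)) ⟩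
            sumF (λ c → p c ⊗ lookup (a c) i) ⊕ sumF (λ c → μ c ⊗ w c ⊗ ⊝ lookup z₀ i) ⊕ sumF (λ c → b (rep c) ⊗ v c ⊗ lookup z₁ i)
              ≡⟨ trans (cong (_⊕ sumF (λ c → b (rep c) ⊗ v c ⊗ lookup z₁ i)) (sym (sumF-⊕ ℓ _ _))) (sym (sumF-⊕ ℓ _ _)) ⟩
            sumF (λ c → p c ⊗ lookup (a c) i ⊕ μ c ⊗ w c ⊗ ⊝ lookup z₀ i ⊕ b (rep c) ⊗ v c ⊗ lookup z₁ i)
              ≡⟨ sumF-cong ℓ (λ c → trans
                   (solve 7 (λ b m r a v y z → (b :+ :- (m :* r)) :* a :+ m :* (r :* v) :* :- z :+ b :* v :* y := b :* (a :+ v :* y) :+ :- (m :* r :* (a :+ v :* z))) refl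
                     (b (rep c)) (μ c) (wt (rep c)) (lookup (a c) i) (v c) (lookup z₁ i) (lookup z₀ i))
                   (cong₂ (λ y s → b (rep c) ⊗ y ⊕ s) (sym (lookup-shift (a c) (v c) z₁ i)) (sym (tail-sum c (μ c) b (proj₂ (prop c)) i)))) ⟩
            sumF (λ c → b (rep c) ⊗ lookup (h c) i ⊕ ∑ (tails c) (λ j → b j ⊗ lookup (X c j) i))
              ≡⟨ trans (sumF-⊕ ℓ _ _) (total≡0 i) ⟩
            0# ∎)
          everywhere : ∀ c j → cls j ≡ c → b j ≡ μ c ⊗ wt j
          everywhere c j e = case j Fin.≟ rep c of λ
            { (yes refl) → x⊝y≡0⇒x≡y (proj₁ independent c)
            ; (no ne)    → proj₂ (prop c) j (∈-filter⁺ (tail? c) (∈-allFin j) (e , ne)) }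
          orthogonal : sumF (λ c → μ c ⊗ w c) ≡ 0#
          orthogonal = trans (solve 1 (λ s → s := :- (:- s)) refl _) (trans (cong ⊝_ (proj₁ (proj₂ independent))) (solve 0 (:- :0 := :0) refl))

    mostly-concentric : Mostly (λ n S t → ¬ ¬ Found S class-weight)
    mostly-concentric = mostly-restrict (mostly-∀ ℓ (λ c → mostly-good _ (weights wt (members c)) (weights-≢0 wt wt≢0 (members c)) K)) (mostly-outside 0)
      λ n S G? t t∈ out → out [] z≤n >>= λ (u , u∈ , u∉) → found-concentric S u u∉ (proj₂ (∈-filter⁻ G? {xs = S} u∈))

    private
      mostly-config′ : ∀ r (v : Fin r → 𝔽) → 1 ≤ r → Mostly (λ n S t → ¬ ¬ Config v S)
      mostly-config′ (suc r) v _ = mostly-config r v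

    mostly-translates : 1 ≤ ℓ → (v : Fin ℓ → 𝔽) → (∀ c → class-weight c ≡ 0#) → Mostly (λ n S t → ¬ ¬ Found S (λ c → wt (rep c) ⊗ v c))
    mostly-translates 1≤ℓ v balanced = mostly-restrict (mostly-∀ ℓ (λ c → mostly-good _ (weights wt (tails c)) (weights-≢0 wt wt≢0 (tails c)) K)) (mostly-config′ ℓ v 1≤ℓ)
      λ n S G? t t∈ conf → conf >>= found-translates S (filter G? S) (λ u u∈ → proj₁ (∈-filter⁻ G? {xs = S} u∈)) v balanced
        (λ u u∈ → proj₂ (∈-filter⁻ G? {xs = S} u∈))

  -- Relations between the columns

  unit : ∀ {r} → Fin r → Fin r → 𝔽
  unit c d = gate (c Fin.≟ d) 1#

  unit-diag : ∀ {r} (c : Fin r) → unit c c ≡ 1#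
  unit-diag c with c Fin.≟ c
  ... | yes _ = refl
  ... | no ne = ⊥-elim (ne refl)

  unit-off : ∀ {r} {c d : Fin r} → c ≢ d → unit c d ≡ 0#
  unit-off {c = c} {d} ne with c Fin.≟ d
  ... | yes e = ⊥-elim (ne e)
  ... | no _  = refl

  sumF-unit : ∀ r (c : Fin r) (f : Fin r → 𝔽) → sumF (λ d → unit c d ⊗ f d) ≡ f c
  sumF-unit r c f = trans (sumF≡∑ r _) (trans
    (∑-single (Uniq.allFin⁺ r) (∈-allFin c) (λ d _ ne → trans (cong (_⊗ f d) (unit-off (ne ∘ sym))) (⊗-zeroˡ _)))
    (trans (cong (_⊗ f c) (unit-diag c)) (⊗-identityˡ _)))

  private
    ⊕-multiple : ∀ m (e v g : Fin m → 𝔽) s → sumF (λ i → e i ⊗ (v i ⊕ s ⊗ g i)) ≡ sumF (λ i → e i ⊗ v i) ⊕ s ⊗ sumF (λ i → e i ⊗ g i)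
    ⊕-multiple m e v g s = begin
      sumF (λ i → e i ⊗ (v i ⊕ s ⊗ g i)) ≡⟨ sumF-cong m (λ i → solve 4 (λ e v s g → e :* (v :+ s :* g) := e :* v :+ s :* (e :* g)) refl (e i) (v i) s (g i)) ⟩
      sumF (λ i → e i ⊗ v i ⊕ s ⊗ (e i ⊗ g i)) ≡⟨ sumF-⊕ m _ _ ⟩
      sumF (λ i → e i ⊗ v i) ⊕ sumF (λ i → s ⊗ (e i ⊗ g i)) ≡⟨ cong (sumF (λ i → e i ⊗ v i) ⊕_) (sumF-⊗ m s _) ⟩
      sumF (λ i → e i ⊗ v i) ⊕ s ⊗ sumF (λ i → e i ⊗ g i) ∎
      where open ≡-Reasoning

    ⊗-⊕-multiple : ∀ m (e e′ g : Fin m → 𝔽) s → sumF (λ i → (e i ⊕ s ⊗ e′ i) ⊗ g i) ≡ sumF (λ i → e i ⊗ g i) ⊕ s ⊗ sumF (λ i → e′ i ⊗ g i)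
    ⊗-⊕-multiple m e e′ g s = trans (sumF-cong m (λ i → ⊗-comm _ (g i))) (trans (⊕-multiple m g e e′ s)
      (cong₂ (λ a b → a ⊕ s ⊗ b) (sumF-cong m (λ i → ⊗-comm (g i) _)) (sumF-cong m (λ i → ⊗-comm (g i) _))))

  Separated : ∀ {m} → List (Point m) → (Fin m → 𝔽) → Set
  Separated {m} gs v = Σ (Fin m → 𝔽) λ e → (∀ g → g ∈ gs → sumF (λ i → e i ⊗ lookup g i) ≡ 0#) × sumF (λ i → e i ⊗ v i) ≡ 1#

  -- Linear duality by recursion on the generators. If g is not in the span of the others, its
  -- functional e has e(g) = 1, and v - e(v) g is tested against the others. A functional e′
  -- separating that vector is corrected to e′ - e′(g) e, which also kills g.
  span-or-separated : ∀ {m} (gs : List (Point m)) (v : Fin m → 𝔽) → Span gs v ⊎ Separated gs v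
  span-or-separated {m} [] v with Finₚ.all? (λ i → v i ≟ᶠ 0#)
  ... | yes h = inj₁ h
  ... | no h with Finₚ.¬∀⟶∃¬ m _ (λ i → v i ≟ᶠ 0#) h
  ... | i , ne = inj₂ ((λ j → inv (v i) ne ⊗ unit i j) , (λ _ ()) , (begin
      sumF (λ j → inv (v i) ne ⊗ unit i j ⊗ v j) ≡⟨ sumF-cong m (λ j → ⊗-assoc _ _ _) ⟩
      sumF (λ j → inv (v i) ne ⊗ (unit i j ⊗ v j)) ≡⟨ sumF-⊗ m _ _ ⟩
      inv (v i) ne ⊗ sumF (λ j → unit i j ⊗ v j) ≡⟨ cong (inv (v i) ne ⊗_) (sumF-unit m i v) ⟩
      inv (v i) ne ⊗ v i ≡⟨ trans (⊗-comm _ (v i)) (inv-right (v i) ne) ⟩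
      1# ∎))
    where open ≡-Reasoning
  span-or-separated {m} (g ∷ gs) v with span-or-separated gs (lookup g)
  ... | inj₁ g∈ = Sum.map (span-∷ g gs) extend (span-or-separated gs v)
    where
    kills : ∀ (hs : List (Point m)) e → (∀ h → h ∈ hs → sumF (λ i → e i ⊗ lookup h i) ≡ 0#) → ∀ {u} → Span hs u → sumF (λ i → e i ⊗ u i) ≡ 0#
    kills []       e k h       = sumF-zero m (λ i → trans (cong (e i ⊗_) (h i)) (⊗-zeroʳ _))
    kills (h ∷ hs) e k {u} (c , s) = trans
      (solve 2 (λ a z → a := a :+ z :* :0) refl (sumF (λ i → e i ⊗ u i)) c)
      (trans (cong (λ z → sumF (λ i → e i ⊗ u i) ⊕ c ⊗ z) (sym (k h (here refl))))
        (trans (sym (⊕-multiple m e u (lookup h) c)) (kills hs e (λ x x∈ → k x (there x∈)) s)))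
    extend : Separated gs v → Separated (g ∷ gs) v
    extend (e , k , one) = e , (λ { h (here refl) → kills gs e k g∈ ; h (there h∈) → k h h∈ }) , one
  ... | inj₂ (e , k , one) with span-or-separated gs (λ i → v i ⊕ ⊝ sumF (λ i → e i ⊗ v i) ⊗ lookup g i)
  ... | inj₁ s = inj₁ (⊝ sumF (λ i → e i ⊗ v i) , s)
  ... | inj₂ (e′ , k′ , one′) = inj₂ ((λ i → e′ i ⊕ ⊝ b ⊗ e i) , kills , unital)
    where
    b = sumF (λ i → e′ i ⊗ lookup g i)
    kills : ∀ h → h ∈ g ∷ gs → sumF (λ i → (e′ i ⊕ ⊝ b ⊗ e i) ⊗ lookup h i) ≡ 0#
    kills h (here refl) = trans (⊗-⊕-multiple m e′ e (lookup g) (⊝ b)) (trans (cong (λ z → b ⊕ ⊝ b ⊗ z) one) (solve 1 (λ b → b :+ :- b :* :1 := :0) refl b))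
    kills h (there h∈)  = trans (⊗-⊕-multiple m e′ e (lookup h) (⊝ b)) (trans (cong₂ (λ y z → y ⊕ ⊝ b ⊗ z) (k′ h h∈) (k h h∈)) (solve 1 (λ b → :0 :+ :- b :* :0 := :0) refl b))
    unital : sumF (λ i → (e′ i ⊕ ⊝ b ⊗ e i) ⊗ v i) ≡ 1#
    unital = trans (⊗-⊕-multiple m e′ e v (⊝ b)) (trans
      (solve 3 (λ y b z → y :+ :- b :* z := y :+ :- z :* b) refl (sumF (λ i → e′ i ⊗ v i)) b (sumF (λ i → e i ⊗ v i)))
      (trans (sym (⊕-multiple m e′ v (lookup g) (⊝ sumF (λ i → e i ⊗ v i)))) one′))

  module _ {m ℓ : ℕ} (V : Fin m → Fin ℓ → 𝔽) where

    private
      column : Fin ℓ → Point m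
      column c = tabulate (λ i → V i c)

      others : Fin ℓ → List (Fin ℓ)
      others c = filter (λ d → ¬? (c Fin.≟ d)) (allFin ℓ)

      coefficients : (cs : List (Fin ℓ)) {v : Fin m → 𝔽} → Span (map column cs) v →
        Σ (Fin ℓ → 𝔽) λ w → (∀ c → c ∉ cs → w c ≡ 0#) × (∀ i → v i ⊕ sumF (λ c → V i c ⊗ w c) ≡ 0#)
      coefficients []       h = (λ _ → 0#) , (λ _ _ → refl) ,
        λ i → trans (cong₂ _⊕_ (h i) (sumF-zero ℓ (λ c → ⊗-zeroʳ (V i c)))) (⊕-identityˡ 0#)
      coefficients (c ∷ cs) {v} (s , h) with coefficients cs h
      ... | w , w∉ , e = (λ d → w d ⊕ s ⊗ unit c d) ,
            (λ d d∉ → trans (cong₂ (λ a b → a ⊕ s ⊗ b) (w∉ d (d∉ ∘ there)) (unit-off {c = c} {d} (λ { refl → d∉ (here refl) }))) (solve 1 (λ s → :0 :+ s :* :0 := :0) refl s)) ,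
            λ i → trans (cong (v i ⊕_) (trans (⊕-multiple ℓ (V i) w (unit c) s)
                    (cong (λ z → sumF (λ d → V i d ⊗ w d) ⊕ s ⊗ z) (trans (sumF-cong ℓ (λ d → ⊗-comm (V i d) _)) (sumF-unit ℓ c (V i))))))
                  (trans (solve 4 (λ v S s x → v :+ (S :+ s :* x) := v :+ s :* x :+ S) refl (v i) (sumF (λ d → V i d ⊗ w d)) s (V i c))
                    (trans (cong (λ z → v i ⊕ s ⊗ z ⊕ sumF (λ d → V i d ⊗ w d)) (sym (Vecₚ.lookup∘tabulate (λ i → V i c) i))) (e i)))

      search : ∀ r {P Q : Fin r → Set} → (∀ c → P c ⊎ Q c) → ∃ P ⊎ (∀ c → Q c)
      search zero    h = inj₂ λ ()
      search (suc r) h with h zero | search r (h ∘ suc)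
      ... | inj₁ p | _            = inj₁ (zero , p)
      ... | inj₂ _ | inj₁ (c , p) = inj₁ (suc c , p)
      ... | inj₂ x | inj₂ xs      = inj₂ λ { zero → x ; (suc c) → xs c }

    -- Either some column lies in the span of the others, and the dependency has coefficient 1 at
    -- that column, or each column is separated from the others, and the separating functionals are
    -- the rows of a left inverse.
    kernel-or-inverse :
      (Σ (Fin ℓ → 𝔽) λ w → (∃[ c ] w c ≢ 0#) × (∀ i → sumF (λ c → V i c ⊗ w c) ≡ 0#)) ⊎
      (Σ (Fin ℓ → Fin m → 𝔽) λ E → ∀ c d → sumF (λ i → E c i ⊗ V i d) ≡ unit c d)
    kernel-or-inverse with search ℓ (λ c → span-or-separated (map column (others c)) (λ i → V i c))
    ... | inj₁ (c , s) with coefficients (others c) s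
    ... | w , w∉ , e = inj₁ ((λ d → w d ⊕ 1# ⊗ unit c d) ,
            (c , λ z → 0≢1 (trans (sym z) (trans (cong₂ (λ a b → a ⊕ 1# ⊗ b) (w∉ c (λ c∈ → proj₂ (∈-filter⁻ (λ d → ¬? (c Fin.≟ d)) {xs = allFin ℓ} c∈) refl)) (unit-diag c))
              (solve 0 (:0 :+ :1 :* :1 := :1) refl)))) ,
            λ i → trans (⊕-multiple ℓ (V i) w (unit c) 1#) (trans
              (cong (λ z → sumF (λ d → V i d ⊗ w d) ⊕ 1# ⊗ z) (trans (sumF-cong ℓ (λ d → ⊗-comm (V i d) _)) (sumF-unit ℓ c (V i))))
              (trans (solve 2 (λ S x → S :+ :1 :* x := x :+ S) refl (sumF (λ d → V i d ⊗ w d)) (V i c)) (e i))))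
    kernel-or-inverse | inj₂ duals = inj₂ ((λ c → proj₁ (duals c)) , λ c d → dual c d (c Fin.≟ d))
      where
      dual : ∀ c d → Dec (c ≡ d) → sumF (λ i → proj₁ (duals c) i ⊗ V i d) ≡ unit c d
      dual c d (yes refl) = trans (proj₂ (proj₂ (duals c))) (sym (unit-diag c))
      dual c d (no ne)    = trans (sumF-cong m (λ i → cong (proj₁ (duals c) i ⊗_) (sym (Vecₚ.lookup∘tabulate (λ i → V i d) i))))
        (trans (proj₁ (proj₂ (duals c)) (column d) (∈-map⁺ column (∈-filter⁺ (λ d → ¬? (c Fin.≟ d)) (∈-allFin d) ne))) (sym (unit-off ne)))

  -- The affine span

  lookup-injective : {A : Set} {xs : List A} → Unique xs → ∀ i j → Data.List.lookup xs i ≡ Data.List.lookup xs j → i ≡ j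
  lookup-injective (x∉ ∷ u) zero    zero    e = refl
  lookup-injective (x∉ ∷ u) zero    (suc j) e = ⊥-elim (All¬⇒¬Any x∉ (subst (_∈ _) (sym e) (∈-lookup j)))
  lookup-injective (x∉ ∷ u) (suc i) zero    e = ⊥-elim (All¬⇒¬Any x∉ (subst (_∈ _) e (∈-lookup i)))
  lookup-injective (x∉ ∷ u) (suc i) (suc j) e = cong suc (lookup-injective u i j e)

  SatisfiesAt : ∀ {k n} → (Fin k → 𝔽) → (Fin k → Point n) → Set
  SatisfiesAt b x = ∀ t → sumF (λ j → b j ⊗ lookup (x j) t) ≡ 0#

  -- The head of `D` serves as base point. A linear dependency between the differences from it is a
  -- balanced relation supported on `D`, with minus the sum of the coefficients at the base point.
  affDim-independent : ∀ {k n} (x : Fin k → Point n) (D : List (Fin k)) → Unique D →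
    (∀ b → (∀ j → j ∉ D → b j ≡ 0#) → sumF b ≡ 0# → SatisfiesAt b x → ∀ j → b j ≡ 0#) →
    ∀ d → d < length D → AffDimAtLeast x d
  affDim-independent {k} {n} x (j₀ ∷ D) (j₀∉ ∷ u) indep d (s≤s d≤) = J , (λ _ → j₀) , lin
    where
    J : Fin d → Fin k
    J s = Data.List.lookup D (Fin.inject≤ s d≤)
    J∈ : ∀ s → J s ∈ D
    J∈ s = ∈-lookup (Fin.inject≤ s d≤)
    J-injective : ∀ {s s′} → J s ≡ J s′ → s ≡ s′
    J-injective e = Finₚ.inject≤-injective d≤ d≤ _ _ (lookup-injective u _ _ e)
    lin : LinIndep (λ s → diff (x (J s)) (x j₀))
    lin c h s = begin
      c s ≡⟨ sumF-unit d s c ⟨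
      sumF (λ s′ → unit s s′ ⊗ c s′) ≡⟨ sumF-cong d (λ s′ → trans (⊗-comm _ (c s′)) (cong (c s′ ⊗_) (at s′ (s Fin.≟ s′)))) ⟩
      b (J s) ≡⟨ indep b outside-D b-balanced b-satisfied (J s) ⟩
      0# ∎
      where
      open ≡-Reasoning
      e : Fin d → Fin k → 𝔽
      e s j = unit (J s) j ⊕ ⊝ unit j₀ j
      b : Fin k → 𝔽
      b j = sumF (λ s → c s ⊗ e s j)
      j₀≢J : ∀ s → j₀ ≢ J s
      j₀≢J s eq = All¬⇒¬Any j₀∉ (subst (_∈ D) (sym eq) (J∈ s))
      at : ∀ s′ → Dec (s ≡ s′) → unit s s′ ≡ e s′ (J s)
      at s′ (yes refl) = trans (unit-diag s) (sym (trans (cong₂ (λ y z → y ⊕ ⊝ z) (unit-diag (J s)) (unit-off (j₀≢J s))) (solve 0 (:1 :+ :- :0 := :1) refl)))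
      at s′ (no ne)    = trans (unit-off ne) (sym (trans (cong₂ (λ y z → y ⊕ ⊝ z) (unit-off (λ eq → ne (sym (J-injective eq)))) (unit-off (j₀≢J s))) (solve 0 (:0 :+ :- :0 := :0) refl)))
      outside-D : ∀ j → j ∉ j₀ ∷ D → b j ≡ 0#
      outside-D j j∉ = sumF-zero d (λ s → trans (cong₂ (λ y z → c s ⊗ (y ⊕ ⊝ z)) (unit-off {c = J s} {j} (λ { refl → j∉ (there (J∈ s)) })) (unit-off {c = j₀} {j} (λ { refl → j∉ (here refl) })))
        (solve 1 (λ c → c :* (:0 :+ :- :0) := :0) refl (c s)))
      combine : ∀ (f : Fin k → 𝔽) → sumF (λ j → b j ⊗ f j) ≡ sumF (λ s → c s ⊗ (f (J s) ⊕ ⊝ f j₀))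
      combine f = begin
        sumF (λ j → b j ⊗ f j) ≡⟨ sumF-cong k (λ j → sym (sumF-⊗ʳ d (f j) _)) ⟩
        sumF (λ j → sumF (λ s → c s ⊗ e s j ⊗ f j)) ≡⟨ sumF-swap k d _ ⟩
        sumF (λ s → sumF (λ j → c s ⊗ e s j ⊗ f j)) ≡⟨ sumF-cong d (λ s → trans (sumF-cong k (λ j → ⊗-assoc (c s) _ (f j))) (sumF-⊗ k (c s) _)) ⟩
        sumF (λ s → c s ⊗ sumF (λ j → e s j ⊗ f j)) ≡⟨ sumF-cong d (λ s → cong (c s ⊗_) (evaluate s)) ⟩
        sumF (λ s → c s ⊗ (f (J s) ⊕ ⊝ f j₀)) ∎
        where
        evaluate : ∀ s → sumF (λ j → e s j ⊗ f j) ≡ f (J s) ⊕ ⊝ f j₀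
        evaluate s = begin
          sumF (λ j → (unit (J s) j ⊕ ⊝ unit j₀ j) ⊗ f j) ≡⟨ sumF-cong k (λ j → solve 3 (λ u v f → (u :+ :- v) :* f := u :* f :+ :- :1 :* (v :* f)) refl _ _ (f j)) ⟩
          sumF (λ j → unit (J s) j ⊗ f j ⊕ ⊝ 1# ⊗ (unit j₀ j ⊗ f j)) ≡⟨ trans (sumF-⊕ k _ _) (cong₂ _⊕_ (sumF-unit k (J s) f) (trans (sumF-⊗ k (⊝ 1#) _) (cong (⊝ 1# ⊗_) (sumF-unit k j₀ f)))) ⟩
          f (J s) ⊕ ⊝ 1# ⊗ f j₀ ≡⟨ solve 2 (λ x y → x :+ :- :1 :* y := x :+ :- y) refl _ _ ⟩
          f (J s) ⊕ ⊝ f j₀ ∎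
      b-balanced : sumF b ≡ 0#
      b-balanced = trans (sumF-cong k (λ j → sym (⊗-identityʳ _))) (trans (combine (λ _ → 1#)) (sumF-zero d (λ s → solve 1 (λ c → c :* (:1 :+ :- :1) := :0) refl (c s))))
      b-satisfied : SatisfiesAt b x
      b-satisfied t = trans (combine (λ j → lookup (x j) t)) (trans (sumF-cong d (λ s → cong (c s ⊗_) (sym (Vecₚ.lookup∘tabulate _ t)))) (h t))

  -- Application to the given system

  module _ {m k : ℕ} (A : Matrix m k) (ℓ : ℕ) (balanced : Balanced A) (irreducible : Irreducible A) (classes : NumColClasses A ℓ) where

    RichSolution : ∀ {n} → List (Point n) → Set
    RichSolution {n} P = Σ (Fin k → Point n) λ x → (∀ j → x j ∈ P) × IsSolution A x × BalancedEqsPreserve A x × AffDimAtLeast x ((k ∸ ℓ) ⊓ (k ∸ 2))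

    private
      cls : Fin k → Fin ℓ
      cls = proj₁ classes

      rep : Fin ℓ → Fin k
      rep c = proj₁ (proj₁ (proj₂ classes) c)

      cls-rep : ∀ c → cls (rep c) ≡ c
      cls-rep c = proj₂ (proj₁ (proj₂ classes) c)

      to-rep : ∀ j → ColEquiv A j (rep (cls j))
      to-rep j = proj₁ (proj₂ (proj₂ classes) j (rep (cls j))) (sym (cls-rep (cls j)))

      wt : Fin k → 𝔽
      wt j = proj₁ (to-rep j)

      wt≢0 : ∀ j → wt j ≢ 0#
      wt≢0 j = proj₁ (proj₂ (to-rep j))

      V : Fin m → Fin ℓ → 𝔽
      V i c = A i (rep c)

      A≡ : ∀ i j → A i j ≡ wt j ⊗ V i (cls j)
      A≡ i j = proj₂ (proj₂ (to-rep j)) i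

      open Classes cls rep cls-rep wt wt≢0

      Nondegenerate : (Fin ℓ → 𝔽) → Set
      Nondegenerate w = (∃[ c ] w c ≢ 0#) ⊎ ℓ ≤ 1

      Goal : Set
      Goal = Σ (Fin ℓ → 𝔽) λ w → (∀ i → sumF (λ c → V i c ⊗ w c) ≡ 0#) × Nondegenerate w × Mostly (λ n S t → ¬ ¬ Found S w)

      -- Balancedness of each row, grouped by classes. It makes the class weights an admissible
      -- choice of w.
      class-weight-kernel : ∀ i → sumF (λ c → V i c ⊗ class-weight c) ≡ 0#
      class-weight-kernel i = begin
        sumF (λ c → V i c ⊗ class-weight c) ≡⟨ sumF-cong ℓ (λ c → ∑-⊗ (members c) (V i c) wt) ⟨
        sumF (λ c → ∑ (members c) (λ j → V i c ⊗ wt j)) ≡⟨ fibres (λ c j → V i c ⊗ wt j) ⟨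
        sumF (λ j → V i (cls j) ⊗ wt j) ≡⟨ sumF-cong k (λ j → trans (⊗-comm _ (wt j)) (sym (A≡ i j))) ⟩
        sumF (λ j → A i j) ≡⟨ balanced i ⟩
        0# ∎
        where open ≡-Reasoning

      -- With a left inverse of V the system splits into one equation for each class.
      reducible : 2 ≤ ℓ → (E : Fin ℓ → Fin m → 𝔽) → (∀ c d → sumF (λ i → E c i ⊗ V i d) ≡ unit c d) → Reducible A
      reducible 2≤ℓ E dual = ℓ , B , ((λ c → E c , λ j → refl) , (λ i → V i , recover i)) , ℓ , 2≤ℓ , cls , proj₁ (proj₂ classes) ,
        (λ c → c , λ j ne → decidable-stable (cls j Fin.≟ c) (λ ne′ → ne (trans (B≡ c j) (trans (cong (wt j ⊗_) (unit-off (ne′ ∘ sym))) (⊗-zeroʳ _)))))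
        where
        B : Matrix ℓ k
        B c j = sumF (λ i → E c i ⊗ A i j)
        B≡ : ∀ c j → B c j ≡ wt j ⊗ unit c (cls j)
        B≡ c j = trans (sumF-cong m (λ i → trans (cong (E c i ⊗_) (A≡ i j)) (solve 3 (λ e w v → e :* (w :* v) := w :* (e :* v)) refl (E c i) (wt j) _)))
          (trans (sumF-⊗ m (wt j) _) (cong (wt j ⊗_) (dual c (cls j))))
        recover : ∀ i j → A i j ≡ sumF (λ c → V i c ⊗ B c j)
        recover i j = sym (begin
          sumF (λ c → V i c ⊗ B c j) ≡⟨ sumF-cong ℓ (λ c → trans (cong (V i c ⊗_) (B≡ c j)) (trans
                                            (cong (λ u → V i c ⊗ (wt j ⊗ u)) (unit-sym c (cls j)))
                                            (solve 3 (λ v w u → v :* (w :* u) := u :* (w :* v)) refl (V i c) (wt j) _))) ⟩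
          sumF (λ c → unit (cls j) c ⊗ (wt j ⊗ V i c)) ≡⟨ sumF-unit ℓ (cls j) _ ⟩
          wt j ⊗ V i (cls j) ≡⟨ A≡ i j ⟨
          A i j ∎)
          where
          open ≡-Reasoning
          unit-sym : ∀ c d → unit c d ≡ unit d c
          unit-sym c d with c Fin.≟ d
          ... | yes refl = sym (unit-diag c)
          ... | no ne    = sym (unit-off (ne ∘ sym))

      negligible : Goal
      negligible with Finₚ.all? (λ c → class-weight c ≟ᶠ 0#)
      ... | no some = class-weight , class-weight-kernel , inj₁ (Finₚ.¬∀⟶∃¬ ℓ _ (λ c → class-weight c ≟ᶠ 0#) some) , mostly-concentric
      ... | yes zeros with ℓ ≤? 1
      ... | yes ℓ≤1 = class-weight , class-weight-kernel , inj₂ ℓ≤1 , mostly-concentric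
      ... | no ℓ≰1 with kernel-or-inverse V
      ... | inj₂ (E , dual) = ⊥-elim (irreducible (reducible (≰⇒> ℓ≰1) E dual))
      ... | inj₁ (w , (c₀ , w≢0) , kernel) = (λ c → wt (rep c) ⊗ v c) ,
            (λ i → trans (sumF-cong ℓ (λ c → cong (V i c ⊗_) (v≡ c))) (kernel i)) ,
            inj₁ (c₀ , λ e → w≢0 (trans (sym (v≡ c₀)) e)) ,
            mostly-translates (≤-trans (s≤s z≤n) (≰⇒> ℓ≰1)) v zeros
        where
        -- `mostly-translates` returns `wt (rep c)` times v_c, so the kernel vector is divided by
        -- that weight beforehand.
        v : Fin ℓ → 𝔽
        v c = inv (wt (rep c)) (wt≢0 (rep c)) ⊗ w c
        v≡ : ∀ c → wt (rep c) ⊗ v c ≡ w c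
        v≡ c = trans (sym (⊗-assoc _ _ _)) (trans (cong (_⊗ w c) (inv-right (wt (rep c)) _)) (⊗-identityˡ _))

      -- Affine relations between points are linear relations between their homogenisations.
      homogenise : ∀ {n} → Point n → Point (suc n)
      homogenise p = 1# ∷ p

      module _ (w : Fin ℓ → 𝔽) where

        Relations : ∀ {n} → (Fin k → Point n) → Set
        Relations x = ∀ (b : Fin k → 𝔽) → sumF b ≡ 0# → SatisfiesAt b x → ClassRelation w b

        -- Since b_j = μ_c `wt j` on class c, the new row varies within a class by the same ratios
        -- as the rows of `A`. Conversely, dropping the new row keeps the scalar.
        preserves : ∀ {n} (x : Fin k → Point n) → Relations x → BalancedEqsPreserve A x
        preserves x rel b b-balanced sat j j′ with rel b b-balanced sat
        ... | μ , b≡ , _ = forth , λ { (s , s≢0 , e) → s , s≢0 , e ∘ suc }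
          where
          forth : ColEquiv A j j′ → ColEquiv (λ i → Functional._∷_ b A i) j j′
          forth equiv = s , ⊗-≢0 (wt≢0 j) (inv-≢0 (wt j′) (wt≢0 j′)) ,
              λ { zero → trans (b≡ j) (trans (scaled (μ (cls j))) (cong (s ⊗_) (trans (cong (λ c → μ c ⊗ wt j′) same) (sym (b≡ j′)))))
                ; (suc i) → trans (A≡ i j) (trans (⊗-comm _ _) (trans (scaled (V i (cls j))) (cong (s ⊗_)
                    (trans (cong (λ c → V i c ⊗ wt j′) same) (trans (⊗-comm _ (wt j′)) (sym (A≡ i j′))))))) }
            where
            same : cls j ≡ cls j′
            same = proj₂ (proj₂ (proj₂ classes) j j′) equiv
            s = wt j ⊗ inv (wt j′) (wt≢0 j′)
            scaled : ∀ y → y ⊗ wt j ≡ s ⊗ (y ⊗ wt j′)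
            scaled y = trans (trans (sym (⊗-identityʳ _)) (cong (y ⊗ wt j ⊗_) (sym (inv-right (wt j′) (wt≢0 j′)))))
              (solve 4 (λ y w w′ i → y :* w :* (w′ :* i) := w :* i :* (y :* w′)) refl y (wt j) (wt j′) _)

        private
          free : List (Fin k)
          free = filter (λ j → ¬? (j Fin.≟ rep (cls j))) (allFin k)

          free-unique : Unique free
          free-unique = Uniq.filter⁺ _ (Uniq.allFin⁺ k)

          rep∉free : ∀ c → rep c ∉ free
          rep∉free c c∈ = proj₂ (∈-filter⁻ (λ j → ¬? (j Fin.≟ rep (cls j))) {xs = allFin k} c∈) (cong rep (sym (cls-rep c)))

          free-long : k ∸ ℓ ≤ length free
          free-long = m≤n+o⇒m∸n≤o k ℓ (begin
            k ≡⟨ length-tabulate {n = k} id ⟨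
            length (allFin k) ≤⟨ count-+ (λ j → j Fin.≟ rep (cls j)) (λ j → ¬? (j Fin.≟ rep (cls j))) (allFin k)
                                            (λ j _ → case j Fin.≟ rep (cls j) of λ { (yes e) → inj₁ e ; (no ne) → inj₂ ne }) ⟩
            length (filter (λ j → j Fin.≟ rep (cls j)) (allFin k)) + length free ≤⟨ +-monoˡ-≤ (length free) (unique-⊆⇒length≤ (Uniq.filter⁺ _ (Uniq.allFin⁺ k))
                                            (λ j j∈ → subst (_∈ map rep (allFin ℓ)) (sym (proj₂ (∈-filter⁻ (λ j → j Fin.≟ rep (cls j)) {xs = allFin k} j∈)))
                                            (∈-map⁺ rep (∈-allFin (cls j))))) ⟩
            length (map rep (allFin ℓ)) + length free ≡⟨ cong (_+ length free) (trans (length-map rep (allFin ℓ)) (length-tabulate {n = ℓ} id)) ⟩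
            ℓ + length free ∎)
            where open ≤-Reasoning

          μ-zero : ∀ {b : Fin k → 𝔽} {μ : Fin ℓ → 𝔽} → (∀ j → b j ≡ μ (cls j) ⊗ wt j) → ∀ c → b (rep c) ≡ 0# → μ c ≡ 0#
          μ-zero {b} {μ} b≡ c e = ⊗-cancelˡ (wt≢0 (rep c)) (trans (⊗-comm _ (μ c)) (trans (cong (λ d → μ d ⊗ wt (rep c)) (sym (cls-rep c)))
            (trans (sym (b≡ (rep c))) (trans e (sym (⊗-zeroʳ _))))))

          b-zero : ∀ {b : Fin k → 𝔽} {μ : Fin ℓ → 𝔽} → (∀ j → b j ≡ μ (cls j) ⊗ wt j) → (∀ c → μ c ≡ 0#) → ∀ j → b j ≡ 0#
          b-zero b≡ μ≡0 j = trans (b≡ j) (trans (cong (_⊗ wt j) (μ≡0 (cls j))) (⊗-zeroˡ _))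

        -- A relation that vanishes at `rep c` has μ_c = 0. If w is nonzero at c₀, the
        -- non-representatives together with `rep c₀` thus carry only relations with μ concentrated
        -- at c₀, and orthogonality to w removes that last multiplier. If ℓ ≤ 1, the at least k - 1
        -- non-representatives alone suffice for dimension k - 2.
        dimension : ∀ {n} (x : Fin k → Point n) → Relations x → Nondegenerate w → AffDimAtLeast x ((k ∸ ℓ) ⊓ (k ∸ 2))
        dimension x rel (inj₁ (c₀ , w≢0)) = affDim-independent x (rep c₀ ∷ free) (¬Any⇒All¬ free (rep∉free c₀) ∷ free-unique) indep _
            (s≤s (≤-trans (m⊓n≤m _ _) free-long))
          where
          indep : ∀ b → (∀ j → j ∉ rep c₀ ∷ free → b j ≡ 0#) → sumF b ≡ 0# → SatisfiesAt b x → ∀ j → b j ≡ 0#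
          indep b outside-D b-balanced sat with rel b b-balanced sat
          ... | μ , b≡ , μ⊥w = b-zero {b} {μ} b≡ μ≡0
            where
            off : ∀ c → c ≢ c₀ → μ c ≡ 0#
            off c ne = μ-zero {b} {μ} b≡ c (outside-D (rep c) λ
              { (here e)   → ne (trans (sym (cls-rep c)) (trans (cong cls e) (cls-rep c₀)))
              ; (there c∈) → rep∉free c c∈ })
            μ≡0 : ∀ c → μ c ≡ 0#
            μ≡0 c with c Fin.≟ c₀
            ... | no ne    = off c ne
            ... | yes refl = ⊗-cancelˡ w≢0 (trans (⊗-comm (w c) (μ c)) (trans (sym (trans (sumF≡∑ ℓ _)
                  (∑-single (Uniq.allFin⁺ ℓ) (∈-allFin c) (λ d _ ne → trans (cong (_⊗ w d) (off d ne)) (⊗-zeroˡ _))))) (trans μ⊥w (sym (⊗-zeroʳ _)))))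
        dimension x rel (inj₂ ℓ≤1) = by-size k refl
          where
          indep : ∀ b → (∀ j → j ∉ free → b j ≡ 0#) → sumF b ≡ 0# → SatisfiesAt b x → ∀ j → b j ≡ 0#
          indep b outside-D b-balanced sat with rel b b-balanced sat
          ... | μ , b≡ , _ = b-zero {b} {μ} b≡ (λ c → μ-zero {b} {μ} b≡ c (outside-D (rep c) (rep∉free c)))
          none : ∀ {d} → d ≡ 0 → AffDimAtLeast x d
          none refl = (λ ()) , (λ ()) , λ _ _ ()
          by-size : ∀ k′ → k ≡ k′ → AffDimAtLeast x ((k ∸ ℓ) ⊓ (k ∸ 2))
          -- For k ≤ 1 truncation makes the required dimension 0, and k - 2 < k - 1 need not hold.
          by-size zero          e = none (trans (cong (λ z → (k ∸ ℓ) ⊓ (z ∸ 2)) e) (⊓-zeroʳ _))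
          by-size (suc zero)    e = none (trans (cong (λ z → (k ∸ ℓ) ⊓ (z ∸ 2)) e) (⊓-zeroʳ _))
          by-size (suc (suc r)) e = affDim-independent x free free-unique indep _ (begin-strict
            (k ∸ ℓ) ⊓ (k ∸ 2) ≤⟨ m⊓n≤n (k ∸ ℓ) (k ∸ 2) ⟩
            k ∸ 2 ≡⟨ cong (_∸ 2) e ⟩
            r <⟨ n<1+n r ⟩
            suc r ≡⟨ cong (_∸ 1) e ⟨
            k ∸ 1 ≤⟨ ∸-monoʳ-≤ k ℓ≤1 ⟩
            k ∸ ℓ ≤⟨ free-long ⟩
            length free ∎)
            where open ≤-Reasoning

        -- A decidable form of what is needed from `Found`: coefficients and multipliers range over
        -- finite lists of words. As `Found` is known only under double negation, a search for a
        -- suitable tuple is what produces an actual solution.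
        Suitable : ∀ {n} → Vec (Point n) k → Set
        Suitable {n} xs = (∀ i t → sumF (λ j → A i j ⊗ lookup (lookup xs j) t) ≡ 0#) ×
          All (λ bs → (∀ (t : Fin n) → sumF (λ j → lookup bs j ⊗ lookup (lookup xs j) t) ≡ 0#) →
            Any (λ μs → (∀ j → lookup bs j ≡ lookup μs (cls j) ⊗ wt j) × sumF (λ c → lookup μs c ⊗ w c) ≡ 0#) (words 𝔽s ℓ)) (words 𝔽s k)

        suitable? : ∀ {n} → Decidable (Suitable {n})
        suitable? {n} xs = Finₚ.all? (λ i → Finₚ.all? λ t → sumF (λ j → A i j ⊗ lookup (lookup xs j) t) ≟ᶠ 0#) ×-dec
          All.all? (λ bs → Finₚ.all? (λ t → sumF (λ j → lookup bs j ⊗ lookup (lookup xs j) t) ≟ᶠ 0#) →-dec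
            Any.any? (λ μs → Finₚ.all? (λ j → lookup bs j ≟ᶠ lookup μs (cls j) ⊗ wt j) ×-dec (sumF (λ c → lookup μs c ⊗ w c) ≟ᶠ 0#)) (words 𝔽s ℓ)) (words 𝔽s k)

        found⇒suitable : ∀ {n} {S : List (Point n)} → (∀ i → sumF (λ c → V i c ⊗ w c) ≡ 0#) → Found S w → Any Suitable (words S k)
        found⇒suitable {n} {S} kernel f = lose xs∈ (solved , All.tabulate (λ {bs} _ → relation bs))
          where
          open Found f
          xs = tabulate x
          x≡ : ∀ j → lookup xs j ≡ x j
          x≡ = Vecₚ.lookup∘tabulate x
          xs∈ : xs ∈ words S k
          xs∈ = words-complete xs (λ j → subst (_∈ S) (sym (x≡ j)) (x∈S j))
          solved : ∀ i t → sumF (λ j → A i j ⊗ lookup (lookup xs j) t) ≡ 0#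
          solved i t = trans (sumF-cong k (λ j → cong₂ (λ a y → a ⊗ lookup y t) (trans (A≡ i j) (⊗-comm (wt j) _)) (x≡ j))) (solves (V i) (kernel i) t)
          relation : ∀ bs → (∀ t → sumF (λ j → lookup bs j ⊗ lookup (lookup xs j) t) ≡ 0#) →
            Any (λ μs → (∀ j → lookup bs j ≡ lookup μs (cls j) ⊗ wt j) × sumF (λ c → lookup μs c ⊗ w c) ≡ 0#) (words 𝔽s ℓ)
          relation bs h with relations (lookup bs) (λ t → trans (sumF-cong k (λ j → cong (λ y → lookup bs j ⊗ lookup y t) (sym (x≡ j)))) (h t))
          ... | μ , b≡ , μ⊥w = lose (words-complete (tabulate μ) (λ c → ∈-𝔽s _))
                ((λ j → trans (b≡ j) (cong (_⊗ wt j) (sym (μ≡ (cls j))))) , trans (sumF-cong ℓ (λ c → cong (_⊗ w c) (μ≡ c))) μ⊥w)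
            where
            μ≡ : ∀ c → lookup (tabulate μ) c ≡ μ c
            μ≡ = Vecₚ.lookup∘tabulate μ

        dehomogenise : ∀ {n} (P : List (Point n)) → Nondegenerate w → Any Suitable (words (map homogenise P) k) →
          RichSolution P
        dehomogenise {n} P nondeg some with find some
        ... | xs , xs∈ , solved , relation = x , (λ j → proj₁ (proj₂ (preimage j))) ,
              (λ i t → trans (sumF-cong k (λ j → cong (λ y → A i j ⊗ lookup y (suc t)) (sym (xs≡ j)))) (solved i (suc t))) ,
              preserves x rel , dimension x rel nondeg
          where
          preimage : ∀ j → ∃[ p ] (p ∈ P × lookup xs j ≡ homogenise p)
          preimage j = ∈-map⁻ homogenise (words-sound xs xs∈ j)
          x : Fin k → Point n
          x j = proj₁ (preimage j)
          xs≡ : ∀ j → lookup xs j ≡ homogenise (x j)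
          xs≡ j = proj₂ (proj₂ (preimage j))
          rel : Relations x
          rel b b-balanced sat with find (All.lookup relation (words-complete (tabulate b) (λ j → ∈-𝔽s _)) satisfied)
            where
            satisfied : ∀ t → sumF (λ j → lookup (tabulate b) j ⊗ lookup (lookup xs j) t) ≡ 0#
            satisfied t = trans (sumF-cong k (λ j → cong₂ (λ c y → c ⊗ lookup y t) (Vecₚ.lookup∘tabulate b j) (xs≡ j))) (at t)
              where
              at : ∀ t → sumF (λ j → b j ⊗ lookup (homogenise (x j)) t) ≡ 0#
              at zero    = trans (sumF-cong k (λ j → ⊗-identityʳ (b j))) b-balanced
              at (suc t) = sat t
          ... | μs , _ , b≡ , μ⊥w = lookup μs , (λ j → trans (sym (Vecₚ.lookup∘tabulate b j)) (b≡ j)) , μ⊥w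

    Rich : ℚ.ℚ → ℚ.ℚ → Set
    Rich β γ = ∀ (n : ℕ) (S : FinSubset n) → β ℚ.* powℚ γ n ℚ.≤ ℕtoℚ (length (FinSubset.elems S)) →
      RichSolution (FinSubset.elems S)

    private
      -- The property `Found` does not mention the point t. Were it refutable, all points of `P′`
      -- would be exceptions, and `Mostly` would bound the size of `P′` itself, against its density
      -- in dimension `suc n`.
      dense⇒rich : ∀ w → (∀ i → sumF (λ c → V i c ⊗ w c) ≡ 0#) → Nondegenerate w → (neg : Mostly (λ n S t → ¬ ¬ Found S w)) →
        ∀ β γ → (∀ n N → β ℚ.* powℚ γ n ℚ.≤ ℕtoℚ N → factor neg * (q * (1 + rate neg)) ^ suc n < N * (2 + rate neg) ^ suc n) → Rich β γ
      dense⇒rich w kernel nondeg (mostly d c bound) β γ dense n S large =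
        dehomogenise w P nondeg (decidable-stable (Any.any? (suitable? w) (words P′ k)) (¬¬-map (found⇒suitable w kernel) exists))
        where
        P = FinSubset.elems S
        P′ = map homogenise P
        P′-unique : Unique P′
        P′-unique = Uniq.map⁺ (cong Vec.tail) (FinSubset.distinct S)
        exists : ¬ ¬ Found P′ w
        exists none = <⇒≱ (dense n (length P) large) (subst (λ N → N * (2 + d) ^ suc n ≤ c * (q * (1 + d)) ^ suc n) (length-map homogenise P)
          (smallness (bound (suc n) P′ P′ P′-unique P′-unique (λ _ → id) (λ _ _ ¬¬found → ¬¬found none))))

      rich : Goal → Σ ℚ.ℚ λ β → Σ ℚ.ℚ λ γ → (ℚ.0ℚ ℚ.< β) × (ℚ.0ℚ ℚ.< γ) × (γ ℚ.< ℕtoℚ q) × Rich β γ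
      rich (w , kernel , nondeg , neg) =
        let β , γ , 0<β , 0<γ , γ<q , dense = threshold q (rate neg) (factor neg) (≤-trans (s≤s z≤n) 2≤q)
        in β , γ , 0<β , 0<γ , γ<q , dense⇒rich w kernel nondeg neg β γ dense

    rich-solutions : Σ ℚ.ℚ λ β → Σ ℚ.ℚ λ γ → (ℚ.0ℚ ℚ.< β) × (ℚ.0ℚ ℚ.< γ) × (γ ℚ.< ℕtoℚ q) × Rich β γ
    rich-solutions = rich negligible

open import Data.Nat using (ℕ; _∸_; _⊓_)
open import Data.Fin using (Fin)
open import Data.Product using (Σ; _×_; proj₁)
open import Data.List using (length)
open import Data.List.Membership.Propositional using (_∈_)
open import Data.Rational using (ℚ; 0ℚ; _<_; _≤_; _*_)

theoremC : (F : FiniteField) → let open Lin F in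
    ∀ {m k : ℕ} (A : Matrix m k) (ℓ : ℕ) →
    TypeRC A → NonDegenerate A → Irreducible A → NumColClasses A ℓ →
    Σ ℚ λ β → Σ ℚ λ γ → (0ℚ < β) × (0ℚ < γ) × (γ < ℕtoℚ (FiniteField.size F)) ×
    (∀ (n : ℕ) (S : FinSubset n) →
    β * powℚ γ n ≤ ℕtoℚ (length (FinSubset.elems S)) →
    Σ (Fin k → Point n) λ x →
    (∀ j → x j ∈ FinSubset.elems S) ×
    IsSolution A x ×
    BalancedEqsPreserve A x ×
    AffDimAtLeast x ((k ∸ ℓ) ⊓ (k ∸ 2)))
theoremC F A ℓ rc _ irreducible classes = Proof.rich-solutions F A ℓ (proj₁ rc) irreducible classes
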